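{- Let $k\geq 3$ and let $H$ be a $k$-graph. Then there exists an integer $n_0=n_0(H)$ such that for all $n\geq n_0$ with $n\equiv 1\pmod{k-1}$, $$R(P^{(k)}_{n,1},H)\leq (\chi(H)-1)(n-1)+\max\{\tau(k-1,\sigma(H))-2k+3,\ \sigma(H)\}.$$
   Context: A $k$-graph is a $k$-uniform hypergraph. $R(G,H)$ is the least $N$ such that every red/blue colouring of the edges of $K^{(k)}_N$ contains a red copy of $G$ or a blue copy of $H$. A proper colouring is a vertex colouring with no monochromatic edge; $\chi(H)$ is the least number of colours of a proper colouring, and $\sigma(H)$ is the smallest possible size of a colour class in a proper colouring of $H$ with $\chi(H)$ colours. The loose path $P^{(k)}_{n,1}$ ($n=q(k-1)+1$) has vertices $v_1,\dots,v_n$ and edges $\{v_{(i-1)(k-1)+1},\dots,v_{i(k-1)+1}\}$, $i\in[q]$. For integers $j,\alpha\ge1$, $\tau(j,\alpha)$ is the largest $N$ such that some $j$-uniform hypergraph on $N$ vertices has independence number less than $\alpha$ and no two edges meeting in exactly one vertex. -}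

module Defs where

open import Data.Bool using (_∧_)
open import Data.Bool.Properties using () renaming (_≟_ to _≟ᵇ_)
open import Data.Fin using (Fin; zero; suc; toℕ)
open import Data.Fin.Properties using (any?) renaming (_≟_ to _≟ᶠ_)
open import Data.Fin.Subset
  using (Subset; inside; outside; _∈_; _⊆_; _∪_; _∩_; ⊥; ⁅_⁆; ∣_∣)
open import Data.Nat using (ℕ; suc; _+_; _*_; _∸_; _≤_; _<_; _≟_; _≤?_; _<?_)
open import Data.Product using (∃; _×_)
open import Data.Sum using (_⊎_)
open import Data.Vec using (tabulate; []; _∷_)
open import Data.Vec.Properties using (≡-dec)
open import Function using (_∘_)
open import Function.Definitions using (Injective)
open import Relation.Binary using (DecidableEquality)
open import Relation.Binary.PropositionalEquality using (_≡_; _≢_; refl)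
open import Relation.Nullary using (¬_; yes; no; does)
open import Relation.Nullary.Decidable using (_×-dec_)
open import Relation.Unary using (Decidable)

IsLeast : ∀ {ℓ} → (ℕ → Set ℓ) → ℕ → Set ℓ
IsLeast P m = P m × (∀ x → P x → m ≤ x)

IsGreatest : ∀ {ℓ} → (ℕ → Set ℓ) → ℕ → Set ℓ
IsGreatest P m = P m × (∀ x → P x → x ≤ m)

-- A finite hypergraph on the vertex set Fin n.  The edges form a set of
-- subsets (no multiplicities); decidability is automatic classically.
record Hypergraph (n : ℕ) : Set₁ where
  field
    Edge  : Subset n → Set
    edge? : Decidable Edge

open Hypergraph public

Uniform : ∀ {n} → ℕ → Hypergraph n → Set
Uniform k H = ∀ e → Edge H e → ∣ e ∣ ≡ k

image : ∀ {m n} → (Fin m → Fin n) → Subset m → Subset n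
image f []            = ⊥
image f (inside  ∷ p) = ⁅ f zero ⁆ ∪ image (f ∘ suc) p
image f (outside ∷ p) = image (f ∘ suc) p

-- F contains a (not necessarily induced) copy of G.
Contains : ∀ {m n} → Hypergraph n → Hypergraph m → Set
Contains {m} {n} F G =
  ∃ λ (f : Fin m → Fin n) →
    Injective _≡_ _≡_ f × (∀ e → Edge G e → Edge F (image f e))

data Colour : Set where
  red blue : Colour

_≟ᶜ_ : DecidableEquality Colour
red  ≟ᶜ red  = yes refl
red  ≟ᶜ blue = no λ ()
blue ≟ᶜ red  = no λ ()
blue ≟ᶜ blue = yes refl

-- A colouring of the edges of K_N^(k) is given as a function on all subsets
-- of Fin N, of which only the values on k-subsets are ever used.
-- colourGraph k c x is the k-graph of the edges of K_N^(k) with colour x.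
colourGraph : ∀ {N} → ℕ → (Subset N → Colour) → Colour → Hypergraph N
colourGraph k c x = record
  { Edge  = λ e → ∣ e ∣ ≡ k × c e ≡ x
  ; edge? = λ e → (∣ e ∣ ≟ k) ×-dec (c e ≟ᶜ x)
  }

-- r = R(G , H) for k-graphs G and H.
IsRamseyNumber : ∀ {m n} → ℕ → Hypergraph m → Hypergraph n → ℕ → Set
IsRamseyNumber k G H = IsLeast λ N →
  (c : Subset N → Colour) →
    Contains (colourGraph k c red) G ⊎ Contains (colourGraph k c blue) H

Monochromatic : ∀ {n q} → (Fin n → Fin q) → Subset n → Set
Monochromatic f e = ∀ u v → u ∈ e → v ∈ e → f u ≡ f v

Proper : ∀ {n q} → Hypergraph n → (Fin n → Fin q) → Set
Proper H f = ∀ e → Edge H e → ¬ Monochromatic f e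

colourClass : ∀ {n q} → (Fin n → Fin q) → Fin q → Subset n
colourClass f x = tabulate λ v → does (f v ≟ᶠ x)

-- q = χ(H).
IsChromaticNumber : ∀ {n} → Hypergraph n → ℕ → Set
IsChromaticNumber {n} H = IsLeast λ q → ∃ λ (f : Fin n → Fin q) → Proper H f

-- s = σ(H).  No such s exists exactly when H has no vertices or an edge
-- with at most one vertex.
IsSigma : ∀ {n} → Hypergraph n → ℕ → Set
IsSigma {n} H s =
  ∃ λ q → IsChromaticNumber H q ×
    IsLeast (λ t → ∃ λ (f : Fin n → Fin q) → Proper H f ×
                     ∃ λ (x : Fin q) → ∣ colourClass f x ∣ ≡ t) s

Independent : ∀ {n} → Hypergraph n → Subset n → Set
Independent H S = ∀ e → Edge H e → ¬ (e ⊆ S)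

IsIndependenceNumber : ∀ {n} → Hypergraph n → ℕ → Set
IsIndependenceNumber {n} H =
  IsGreatest λ a → ∃ λ (S : Subset n) → Independent H S × ∣ S ∣ ≡ a

-- t = τ(j , α).
IsTau : ℕ → ℕ → ℕ → Set₁
IsTau j α = IsGreatest λ N →
  ∃ λ (F : Hypergraph N) →
    Uniform j F
    × (∃ λ a → IsIndependenceNumber F a × a < α)
    × (∀ e f → Edge F e → Edge F f → e ≢ f → ∣ e ∩ f ∣ ≢ 1)

-- The i-th block of consecutive vertices (i counted from 0, vertices from 0):
-- { v : i (k - 1) ≤ v ≤ (i + 1)(k - 1) }.
block : (k n i : ℕ) → Subset n
block k n i = tabulate λ v →
  does (i * (k ∸ 1) ≤? toℕ v) ∧ does (toℕ v ≤? suc i * (k ∸ 1))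

-- The loose path P_{n,1}^(k), for k ≥ 2 and n ≡ 1 (mod k - 1).  If
-- n = q (k - 1) + 1, the condition (i + 1)(k - 1) < n says i < q.
loosePath : (k n : ℕ) → Hypergraph n
loosePath k n = record
  { Edge  = λ e → ∃ λ (i : Fin n) →
              suc (toℕ i) * (k ∸ 1) < n × e ≡ block k n (toℕ i)
  ; edge? = λ e → any? λ i →
              (suc (toℕ i) * (k ∸ 1) <? n) ×-dec ≡-dec _≟ᵇ_ e (block k n (toℕ i))
  }

{-# OPTIONS --safe #-}
-- Fix a colouring without a blue copy of H and suppose that there is no red path with n vertices.
-- By Ramsey's theorem all but boundedly many vertices lie in red cliques of constant size, and χ cliques
-- always have a red edge between two of them; so the vertices can be covered, up to boundedly many, by
-- fewer than χ disjoint "balloons": a long red path together with a red clique (its core) that can extend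
-- and reroute the path.  Counting shows that there are exactly χ - 1 balloons and that each has at least
-- n/2 vertices, hence any connection between two cores gives a red path with n vertices.
-- Of the remaining vertices W, sets A such that A ∪ T is red for some T with at least two vertices in a core
-- are absorbed in a path.  What is left are (k-1)-sets f with f ∪ {x} red for two vertices x of a core;
-- σ vertices without such a set give a blue copy of H, and two such sets with exactly one common vertex
-- can again be absorbed.  So |W| ≤ τ.  The sets f can also be put at the two ends of a path, and the
-- count of the vertices shows that one of the paths, lengthened in this way, has n vertices.
module Submission where

-- The obstacle is the order of the constants. After the first covering, the number of uncovered
-- vertices is bounded only by a Ramsey number that exceeds the size of the cores, so the cores
-- cannot pay for absorbing these vertices one by one. Hence the uncovered set is covered again, by
-- balloons with much smaller cores. What is left then is bounded in terms of the small cores, and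
-- the large cores are chosen last, big enough to pay for it. The small balloons are merged into the
-- long ones: of the `R + 1` parts formed by one small and `R = χ - 1` large cores, a red edge
-- between two large ones wins at once.
--
-- The bound can be exact because the number of vertices of a loose path is 1 modulo k - 1: leaving
-- out up to `d = k - 2` vertices costs no edge.
--
-- The term τ - 2k + 3 comes from a count. Let M be the maximum in the theorem. If every balloon
-- with the sets at its ends has at most n - 1 vertices, at least M vertices remain. A balloon with
-- both ends in use holds 2(k - 1) further vertices of W, so W would have at least M + 2k - 2 > τ
-- vertices; hence an end is always available.

module LoosePathRamsey where

  open import Defs
  open import Data.Bool using (Bool; true; false; if_then_else_)
  open import Data.Empty using (⊥-elim) renaming (⊥ to Empty)
  open import Data.Fin using (Fin; zero; suc; toℕ; fromℕ<; punchIn; punchOut; splitAt; _↑ˡ_; _↑ʳ_; combine)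
  import Data.Fin as Fin
  import Data.Fin.Properties as Fin
  open import Data.Fin.Subset using (Subset; inside; outside; ∣_∣; ⁅_⁆; _∪_; _∩_)
    renaming (_∈_ to _∈ˢ_; _⊆_ to _⊆ˢ_; ⊥ to ∅)
  import Data.Fin.Subset.Properties as Subset
  import Data.Integer as ℤ
  open import Data.Integer using () renaming (+_ to pos)
  import Data.Integer.Properties as ℤ
  open import Data.List using (List; []; _∷_; _++_; [_]; length; map; filter; concat; tabulate; lookup; allFin; take; drop)
  open import Data.List.Membership.DecPropositional using () renaming (_∈?_ to member?)
  open import Data.List.Membership.Propositional using (_∈_; _∉_; find; lose)
  open import Data.List.Membership.Propositional.Properties
  import Data.List.Properties as List
  open import Data.List.Properties using (length-++; ++-assoc; ++-identityʳ; length-map; length-tabulate; length-filter; take++drop≡id)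
  open import Data.List.Relation.Binary.Disjoint.Propositional using (Disjoint)
  open import Data.List.Relation.Binary.Permutation.Propositional
    using (_↭_; prep; swap; ↭-refl; ↭-sym; ↭-trans; ↭-reflexive; ↭⇒↭ₛ)
  import Data.List.Relation.Binary.Permutation.Propositional.Properties as Perm
  import Data.List.Relation.Binary.Permutation.Setoid.Properties as PermS
  open import Data.List.Relation.Binary.Sublist.Propositional using ([]; _∷_; _∷ʳ_)
    renaming (_⊆_ to _⊑_; ⊆-trans to ⊑-trans; ⊆-refl to ⊑-refl; lookup to ⊑⇒⊆; minimum to []⊑)
  import Data.List.Relation.Binary.Sublist.Propositional.Properties as Sub
  open import Data.List.Relation.Binary.Subset.Propositional using (_⊆_)
  open import Data.List.Relation.Unary.All as All using (All; []; _∷_)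
  open import Data.List.Relation.Unary.All.Properties using (¬All⇒Any¬)
  open import Data.List.Relation.Unary.AllPairs using ([]; _∷_)
  open import Data.List.Relation.Unary.Any as Any using (Any; here; there)
  open import Data.List.Relation.Unary.Unique.Propositional using (Unique)
  import Data.List.Relation.Unary.Unique.DecPropositional as DecUniq
  import Data.List.Relation.Unary.Unique.Propositional.Properties as Uniq
  open import Data.Nat using (ℕ; zero; suc; _+_; _*_; _∸_; _≤_; _<_; z≤n; s≤s; _⊔_; _^_; _≤?_; _<?_; _≤ᵇ_)
  import Data.Nat as ℕ
  open import Data.Nat.Properties hiding (_≟_)
  open import Data.Product using (∃; ∃₂; _×_; _,_; proj₁; proj₂)
  open import Data.Sum as Sum using (_⊎_; inj₁; inj₂; [_,_]′)
  import Data.Vec as Vec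
  open import Data.Vec using ([]; _∷_)
  import Data.Vec.Properties as Vec
  open import Function using (_∘_; id; case_of_)
  open import Function.Definitions using (Injective)
  open import Relation.Binary.PropositionalEquality
    using (_≡_; _≢_; refl; sym; trans; cong; cong₂; subst; subst₂; setoid; module ≡-Reasoning)
  open import Relation.Nullary using (¬_; Dec; yes; no; does; contradiction)
  open import Relation.Nullary.Decidable using (¬?; _×-dec_; _⊎-dec_; _→-dec_; map′; decidable-stable; dec-true)

  -- Lists of distinct vertices

  variable
    N : ℕ

  _∈?_ : (v : Fin N) (xs : List (Fin N)) → Dec (v ∈ xs)
  _∈?_ = member? Fin._≟_

  infixl 6 _∖_
  _∖_ : List (Fin N) → List (Fin N) → List (Fin N)
  xs ∖ ys = filter (λ v → ¬? (v ∈? ys)) xs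

  ∈-∖⁺ : ∀ {v : Fin N} {xs ys} → v ∈ xs → v ∉ ys → v ∈ xs ∖ ys
  ∈-∖⁺ {ys = ys} = ∈-filter⁺ (λ v → ¬? (v ∈? ys))

  ∈-∖⁻ : ∀ {v : Fin N} xs ys → v ∈ xs ∖ ys → v ∈ xs × v ∉ ys
  ∈-∖⁻ xs ys = ∈-filter⁻ (λ v → ¬? (v ∈? ys)) {xs = xs}

  ∖-Unique : ∀ {xs : List (Fin N)} ys → Unique xs → Unique (xs ∖ ys)
  ∖-Unique ys = Uniq.filter⁺ (λ v → ¬? (v ∈? ys))

  Unique-resp-↭ : ∀ {xs ys : List (Fin N)} → xs ↭ ys → Unique xs → Unique ys
  Unique-resp-↭ {N} p = PermS.Unique-resp-↭ (setoid (Fin N)) (↭⇒↭ₛ p)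

  ∈-resp : ∀ {xs ys : List (Fin N)} → xs ↭ ys → xs ⊆ ys
  ∈-resp p = Perm.∈-resp-↭ p

  Unique-∷⁺ : ∀ {x : Fin N} {xs} → x ∉ xs → Unique xs → Unique (x ∷ xs)
  Unique-∷⁺ {xs = xs} x∉ u = All.tabulate (λ {y} y∈ x≡y → x∉ (subst (_∈ xs) (sym x≡y) y∈)) ∷ u

  Unique-∷⁻ : ∀ {x : Fin N} {xs} → Unique (x ∷ xs) → x ∉ xs × Unique xs
  Unique-∷⁻ u@(_ ∷ us) = Uniq.Unique[x∷xs]⇒x∉xs u , us

  Unique-++⁻ : ∀ (xs : List (Fin N)) {ys} → Unique (xs ++ ys) → Unique xs × Unique ys × Disjoint xs ys
  Unique-++⁻ [] u = [] , u , λ { (() , _) }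
  Unique-++⁻ (x ∷ xs) u with Unique-∷⁻ u
  ... | x∉ , u′ with Unique-++⁻ xs u′
  ... | uxs , uys , dis = Unique-∷⁺ (x∉ ∘ ∈-++⁺ˡ) uxs , uys ,
    λ { (here refl , w) → x∉ (∈-++⁺ʳ xs w) ; (there v , w) → dis (v , w) }

  ∈⇒↭ : ∀ {v : Fin N} {xs} → v ∈ xs → ∃ λ ys → xs ↭ v ∷ ys
  ∈⇒↭ {v = v} v∈ with ∈-∃++ v∈
  ... | as , bs , refl = as ++ bs , Perm.shift v as bs

  ∈₂⇒↭ : ∀ {u v : Fin N} {xs} → u ∈ xs → v ∈ xs → u ≢ v → ∃ λ ys → xs ↭ u ∷ v ∷ ys
  ∈₂⇒↭ u∈ v∈ u≢v with ∈⇒↭ u∈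
  ... | ys , p with ∈-resp p v∈
  ... | here v≡u = ⊥-elim (u≢v (sym v≡u))
  ... | there v∈′ with ∈⇒↭ v∈′
  ... | zs , q = zs , ↭-trans p (prep _ q)

  unique-⊆-length : ∀ {xs ys : List (Fin N)} → Unique xs → xs ⊆ ys → length xs ≤ length ys
  unique-⊆-length {xs = []} _ _ = z≤n
  unique-⊆-length {xs = x ∷ xs} {ys} u sub with Unique-∷⁻ u | ∈⇒↭ (sub (here refl))
  ... | x∉ , u′ | ys′ , p = ≤-trans (s≤s (unique-⊆-length u′ sub′)) (≤-reflexive (sym (Perm.↭-length p)))
    where
    sub′ : xs ⊆ ys′
    sub′ v∈ with ∈-resp p (sub (there v∈))
    ... | here refl = ⊥-elim (x∉ v∈)
    ... | there w = w

  unique-⊆-↭ : ∀ {xs ys : List (Fin N)} → Unique xs → Unique ys → xs ⊆ ys → ys ⊆ xs → xs ↭ ys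
  unique-⊆-↭ {xs = []} {[]} _ _ _ _ = ↭-refl
  unique-⊆-↭ {xs = []} {y ∷ ys} _ _ _ sub with sub (here refl)
  ... | ()
  unique-⊆-↭ {xs = x ∷ xs} {ys} u w sub sup with Unique-∷⁻ u | ∈⇒↭ (sub (here refl))
  ... | x∉ , u′ | ys′ , p with Unique-∷⁻ (Unique-resp-↭ p w)
  ... | x∉′ , w′ = ↭-trans (prep x (unique-⊆-↭ u′ w′ s1 s2)) (↭-sym p)
    where
    s1 : xs ⊆ ys′
    s1 v∈ with ∈-resp p (sub (there v∈))
    ... | here refl = ⊥-elim (x∉ v∈)
    ... | there q = q
    s2 : ys′ ⊆ xs
    s2 v∈ with sup (∈-resp (↭-sym p) (there v∈))
    ... | here refl = ⊥-elim (x∉′ v∈)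
    ... | there q = q

  -- The accounting behind every change of a system: with `A` and `B` the path vertices before and
  -- after, each core vertex of `K` that stops being free lies in `Z`.
  length-∖ : ∀ {K Z A B : List (Fin N)} → Unique K → (∀ {v} → v ∈ K → v ∈ B → v ∈ Z ⊎ v ∈ A) →
             length (K ∖ A) ≤ length Z + length (K ∖ B)
  length-∖ {K = K} {Z} {A} {B} u h =
    ≤-trans (unique-⊆-length (∖-Unique A u) sub) (≤-reflexive (length-++ Z))
    where
    sub : K ∖ A ⊆ Z ++ (K ∖ B)
    sub {v} v∈ with ∈-∖⁻ K A v∈
    ... | v∈K , v∉A with v ∈? B
    ... | no v∉B = ∈-++⁺ʳ Z (∈-∖⁺ v∈K v∉B)
    ... | yes v∈B with h v∈K v∈B
    ... | inj₁ v∈Z = ∈-++⁺ˡ v∈Z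
    ... | inj₂ v∈A = ⊥-elim (v∉A v∈A)

  take-⊆ : ∀ n (xs : List (Fin N)) → take n xs ⊆ xs
  take-⊆ (suc n) (x ∷ xs) (here p) = here p
  take-⊆ (suc n) (x ∷ xs) (there p) = there (take-⊆ n xs p)

  length-take : ∀ n (xs : List (Fin N)) → n ≤ length xs → length (take n xs) ≡ n
  length-take zero xs _ = refl
  length-take (suc n) (x ∷ xs) (s≤s h) = cong suc (length-take n xs h)

  splitAt-length : ∀ n (xs : List (Fin N)) → n ≤ length xs →
                   ∃ λ ys → ∃ λ zs → xs ≡ ys ++ zs × length ys ≡ n
  splitAt-length n xs h = take n xs , drop n xs , sym (take++drop≡id n xs) , length-take n xs h

  Fresh : List (Fin N) → List (Fin N) → Set
  Fresh Z A = Unique Z × Disjoint Z A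

  -- `Z` is the piece built so far. Counting all of it against `K` leaves enough vertices even if it
  -- lies inside `K`, so successive choices stay disjoint.
  pick : ∀ n {K A : List (Fin N)} Z → Unique K → Fresh Z A → n + length Z ≤ length (K ∖ A) →
         ∃ λ t → length t ≡ n × t ⊆ K × Fresh (t ++ Z) A
  pick n {K} {A} Z uK (uZ , dZ) h =
    t , length-take n free enough , proj₁ ∘ fromFree , Uniq.++⁺ (Uniq.take⁺ n uFree) uZ disj , disj′
    where
    free = K ∖ (Z ++ A)
    t = take n free
    uFree = ∖-Unique (Z ++ A) uK
    enough : n ≤ length free
    enough = +-cancelʳ-≤ (length Z) n (length free)
      (≤-trans h (≤-trans (length-∖ {B = Z ++ A} uK (λ _ → ∈-++⁻ Z)) (≤-reflexive (+-comm (length Z) _))))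
    fromFree : ∀ {v} → v ∈ t → v ∈ K × v ∉ Z ++ A
    fromFree v∈ = ∈-∖⁻ K (Z ++ A) (take-⊆ n free v∈)
    disj : Disjoint t Z
    disj (v∈t , v∈Z) = proj₂ (fromFree v∈t) (∈-++⁺ˡ v∈Z)
    disj′ : Disjoint (t ++ Z) A
    disj′ (v∈ , v∈A) with ∈-++⁻ t v∈
    ... | inj₁ v∈t = proj₂ (fromFree v∈t) (∈-++⁺ʳ Z v∈A)
    ... | inj₂ v∈Z = dZ (v∈Z , v∈A)

  -- Permutations of concatenations

  infixr 5 _⊕_
  data Concatenation : Set where
    #_  : ℕ → Concatenation
    _⊕_ : Concatenation → Concatenation → Concatenation

  insert : ℕ → List ℕ → List ℕ
  insert m [] = m ∷ []
  insert m (n ∷ ns) = if m ≤ᵇ n then m ∷ n ∷ ns else n ∷ insert m ns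

  sorted : Concatenation → List ℕ → List ℕ
  sorted (# m)   ns = insert m ns
  sorted (e ⊕ f) ns = sorted e (sorted f ns)

  module _ {A : Set} (ρ : List (List A)) where

    entry : List (List A) → ℕ → List A
    entry []        _       = []
    entry (xs ∷ _)  zero    = xs
    entry (_ ∷ xss) (suc m) = entry xss m

    ⟦_⟧ : Concatenation → List A
    ⟦ # m ⟧   = entry ρ m
    ⟦ e ⊕ f ⟧ = ⟦ e ⟧ ++ ⟦ f ⟧

    entries : List ℕ → List A
    entries [] = []
    entries (m ∷ ms) = entry ρ m ++ entries ms

    insert-↭ : ∀ m ns → entries (insert m ns) ↭ entry ρ m ++ entries ns
    insert-↭ m [] = ↭-refl
    insert-↭ m (n ∷ ns) with m ≤ᵇ n
    ... | true  = ↭-refl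
    ... | false = ↭-trans (Perm.++⁺ˡ (entry ρ n) (insert-↭ m ns)) (Perm.shifts (entry ρ n) (entry ρ m))

    sorted-↭ : ∀ e ns → entries (sorted e ns) ↭ ⟦ e ⟧ ++ entries ns
    sorted-↭ (# m)   ns = insert-↭ m ns
    sorted-↭ (e ⊕ f) ns = ↭-trans (sorted-↭ e (sorted f ns))
      (↭-trans (Perm.++⁺ˡ ⟦ e ⟧ (sorted-↭ f ns)) (↭-reflexive (sym (++-assoc ⟦ e ⟧ ⟦ f ⟧ (entries ns)))))

    -- A solver for permutations: both sides are words in the numbered lists of `ρ`, and the words
    -- are compared by sorting their numbers. For closed words this is mere computation, so `refl`
    -- suffices as the last argument.
    rearrange : ∀ e f → sorted e [] ≡ sorted f [] → ⟦ e ⟧ ↭ ⟦ f ⟧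
    rearrange e f eq = ↭-trans (↭-trans (expand e) (↭-reflexive (cong entries eq))) (↭-sym (expand f))
      where
      expand : ∀ e → ⟦ e ⟧ ↭ entries (sorted e [])
      expand e = ↭-sym (↭-trans (sorted-↭ e []) (↭-reflexive (++-identityʳ ⟦ e ⟧)))

  -- Ramsey's theorem

  module _ {A : Set} where

    Homogeneous : ℕ → (List A → Bool) → List A → Bool → Set
    Homogeneous k col ys b = ∀ {l} → l ⊑ ys → length l ≡ k → col l ≡ b

    -- In the list of xᵢ, the colour of a (suc k)-sublist depends only on its first element.
    data EndHomogeneous (k : ℕ) (col : List A → Bool) : List (A × Bool) → Set where
      []  : EndHomogeneous k col []
      _∷_ : ∀ {x b zs} → Homogeneous k (col ∘ (x ∷_)) (map proj₁ zs) b →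
            EndHomogeneous k col zs → EndHomogeneous k col ((x , b) ∷ zs)

    select : Bool → List (A × Bool) → List A
    select b [] = []
    select true  ((x , true)  ∷ zs) = x ∷ select true zs
    select true  ((x , false) ∷ zs) = select true zs
    select false ((x , true)  ∷ zs) = select false zs
    select false ((x , false) ∷ zs) = x ∷ select false zs

    select-⊑ : ∀ b zs → select b zs ⊑ map proj₁ zs
    select-⊑ b [] = []
    select-⊑ true  ((x , true)  ∷ zs) = refl ∷ select-⊑ true zs
    select-⊑ true  ((x , false) ∷ zs) = x ∷ʳ select-⊑ true zs
    select-⊑ false ((x , true)  ∷ zs) = x ∷ʳ select-⊑ false zs
    select-⊑ false ((x , false) ∷ zs) = refl ∷ select-⊑ false zs

    length-select : ∀ zs → length (select true zs) + length (select false zs) ≡ length zs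
    length-select [] = refl
    length-select ((x , true)  ∷ zs) = cong suc (length-select zs)
    length-select ((x , false) ∷ zs) = trans (+-suc _ _) (cong suc (length-select zs))

    select-homogeneous : ∀ {k col zs} b → EndHomogeneous k col zs →
                         Homogeneous (suc k) col (select b zs) b
    select-homogeneous b [] [] ()
    select-homogeneous true  (_∷_ {b = true}  h e) (_ ∷ʳ s) q = select-homogeneous true e s q
    select-homogeneous true  (_∷_ {b = true} {zs} h e) (refl ∷ s) q = h (⊑-trans s (select-⊑ true zs)) (suc-injective q)
    select-homogeneous true  (_∷_ {b = false} h e) s q = select-homogeneous true e s q
    select-homogeneous false (_∷_ {b = true}  h e) s q = select-homogeneous false e s q
    select-homogeneous false (_∷_ {b = false} h e) (_ ∷ʳ s) q = select-homogeneous false e s q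
    select-homogeneous false (_∷_ {b = false} {zs} h e) (refl ∷ s) q = h (⊑-trans s (select-⊑ false zs)) (suc-injective q)

  mutual
    -- Fixing the first element turns a colouring of `suc k`-lists into one of `k`-lists, so
    -- `endBound` pays for each entry one vertex and one use of the theorem for `k`. Of `a + a`
    -- entries at least `a` share a colour.
    ramseyBound : ℕ → ℕ → ℕ
    ramseyBound zero    a = a
    ramseyBound (suc k) a = endBound k (a + a)

    endBound : ℕ → ℕ → ℕ
    endBound k zero    = 0
    endBound k (suc t) = suc (ramseyBound k (endBound k t))

  m≤n⊎m≤o : ∀ m n o → m + m ≤ n + o → m ≤ n ⊎ m ≤ o
  m≤n⊎m≤o m n o h with m ≤? n | m ≤? o
  ... | yes p | _ = inj₁ p
  ... | no _ | yes q = inj₂ q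
  ... | no p | no q = ⊥-elim (<⇒≱ (+-mono-< (≰⇒> p) (≰⇒> q)) h)

  module _ {A : Set} where mutual

    ramsey : ∀ k a (col : List A → Bool) xs → ramseyBound k a ≤ length xs →
             ∃₂ λ ys b → ys ⊑ xs × a ≤ length ys × Homogeneous k col ys b
    ramsey zero a col xs h = xs , col [] , ⊑-refl , h , λ { {[]} _ _ → refl }
    ramsey (suc k) a col xs h with endHomogeneous k (a + a) col xs h
    ... | zs , zs⊑ , len , e with m≤n⊎m≤o a (length (select true zs)) _ (≤-trans len (≤-reflexive (sym (length-select zs))))
    ... | inj₁ p = select true zs , true , ⊑-trans (select-⊑ true zs) zs⊑ , p , select-homogeneous true e
    ... | inj₂ p = select false zs , false , ⊑-trans (select-⊑ false zs) zs⊑ , p , select-homogeneous false e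

    endHomogeneous : ∀ k t (col : List A → Bool) xs → endBound k t ≤ length xs →
                     ∃ λ zs → map proj₁ zs ⊑ xs × t ≤ length zs × EndHomogeneous k col zs
    endHomogeneous k zero col xs h = [] , []⊑ xs , z≤n , []
    endHomogeneous k (suc t) col (x ∷ xs) (s≤s h) with ramsey k (endBound k t) (col ∘ (x ∷_)) xs h
    ... | ys , b , ys⊑ , len , hom with endHomogeneous k t col ys len
    ... | zs , zs⊑ , len′ , e = (x , b) ∷ zs , refl ∷ ⊑-trans zs⊑ ys⊑ , s≤s len′ ,
                                (λ s → hom (⊑-trans s zs⊑)) ∷ e

  -- Counting in lists, and the constants of the proof

  anyList? : ∀ k {P : List (Fin N) → Set} → (∀ l → Dec (P l)) → Dec (∃ λ l → length l ≡ k × P l)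
  anyList? zero P? = map′ (λ p → [] , refl , p) (λ { ([] , _ , p) → p }) (P? [])
  anyList? (suc k) P? =
    map′ (λ { (x , l , q , p) → x ∷ l , cong suc q , p })
         (λ { (x ∷ l , q , p) → x , l , suc-injective q , p })
         (Fin.any? (λ x → anyList? k (λ l → P? (x ∷ l))))

  -- Two edges of `2 + d` vertices and three connecting sets of `d` vertices. Absorbing or linking
  -- along an ear takes no more, so this is the price of every operation.
  mergeCost : ℕ → ℕ
  mergeCost d = d + (d + (d + ((2 + d) + (2 + d))))

  length-≤-∖ : ∀ {K : List (Fin N)} Z → Unique K → length K ≤ length Z + length (K ∖ Z)
  length-≤-∖ {K = K} Z u = ≤-trans (unique-⊆-length u sub) (≤-reflexive (length-++ Z))
    where
    sub : K ⊆ Z ++ (K ∖ Z)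
    sub {v} v∈ with v ∈? Z
    ... | yes w = ∈-++⁺ˡ w
    ... | no w = ∈-++⁺ʳ Z (∈-∖⁺ v∈ w)

  ∖-< : ∀ {X A B : List (Fin N)} {v} → Unique X → A ⊆ B → v ∈ X → v ∈ B → v ∉ A →
        length (X ∖ B) < length (X ∖ A)
  ∖-< {X = X} {A} {B} u A⊆B v∈X v∈B v∉A =
    unique-⊆-length (Unique-∷⁺ (λ w → proj₂ (∈-∖⁻ X B w) v∈B) (∖-Unique B u))
      λ { (here refl) → ∈-∖⁺ v∈X v∉A
        ; (there w) → let w∈ , w∉ = ∈-∖⁻ X B w in ∈-∖⁺ w∈ (w∉ ∘ A⊆B) }

  length-concatTabulate : ∀ {A : Set} {r} (f : Fin r → List A) m → (∀ i → length (f i) ≤ m) →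
                          length (concat (tabulate f)) ≤ r * m
  length-concatTabulate {r = zero} f m h = z≤n
  length-concatTabulate {r = suc r} f m h = ≤-trans (≤-reflexive (length-++ (f zero)))
    (+-mono-≤ (h zero) (length-concatTabulate (f ∘ suc) m (h ∘ suc)))

  toℕ-punchIn : ∀ {n} (q : Fin (suc n)) i →
    (toℕ i < toℕ q × toℕ (punchIn q i) ≡ toℕ i) ⊎ (toℕ q ≤ toℕ i × toℕ (punchIn q i) ≡ suc (toℕ i))
  toℕ-punchIn zero i = inj₂ (z≤n , refl)
  toℕ-punchIn (suc q) zero = inj₁ (s≤s z≤n , refl)
  toℕ-punchIn (suc q) (suc i) with toℕ-punchIn q i
  ... | inj₁ (a , b) = inj₁ (s≤s a , cong suc b)
  ... | inj₂ (a , b) = inj₂ (s≤s a , cong suc b)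

  -- A homogeneous list of `a + v` vertices contains a red clique of size `a` if it is red, and
  -- cannot be blue since `v` vertices without a red edge would carry a blue copy of `H`.
  redCliqueBound : ℕ → ℕ → ℕ → ℕ
  redCliqueBound d v a = ramseyBound (2 + d) (a + v)

  -- Room for `suc R * suc R + 1` disjoint edges, enough for two of them to join the same pair of
  -- parts; the summand `v + σ` is what must remain in a part to find the next edge.
  pairSize : ℕ → ℕ → ℕ → ℕ → ℕ
  pairSize d v σ R = v + σ + suc (suc R * suc R) * (2 + d)

  Unique-⊑ : ∀ {ys xs : List (Fin N)} → ys ⊑ xs → Unique xs → Unique ys
  Unique-⊑ [] _ = []
  Unique-⊑ (_ ∷ʳ s) u = Unique-⊑ s (proj₂ (Unique-∷⁻ u))
  Unique-⊑ (refl ∷ s) u = let x∉ , u′ = Unique-∷⁻ u in Unique-∷⁺ (x∉ ∘ ⊑⇒⊆ s) (Unique-⊑ s u′)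

  -- The demand on index 0 of a graded system while it has a balloon too many, hence `suc R` instead
  -- of `R`.
  freshSize : ℕ → ℕ → ℕ → ℕ
  freshSize d R m = m + suc R * mergeCost d

  sublists : List (Fin N) → List (List (Fin N))
  sublists [] = [] ∷ []
  sublists (x ∷ xs) = map (x ∷_) (sublists xs) ++ sublists xs

  length-sublists : ∀ (xs : List (Fin N)) → length (sublists xs) ≡ 2 ^ length xs
  length-sublists [] = refl
  length-sublists (x ∷ xs) = trans (length-++ (map (x ∷_) (sublists xs)))
    (trans (cong (_+ length (sublists xs)) (length-map (x ∷_) (sublists xs)))
    (trans (cong (length (sublists xs) +_) (sym (+-identityʳ _))) (cong (2 *_) (length-sublists xs))))

  ∈-sublists⁺ : ∀ {ys xs : List (Fin N)} → ys ⊑ xs → ys ∈ sublists xs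
  ∈-sublists⁺ [] = here refl
  ∈-sublists⁺ {xs = x ∷ xs} (_ ∷ʳ s) = ∈-++⁺ʳ (map (x ∷_) (sublists xs)) (∈-sublists⁺ s)
  ∈-sublists⁺ (refl ∷ s) = ∈-++⁺ˡ (∈-map⁺ _ (∈-sublists⁺ s))

  ∈-sublists⁻ : ∀ {ys} (xs : List (Fin N)) → ys ∈ sublists xs → ys ⊑ xs
  ∈-sublists⁻ [] (here refl) = []
  ∈-sublists⁻ (x ∷ xs) w with ∈-++⁻ (map (x ∷_) (sublists xs)) w
  ... | inj₂ w′ = x ∷ʳ ∈-sublists⁻ xs w′
  ... | inj₁ w′ with ∈-map⁻ (x ∷_) w′
  ... | _ , w″ , refl = refl ∷ ∈-sublists⁻ xs w″

  length-filter-¬ : ∀ {P : Fin N → Set} (P? : ∀ x → Dec (P x)) {X} → Unique X →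
    (∀ {x y} → x ∈ X → y ∈ X → P x → P y → x ≡ y) → length X ≤ suc (length (filter (¬? ∘ P?) X))
  length-filter-¬ {P = P} P? {X} u one with Any.any? P? X
  ... | no none = ≤-trans (unique-⊆-length u (λ w → ∈-filter⁺ (¬? ∘ P?) w (λ p → none (lose w p)))) (n≤1+n _)
  ... | yes some with find some
  ... | x , x∈ , px = unique-⊆-length u λ {y} y∈ → case P? y of λ
    { (yes py) → here (one y∈ x∈ py px) ; (no ¬py) → there (∈-filter⁺ (¬? ∘ P?) y∈ ¬py) }

  firstOrAll : ∀ {r} {A : Set} {P : Fin r → Set} → (∀ i → A ⊎ P i) → A ⊎ (∀ i → P i)
  firstOrAll {zero} h = inj₂ λ ()
  firstOrAll {suc r} h with h zero | firstOrAll (h ∘ suc)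
  ... | inj₁ a | _ = inj₁ a
  ... | inj₂ _ | inj₁ a = inj₁ a
  ... | inj₂ p | inj₂ ps = inj₂ λ { zero → p ; (suc i) → ps i }

  -- Adding `m` on the left avoids a subtraction. Together with a nearly tight lower bound for the
  -- union of the parts, this forces each single part to be large.
  length-concatTabulate-at : ∀ {A : Set} {r} (f : Fin r → List A) m → (∀ i → length (f i) ≤ m) → ∀ i →
                             length (concat (tabulate f)) + m ≤ r * m + length (f i)
  length-concatTabulate-at {r = suc r} f m h zero = begin
    length (f zero ++ concat (tabulate (f ∘ suc))) + m
      ≡⟨ cong (_+ m) (length-++ (f zero)) ⟩
    length (f zero) + length (concat (tabulate (f ∘ suc))) + m
      ≤⟨ +-monoˡ-≤ m (+-monoʳ-≤ (length (f zero)) (length-concatTabulate (f ∘ suc) m (h ∘ suc))) ⟩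
    length (f zero) + r * m + m ≡⟨ +-assoc (length (f zero)) (r * m) m ⟩
    length (f zero) + (r * m + m) ≡⟨ +-comm (length (f zero)) (r * m + m) ⟩
    r * m + m + length (f zero) ≡⟨ cong (_+ length (f zero)) (+-comm (r * m) m) ⟩
    m + r * m + length (f zero) ∎
    where open ≤-Reasoning
  length-concatTabulate-at {r = suc r} f m h (suc i) = begin
    length (f zero ++ concat (tabulate (f ∘ suc))) + m
      ≡⟨ cong (_+ m) (length-++ (f zero)) ⟩
    length (f zero) + length (concat (tabulate (f ∘ suc))) + m
      ≡⟨ +-assoc (length (f zero)) _ m ⟩
    length (f zero) + (length (concat (tabulate (f ∘ suc))) + m)
      ≤⟨ +-mono-≤ (h zero) (length-concatTabulate-at (f ∘ suc) m (h ∘ suc) i) ⟩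
    m + (r * m + length (f (suc i))) ≡⟨ +-assoc m (r * m) _ ⟨
    m + r * m + length (f (suc i)) ∎
    where open ≤-Reasoning

  -- `leftover` depends on `smallClique` only, so that `bigClique` can contain one `mergeCost` for
  -- each leftover vertex and one for each of at most `R` small balloons. In `reserve`, `v + 2 ^ σ`
  -- is for the search of a blue copy after pruning, `mergeCost d` for one operation and `2 * suc d`
  -- for the two ends of a path. `threshold` adds the size of a large core to the bound on the
  -- vertices left by the first covering.
  smallClique bigClique leftover reserve threshold : ℕ → ℕ → ℕ → ℕ → ℕ
  smallClique d v σ R = pairSize d v σ R + mergeCost d + R * mergeCost d
  leftover d v σ R = redCliqueBound d v (suc (freshSize d R (smallClique d v σ R))) + R * freshSize d R (smallClique d v σ R)
  reserve d v σ R = v + 2 ^ σ + mergeCost d + 2 * suc d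
  bigClique d v σ R = reserve d v σ R + leftover d v σ R * mergeCost d + R * mergeCost d + smallClique d v σ R
  threshold d v σ R = freshSize d R (bigClique d v σ R) + redCliqueBound d v (suc (freshSize d R (bigClique d v σ R)))

  -- Subsets as lists

  fromList : List (Fin N) → Subset N
  fromList [] = ∅
  fromList (x ∷ xs) = ⁅ x ⁆ ∪ fromList xs

  fromList-↭ : ∀ {xs ys : List (Fin N)} → xs ↭ ys → fromList xs ≡ fromList ys
  fromList-↭ _↭_.refl = refl
  fromList-↭ (_↭_.prep x p) = cong (⁅ x ⁆ ∪_) (fromList-↭ p)
  fromList-↭ {xs = x ∷ y ∷ xs} {ys = _ ∷ _ ∷ ys} (_↭_.swap x y p) = begin
    ⁅ x ⁆ ∪ (⁅ y ⁆ ∪ fromList xs) ≡⟨ cong (λ q → ⁅ x ⁆ ∪ (⁅ y ⁆ ∪ q)) (fromList-↭ p) ⟩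
    ⁅ x ⁆ ∪ (⁅ y ⁆ ∪ fromList ys) ≡⟨ Subset.∪-assoc ⁅ x ⁆ ⁅ y ⁆ _ ⟨
    (⁅ x ⁆ ∪ ⁅ y ⁆) ∪ fromList ys ≡⟨ cong (_∪ fromList ys) (Subset.∪-comm ⁅ x ⁆ ⁅ y ⁆) ⟩
    (⁅ y ⁆ ∪ ⁅ x ⁆) ∪ fromList ys ≡⟨ Subset.∪-assoc ⁅ y ⁆ ⁅ x ⁆ _ ⟩
    ⁅ y ⁆ ∪ (⁅ x ⁆ ∪ fromList ys) ∎
    where open ≡-Reasoning
  fromList-↭ (_↭_.trans p q) = trans (fromList-↭ p) (fromList-↭ q)

  ∈-fromList⁻ : ∀ {v} (xs : List (Fin N)) → v ∈ˢ fromList xs → v ∈ xs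
  ∈-fromList⁻ [] w = ⊥-elim (Subset.∉⊥ w)

  ∈-fromList⁻ (x ∷ xs) w with Subset.x∈p∪q⁻ ⁅ x ⁆ (fromList xs) w
  ... | inj₁ a = here (Subset.x∈⁅y⁆⇒x≡y x a)
  ... | inj₂ a = there (∈-fromList⁻ xs a)

  ∣⁅x⁆∪p∣ : ∀ {x : Fin N} {p} → ¬ x ∈ˢ p → ∣ ⁅ x ⁆ ∪ p ∣ ≡ suc ∣ p ∣
  ∣⁅x⁆∪p∣ {x = zero} {inside ∷ p} x∉ = contradiction Vec.here x∉
  ∣⁅x⁆∪p∣ {x = zero} {outside ∷ p} x∉ = cong (suc ∘ ∣_∣) (Subset.∪-identityˡ p)
  ∣⁅x⁆∪p∣ {x = suc x} {inside ∷ p} x∉ = cong suc (∣⁅x⁆∪p∣ (x∉ ∘ Vec.there))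
  ∣⁅x⁆∪p∣ {x = suc x} {outside ∷ p} x∉ = ∣⁅x⁆∪p∣ (x∉ ∘ Vec.there)

  ∣fromList∣ : ∀ {xs : List (Fin N)} → Unique xs → ∣ fromList xs ∣ ≡ length xs
  ∣fromList∣ {N} {[]} _ = Subset.∣⊥∣≡0 N
  ∣fromList∣ {xs = x ∷ xs} u = trans (∣⁅x⁆∪p∣ (proj₁ (Unique-∷⁻ u) ∘ ∈-fromList⁻ xs)) (cong suc (∣fromList∣ (proj₂ (Unique-∷⁻ u))))

  elements : ∀ {m} → Subset m → List (Fin m)
  elements [] = []
  elements (inside  ∷ p) = zero ∷ map suc (elements p)
  elements (outside ∷ p) = map suc (elements p)

  length-elements : ∀ {m} (p : Subset m) → length (elements p) ≡ ∣ p ∣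
  length-elements [] = refl
  length-elements (inside  ∷ p) = cong suc (trans (length-map suc (elements p)) (length-elements p))
  length-elements (outside ∷ p) = trans (length-map suc (elements p)) (length-elements p)

  elements-Unique : ∀ {m} (p : Subset m) → Unique (elements p)
  elements-Unique [] = []
  elements-Unique (inside  ∷ p) = Unique-∷⁺ (λ w → case ∈-map⁻ suc w of λ { (_ , _ , ()) })
    (Uniq.map⁺ Fin.suc-injective (elements-Unique p))
  elements-Unique (outside ∷ p) = Uniq.map⁺ Fin.suc-injective (elements-Unique p)

  ∈-elements⁺ : ∀ {m} {p : Subset m} {x} → x ∈ˢ p → x ∈ elements p
  ∈-elements⁺ {p = inside  ∷ p} Vec.here = here refl
  ∈-elements⁺ {p = inside  ∷ p} (Vec.there w) = there (∈-map⁺ suc (∈-elements⁺ w))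
  ∈-elements⁺ {p = outside ∷ p} (Vec.there w) = ∈-map⁺ suc (∈-elements⁺ w)

  ∈-elements⁻ : ∀ {m} (p : Subset m) {x} → x ∈ elements p → x ∈ˢ p
  ∈-elements⁻ (inside  ∷ p) (here refl) = Vec.here
  ∈-elements⁻ (inside  ∷ p) (there w) with ∈-map⁻ suc w
  ... | _ , w′ , refl = Vec.there (∈-elements⁻ p w′)
  ∈-elements⁻ (outside ∷ p) w with ∈-map⁻ suc w
  ... | _ , w′ , refl = Vec.there (∈-elements⁻ p w′)

  image-elements : ∀ {m} (f : Fin m → Fin N) p → image f p ≡ fromList (map f (elements p))
  image-elements f [] = refl
  image-elements f (inside  ∷ p) = cong (⁅ f zero ⁆ ∪_) (trans (image-elements (f ∘ suc) p) (cong fromList (List.map-∘ (elements p))))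
  image-elements f (outside ∷ p) = trans (image-elements (f ∘ suc) p) (cong fromList (List.map-∘ (elements p)))

  ∣image∣ : ∀ {m} {f : Fin m → Fin N} → Injective _≡_ _≡_ f → ∀ p → ∣ image f p ∣ ≡ ∣ p ∣
  ∣image∣ {f = f} inj p = begin
    ∣ image f p ∣ ≡⟨ cong ∣_∣ (image-elements f p) ⟩
    ∣ fromList (map f (elements p)) ∣ ≡⟨ ∣fromList∣ (Uniq.map⁺ inj (elements-Unique p)) ⟩
    length (map f (elements p)) ≡⟨ length-map f (elements p) ⟩
    length (elements p) ≡⟨ length-elements p ⟩
    ∣ p ∣ ∎
    where open ≡-Reasoning

  image-cong : ∀ {m} {f g : Fin m → Fin N} → (∀ i → f i ≡ g i) → ∀ p → image f p ≡ image g p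
  image-cong h [] = refl
  image-cong h (inside  ∷ p) = cong₂ (λ x q → ⁅ x ⁆ ∪ q) (h zero) (image-cong (h ∘ suc) p)
  image-cong h (outside ∷ p) = image-cong (h ∘ suc) p

  satisfying : ∀ {m} {P : Fin m → Set} → (∀ i → Dec (P i)) → Subset m
  satisfying P? = Vec.tabulate (does ∘ P?)

  ∈-satisfying⁺ : ∀ {m} {P : Fin m → Set} (P? : ∀ i → Dec (P i)) {i} → P i → i ∈ˢ satisfying P?
  ∈-satisfying⁺ P? {i} p = Vec.lookup⇒[]= i _ (trans (Vec.lookup∘tabulate (does ∘ P?) i) (dec-true (P? i) p))

  ∈-satisfying⁻ : ∀ {m} {P : Fin m → Set} (P? : ∀ i → Dec (P i)) {i} → i ∈ˢ satisfying P? → P i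
  ∈-satisfying⁻ {P = P} P? {i} w = go (P? i) (trans (sym (Vec.lookup∘tabulate (does ∘ P?) i)) (Vec.[]=⇒lookup w))
    where
    go : (D : Dec (P i)) → does D ≡ true → P i
    go (yes p) _ = p

  lookup-injective : ∀ {xs : List (Fin N)} → Unique xs → ∀ i j → lookup xs i ≡ lookup xs j → i ≡ j
  lookup-injective {xs = x ∷ xs} u zero zero _ = refl
  lookup-injective {xs = x ∷ xs} u zero (suc j) eq = contradiction (subst (_∈ xs) (sym eq) (∈-lookup j)) (proj₁ (Unique-∷⁻ u))
  lookup-injective {xs = x ∷ xs} u (suc i) zero eq = contradiction (subst (_∈ xs) eq (∈-lookup i)) (proj₁ (Unique-∷⁻ u))
  lookup-injective {xs = x ∷ xs} u (suc i) (suc j) eq = cong suc (lookup-injective (proj₂ (Unique-∷⁻ u)) i j eq)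

  -- Finite searches

  consᶠ : ∀ {m} {A : Set} → A → (Fin m → A) → Fin (suc m) → A
  consᶠ a f zero = a
  consᶠ a f (suc i) = f i

  -- A function rebuilt from its first value and the rest agrees with the original only pointwise,
  -- so `P` has to respect pointwise equality.
  anyFunction? : ∀ m {n} {P : (Fin m → Fin n) → Set} → (∀ {f g} → (∀ i → f i ≡ g i) → P f → P g) →
                 (∀ f → Dec (P f)) → Dec (∃ P)
  anyFunction? zero {n} {P} ext P? = map′ (λ p → empty , p) (λ { (f , p) → ext {f} {empty} (λ ()) p }) (P? empty)
    where
    empty : Fin 0 → Fin n
    empty ()
  anyFunction? (suc m) {P = P} ext P? = map′
    (λ { (x , f , p) → consᶠ x f , p })
    (λ { (f , p) → f zero , f ∘ suc , ext (λ { zero → refl ; (suc i) → refl }) p })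
    (Fin.any? λ x → anyFunction? m (λ eq → ext λ { zero → refl ; (suc i) → eq i }) (λ f → P? (consᶠ x f)))

  allSubset? : ∀ {n} {P : Subset n → Set} → (∀ e → Dec (P e)) → Dec (∀ e → P e)
  allSubset? P? = map′ (λ none e → decidable-stable (P? e) (λ np → none (e , np)))
    (λ all → λ { (e , np) → np (all e) }) (¬? (Subset.anySubset? (¬? ∘ P?)))

  injective? : ∀ {m n} (f : Fin m → Fin n) → Dec (Injective _≡_ _≡_ f)
  injective? f = map′ (λ h {x} {y} → h x y) (λ h x y → h)
    (Fin.all? λ x → Fin.all? λ y → (f x Fin.≟ f y) →-dec (x Fin.≟ y))

  contains? : ∀ {m n} (F : Hypergraph n) (G : Hypergraph m) → Dec (Contains F G)
  contains? {m} F G = anyFunction? m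
    (λ {f} {g} eq (inj , h) → (λ {x} {y} e → inj (trans (eq x) (trans e (sym (eq y))))) ,
                    λ e Ge → subst (Edge F) (image-cong eq e) (h e Ge))
    (λ f → injective? f ×-dec allSubset? (λ e → edge? G e →-dec edge? F (image f e)))

  splitColouring : ∀ {n} → (Subset n → Colour) → (Subset n → Colour) → Subset (suc n) → Colour
  splitColouring c c′ (inside  ∷ p) = c p
  splitColouring c c′ (outside ∷ p) = c′ p

  -- By induction: a colouring of the subsets of `suc n` points is a pair of colourings of the
  -- subsets of `n` points, one for the subsets with the point `zero` and one for those without.
  allColourings? : ∀ n {P : (Subset n → Colour) → Set} → (∀ {c c′} → (∀ e → c e ≡ c′ e) → P c → P c′) →
                   (∀ c → Dec (P c)) → Dec (∀ c → P c)
  allColourings? zero {P} ext P? = map′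
    (λ { (pr , pb) c → constant c (c []) refl pr pb }) (λ all → all (λ _ → red) , all (λ _ → blue))
    (P? (λ _ → red) ×-dec P? (λ _ → blue))
    where
    constant : ∀ c x → c [] ≡ x → P (λ _ → red) → P (λ _ → blue) → P c
    constant c red eq pr pb = ext (λ { [] → sym eq }) pr
    constant c blue eq pr pb = ext (λ { [] → sym eq }) pb
  allColourings? (suc n) ext P? = map′
    (λ all c → ext (λ { (inside ∷ p) → refl ; (outside ∷ p) → refl }) (all (c ∘ (inside ∷_)) (c ∘ (outside ∷_))))
    (λ all c c′ → all (splitColouring c c′))
    (allColourings? n
      (λ eq all c′ → ext (λ { (inside ∷ p) → eq p ; (outside ∷ p) → refl }) (all c′))
      (λ c → allColourings? n (λ eq → ext λ { (inside ∷ p) → refl ; (outside ∷ p) → eq p })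
               (λ c′ → P? (splitColouring c c′))))

  least : ∀ {P : ℕ → Set} → (∀ n → Dec (P n)) → ∀ n → P n → ∃ λ m → IsLeast P m × m ≤ n
  least {P} P? n p = [ (λ none → n , (p , λ x px → ≮⇒≥ (λ x<n → none x x<n px)) , ≤-refl) ,
                       (λ { (m , l , m<n) → m , l , <⇒≤ m<n }) ]′ (search n)
    where
    search : ∀ n → (∀ m → m < n → ¬ P m) ⊎ ∃ λ m → IsLeast P m × m < n
    search zero = inj₁ λ _ ()
    search (suc n) with search n
    ... | inj₂ (m , l , m<n) = inj₂ (m , l , m≤n⇒m≤1+n m<n)
    ... | inj₁ none with P? n
    ... | yes pn = inj₂ (n , (pn , λ x px → ≮⇒≥ (λ x<n → none x x<n px)) , ≤-refl)
    ... | no ¬pn = inj₁ λ m m<1+n pm → [ (λ m<n → none m m<n pm) , (λ { refl → ¬pn pm }) ]′ (m≤n⇒m<n∨m≡n (≤-pred m<1+n))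

  greatest : ∀ {P : ℕ → Set} → (∀ n → Dec (P n)) → ∀ n → (∀ m → P m → m ≤ n) → ∀ {m} → P m → ∃ λ g → IsGreatest P g
  greatest {P} P? zero bound {m} p = 0 , (subst P (n≤0⇒n≡0 (bound m p)) p) , bound
  greatest P? (suc n) bound p with P? (suc n)
  ... | yes q = suc n , q , bound
  ... | no ¬q = greatest P? n (λ m pm → ≤-pred (≤∧≢⇒< (bound m pm) λ { refl → ¬q pm })) p

  -- An upper bound alone does not exhibit the Ramsey number. It is found by search, as for each `N`
  -- only finitely many colourings and embeddings have to be tested.
  ramseyNumber-≤ : ∀ {m n} k (G : Hypergraph m) (H : Hypergraph n) N →
    ((c : Subset N → Colour) → Contains (colourGraph k c red) G ⊎ Contains (colourGraph k c blue) H) →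
    ∃ λ R → IsRamseyNumber k G H R × R ≤ N
  ramseyNumber-≤ k G H = least λ N → allColourings? N
    (λ eq → [ (λ (f , inj , h) → inj₁ (f , inj , λ e Ge → recolour eq red (h e Ge))) ,
              (λ (f , inj , h) → inj₂ (f , inj , λ e He → recolour eq blue (h e He))) ]′)
    (λ c → contains? (colourGraph k c red) G ⊎-dec contains? (colourGraph k c blue) H)
    where
    recolour : ∀ {N} {c c′ : Subset N → Colour} → (∀ e → c e ≡ c′ e) → ∀ x {e} →
               Edge (colourGraph k c x) e → Edge (colourGraph k c′ x) e
    recolour eq x {e} (size , col) = size , trans (sym (eq e)) col

  ∈-slice⁺ : ∀ (L : List (Fin N)) m k (p : Fin (length L)) → m ≤ toℕ p → toℕ p < m + k → lookup L p ∈ take k (drop m L)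
  ∈-slice⁺ (x ∷ L) zero (suc k) zero _ _ = here refl
  ∈-slice⁺ (x ∷ L) zero (suc k) (suc p) _ (s≤s h) = there (∈-slice⁺ L zero k p z≤n h)
  ∈-slice⁺ (x ∷ L) (suc m) k (suc p) (s≤s le) (s≤s h) = ∈-slice⁺ L m k p le h

  ∈-slice⁻ : ∀ (L : List (Fin N)) m k {y} → y ∈ take k (drop m L) →
             ∃ λ (p : Fin (length L)) → m ≤ toℕ p × toℕ p < m + k × y ≡ lookup L p
  ∈-slice⁻ [] zero (suc k) ()
  ∈-slice⁻ [] (suc m) (suc k) ()
  ∈-slice⁻ (x ∷ L) zero (suc k) (here eq) = zero , z≤n , s≤s z≤n , eq
  ∈-slice⁻ (x ∷ L) zero (suc k) (there w) = let p , _ , h , eq = ∈-slice⁻ L zero k w in suc p , z≤n , s≤s h , eq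
  ∈-slice⁻ (x ∷ L) (suc m) k w = let p , le , h , eq = ∈-slice⁻ L m k w in suc p , s≤s le , s≤s h , eq

  -- Red loose paths and their extension through cliques

  module RedPaths {N : ℕ} (Red : List (Fin N) → Set)
                  (Red-↭ : ∀ {l l′} → l ↭ l′ → Red l → Red l′) (d : ℕ) where

    V : Set
    V = Fin N

    Clique : List V → Set
    Clique Y = ∀ {l} → length l ≡ 2 + d → Unique l → l ⊆ Y → Red l

    -- RPath x vs y: a red loose path with consecutive vertices x ∷ vs ending at y.
    data RPath : V → List V → V → Set where
      []   : ∀ {x} → RPath x [] x
      step : ∀ {x t z vs y} → length t ≡ d → Red (x ∷ t ++ z ∷ []) → RPath z vs y →
             RPath x (t ++ z ∷ vs) y

    infixr 5 _▷_
    _▷_ : ∀ {x vs y ws z} → RPath x vs y → RPath y ws z → RPath x (vs ++ ws) z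
    [] ▷ q = q
    _▷_ {ws = ws} (step {t = t} {z} {vs} len r p) q =
      subst (λ l → RPath _ l _) (sym (++-assoc t (z ∷ vs) ws)) (step len r (p ▷ q))

    edge : ∀ {x t z} → length t ≡ d → Red (x ∷ t ++ z ∷ []) → RPath x (t ++ z ∷ []) z
    edge len r = step len r []

    reverse : ∀ {x vs y} → RPath x vs y → ∃ λ ws → RPath y ws x × y ∷ ws ↭ x ∷ vs
    reverse [] = [] , [] , ↭-refl
    reverse (step {x} {t} {z} {vs} {y} len r p) with reverse p
    ... | ws , q , π = ws ++ t ++ x ∷ [] , q ▷ edge len (Red-↭ σ r) ,
          ↭-trans (Perm.++⁺ʳ (t ++ x ∷ []) π)
            (rearrange ([ z ] ∷ vs ∷ t ∷ [ x ] ∷ [])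
            ((# 0 ⊕ # 1) ⊕ (# 2 ⊕ # 3))
            (# 3 ⊕ (# 2 ⊕ (# 0 ⊕ # 1))) refl)
      where
      σ : x ∷ t ++ z ∷ [] ↭ z ∷ t ++ x ∷ []
      σ = rearrange ([ x ] ∷ t ∷ [ z ] ∷ [])
            (# 0 ⊕ (# 1 ⊕ # 2))
            (# 2 ⊕ (# 1 ⊕ # 0)) refl

    end∈ : ∀ {x vs y} → RPath x vs y → y ∈ x ∷ vs
    end∈ [] = here refl
    end∈ (step {t = t} _ _ p) = there (∈-++⁺ʳ t (end∈ p))

    -- The first vertex is not counted: a path with `q` edges has `suc (size q)` vertices, so
    -- `size q` is n - 1.
    size : ℕ → ℕ
    size q = q * suc d

    length-RPath : ∀ {x vs y} → RPath x vs y → ∃ λ q → length vs ≡ size q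
    length-RPath [] = 0 , refl
    length-RPath (step {t = t} {vs = vs} len _ p) with length-RPath p
    ... | q , eq = suc q , trans (length-++ t) (trans (cong₂ (λ a b → a + suc b) len eq) (+-suc d _))

    Win : ℕ → Set
    Win q = ∃ λ x → ∃ λ vs → ∃ λ y → RPath x vs y × Unique (x ∷ vs) × size q ≤ length vs

    size-≤ : ∀ {x vs y} q → RPath x vs y → size q ≤ length vs + d → size q ≤ length vs
    size-≤ {vs = vs} q p h with length-RPath p
    ... | q′ , eq with q ≤? q′
    ... | yes le = ≤-trans (*-monoˡ-≤ (suc d) le) (≤-reflexive (sym eq))
    ... | no nle = ⊥-elim (<⇒≱ bad (≤-trans (*-monoˡ-≤ (suc d) (≰⇒> nle)) h))
      where
      bad : length vs + d < size (suc q′)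
      bad = s≤s (≤-reflexive (trans (cong (_+ d) eq) (+-comm (size q′) d)))

    edgePath : ∀ {e c c′ t} → length e ≡ 2 + d → Red e → e ↭ c ∷ c′ ∷ t → RPath c (t ++ c′ ∷ []) c′
    edgePath {e} {c} {c′} {t} len r π =
      edge (suc-injective (suc-injective (trans (sym (Perm.↭-length π)) len)))
           (Red-↭ (↭-trans π (prep c (Perm.∷↭∷ʳ c′ t))) r)

    tailPath : ∀ {x} f → length f ≡ suc d → Red (x ∷ f) → ∃ λ vs → ∃ λ y → RPath x vs y × vs ↭ f
    tailPath {x} (z ∷ t) len r =
      t ++ z ∷ [] , z , edge (suc-injective len) (Red-↭ (prep x (↭-sym σ)) r) , σ
      where σ = ↭-sym (Perm.∷↭∷ʳ z t)

    cliqueEdge : ∀ {Y y t c} → Clique Y → y ∈ Y → t ⊆ Y → c ∈ Y → length t ≡ d →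
                 Unique (y ∷ t ++ c ∷ []) → RPath y (t ++ c ∷ []) c
    cliqueEdge {Y} {y} {t} {c} cl y∈ t⊆ c∈ len u = edge len
      (cl (cong suc (trans (length-++ t) (trans (+-comm (length t) 1) (cong suc len)))) u sub)
      where
      sub : y ∷ t ++ c ∷ [] ⊆ Y
      sub (here refl) = y∈
      sub (there v∈) with ∈-++⁻ t v∈
      ... | inj₁ v∈t = t⊆ v∈t
      ... | inj₂ (here refl) = c∈

    -- Each step spends `suc d` vertices of `C` on a clique edge at the end of the path. `D` is held
    -- back for an edge that is added later, which is why the clique is still known at the new end.
    -- `n` is fuel.
    extendAll : ∀ n {z vs y D C} → length C ≤ n → RPath z vs y → Clique (y ∷ D ++ C) →
                Unique ((z ∷ vs) ++ D ++ C) →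
                ∃ λ vs′ → ∃ λ y′ → ∃ λ C′ → RPath z vs′ y′ × vs′ ++ C′ ↭ vs ++ C ×
                  length C′ ≤ d × Clique (y′ ∷ D ++ C′)
    extendAll n {vs = vs} {y} {D} {C} len p cl u with length C ≤? d
    ... | yes le = vs , y , C , p , ↭-refl , le , cl
    ... | no nle with splitAt-length d C (<⇒≤ (≰⇒> nle))
    extendAll n len p cl u | no nle | t , [] , refl , lt =
      ⊥-elim (nle (≤-reflexive (trans (length-++ t) (trans (+-identityʳ _) lt))))
    extendAll zero len p cl u | no nle | t , c ∷ C₁ , refl , lt =
      ⊥-elim (nle (≤-trans len z≤n))
    extendAll (suc n) {z} {vs} {y} {D} len p cl u | no nle | t , c ∷ C₁ , refl , lt
      with Unique-++⁻ (z ∷ vs) (Unique-resp-↭ π u)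
      where
      π : (z ∷ vs) ++ D ++ t ++ c ∷ C₁ ↭ (z ∷ vs) ++ (t ++ c ∷ []) ++ D ++ C₁
      π = rearrange ([ z ] ∷ vs ∷ D ∷ [ c ] ∷ t ∷ C₁ ∷ [])
            ((# 0 ⊕ # 1) ⊕ (# 2 ⊕ (# 4 ⊕ (# 3 ⊕ # 5))))
            ((# 0 ⊕ # 1) ⊕ ((# 4 ⊕ # 3) ⊕ (# 2 ⊕ # 5))) refl
    ... | _ , u′ , dis with Unique-++⁻ (t ++ c ∷ []) u′
    ... | ut , _ , _
      with extendAll n {z} {vs ++ t ++ c ∷ []} {c} {D} {C₁} len₁ (p ▷ st) cl₁ (Unique-resp-↭ π u)
      where
      len₁ : length C₁ ≤ n
      len₁ = ≤-pred (≤-trans (≤-trans (m≤n+m _ (length t)) (≤-reflexive (sym (length-++ t)))) len)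
      st : RPath y (t ++ c ∷ []) c
      st = cliqueEdge cl (here refl) (λ v∈ → there (∈-++⁺ʳ D (∈-++⁺ˡ v∈)))
             (there (∈-++⁺ʳ D (∈-++⁺ʳ t (here refl)))) lt
             (Unique-∷⁺ (λ y∈ → dis (end∈ p , ∈-++⁺ˡ y∈)) ut)
      cl₁ : Clique (c ∷ D ++ C₁)
      cl₁ l≡ ul sub = cl l≡ ul (g ∘ sub)
        where
        g : c ∷ D ++ C₁ ⊆ y ∷ D ++ t ++ c ∷ C₁
        g (here refl) = there (∈-++⁺ʳ D (∈-++⁺ʳ t (here refl)))
        g (there v∈) with ∈-++⁻ D v∈
        ... | inj₁ w = there (∈-++⁺ˡ w)
        ... | inj₂ w = there (∈-++⁺ʳ D (∈-++⁺ʳ t (there w)))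
      π : (z ∷ vs) ++ D ++ t ++ c ∷ C₁ ↭ (z ∷ (vs ++ t ++ c ∷ [])) ++ D ++ C₁
      π = rearrange ([ z ] ∷ vs ∷ D ∷ [ c ] ∷ t ∷ C₁ ∷ [])
            ((# 0 ⊕ # 1) ⊕ (# 2 ⊕ (# 4 ⊕ (# 3 ⊕ # 5))))
            ((# 0 ⊕ (# 1 ⊕ (# 4 ⊕ # 3))) ⊕ (# 2 ⊕ # 5)) refl
    ... | vs′ , y′ , C′ , p′ , π , le , cl′ = vs′ , y′ , C′ , p′ , ↭-trans π σ , le , cl′
      where
      σ : (vs ++ t ++ c ∷ []) ++ C₁ ↭ vs ++ t ++ c ∷ C₁
      σ = rearrange (vs ∷ t ∷ [ c ] ∷ C₁ ∷ [])
            ((# 0 ⊕ (# 1 ⊕ # 2)) ⊕ # 3)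
            (# 0 ⊕ (# 1 ⊕ (# 2 ⊕ # 3))) refl

    Clique-⊆ : ∀ {Y Z} → Z ⊆ Y → Clique Y → Clique Z
    Clique-⊆ sub cl l≡ u s = cl l≡ u (sub ∘ s)

    ∷-⊆ : ∀ {x : V} {Y Z} → Z ⊆ Y → x ∷ Z ⊆ x ∷ Y
    ∷-⊆ s (here p) = here p
    ∷-⊆ s (there p) = there (s p)

    Attachable : List V → List V → Set
    Attachable C l = ∃ λ c → c ∈ C × length l ≡ suc d × Red (c ∷ l)

    -- The attaching vertex `c` and `d` more vertices `t` are set aside while the rest of `C` is
    -- used up; then a clique edge through `t` leads to `c`, from which the edge `c ∷ l` completes
    -- the path.
    finalEnd : ∀ {z vs y C l} → RPath z vs y → Clique (y ∷ C) → Unique ((z ∷ vs) ++ C ++ l) →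
               suc d ≤ length C → l ≡ [] ⊎ Attachable C l →
               ∃ λ vs′ → ∃ λ y′ → ∃ λ rest → RPath z vs′ y′ × vs′ ++ rest ↭ vs ++ C ++ l × length rest ≤ d
    finalEnd {z} {vs} {y} {C} p cl u _ (inj₁ refl)
      with extendAll (length C) {D = []} ≤-refl p cl
             (subst (λ l → Unique ((z ∷ vs) ++ l)) (++-identityʳ C) u)
    ... | vs′ , y′ , C′ , p′ , π , le , _ =
      vs′ , y′ , C′ , p′ , subst (λ l → vs′ ++ C′ ↭ vs ++ l) (sym (++-identityʳ C)) π , le
    finalEnd {z} {vs} {y} {C} {l} p cl u big (inj₂ (c , c∈ , l≡ , r)) with ∈⇒↭ c∈
    ... | C₀ , π₀ with splitAt-length d C₀ (≤-pred (≤-trans big (≤-reflexive (Perm.↭-length π₀))))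
    ... | t , C₁ , refl , lt
      with extendAll (length C₁) {D = c ∷ t} ≤-refl p (Clique-⊆ (∷-⊆ (∈-resp (↭-sym π₀))) cl)
             (proj₁ (Unique-++⁻ _ (Unique-resp-↭ π₁ u))) | tailPath l l≡ r
      where
      π₁ : (z ∷ vs) ++ C ++ l ↭ ((z ∷ vs) ++ (c ∷ t) ++ C₁) ++ l
      π₁ = ↭-trans (Perm.++⁺ˡ (z ∷ vs) (Perm.++⁺ʳ l π₀))
            (rearrange ([ z ] ∷ vs ∷ [ c ] ∷ t ∷ C₁ ∷ l ∷ [])
            ((# 0 ⊕ # 1) ⊕ ((# 2 ⊕ (# 3 ⊕ # 4)) ⊕ # 5))
            (((# 0 ⊕ # 1) ⊕ ((# 2 ⊕ # 3) ⊕ # 4)) ⊕ # 5) refl)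
    ... | vs′ , y′ , C′ , p′ , π , le , cl′ | ws , w , q , σ =
      vs′ ++ (t ++ c ∷ []) ++ ws , w , C′ , p′ ▷ st ▷ q , total , le
      where
      total : (vs′ ++ (t ++ c ∷ []) ++ ws) ++ C′ ↭ vs ++ C ++ l
      total = ↭-trans
        (rearrange (vs′ ∷ t ∷ [ c ] ∷ ws ∷ C′ ∷ [])
            ((# 0 ⊕ ((# 1 ⊕ # 2) ⊕ # 3)) ⊕ # 4)
            ((# 0 ⊕ # 4) ⊕ ((# 2 ⊕ # 1) ⊕ # 3)) refl)
        (↭-trans (Perm.++⁺ π (Perm.++⁺ˡ (c ∷ t) σ))
        (↭-trans
        (rearrange (vs ∷ C₁ ∷ [ c ] ∷ t ∷ l ∷ [])
            ((# 0 ⊕ # 1) ⊕ ((# 2 ⊕ # 3) ⊕ # 4))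
            (# 0 ⊕ ((# 2 ⊕ (# 3 ⊕ # 1)) ⊕ # 4)) refl)
        (Perm.++⁺ˡ vs (Perm.++⁺ʳ l (↭-sym π₀)))))
      u′ : Unique ((z ∷ vs′) ++ (t ++ c ∷ []) ++ (ws ++ C′))
      u′ = Unique-resp-↭ (↭-trans (prep z (↭-sym total))
        (rearrange ([ z ] ∷ vs′ ∷ t ∷ [ c ] ∷ ws ∷ C′ ∷ [])
            (# 0 ⊕ ((# 1 ⊕ ((# 2 ⊕ # 3) ⊕ # 4)) ⊕ # 5))
            ((# 0 ⊕ # 1) ⊕ ((# 2 ⊕ # 3) ⊕ (# 4 ⊕ # 5))) refl)) u
      st : RPath y′ (t ++ c ∷ []) c
      st with Unique-++⁻ (z ∷ vs′) u′
      ... | _ , u″ , dis = cliqueEdge cl′ (here refl) (λ v∈ → there (∈-++⁺ˡ {xs = c ∷ t} (there v∈))) (there (here refl)) lt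
        (Unique-∷⁺ (λ y∈ → dis (end∈ p′ , ∈-++⁺ˡ y∈)) (proj₁ (Unique-++⁻ (t ++ c ∷ []) u″)))

    finalWin : ∀ {z vs y C l} q → RPath z vs y → Clique (y ∷ C) → Unique ((z ∷ vs) ++ C ++ l) →
               suc d ≤ length C → l ≡ [] ⊎ Attachable C l →
               size q ≤ length vs + (length C + length l) → Win q
    finalWin {z} {vs} {C = C} {l} q p cl u big att h with finalEnd p cl u big att
    ... | vs′ , y′ , rest , p′ , π , le = z , vs′ , y′ , p′ ,
      proj₁ (Unique-++⁻ (z ∷ vs′) (Unique-resp-↭ (prep z (↭-sym π)) u)) ,
      size-≤ q p′ (≤-trans h (≤-trans (≤-reflexive len) (+-monoʳ-≤ (length vs′) le)))
      where
      len : length vs + (length C + length l) ≡ length vs′ + length rest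
      len = trans (cong (length vs +_) (sym (length-++ C)))
        (trans (sym (length-++ vs)) (trans (sym (Perm.↭-length π)) (length-++ vs′)))

    -- Two candidates for the attaching vertex, so that both ends of a path can be served.
    End : List V → List V → Set
    End F l = ∃₂ λ a b → a ≢ b × a ∈ F × b ∈ F × length l ≡ suc d × Red (a ∷ l) × Red (b ∷ l)

    -- Each end takes `suc d` vertices of `F`. The set `r` is attached beyond `y` by way of `c`; the
    -- reversed path then ends at `x`, where `finalWin` uses up the rest of `F` before it attaches
    -- `l` at `a`.
    finish : ∀ q {x vs y F l r} → RPath x vs y → Clique (x ∷ y ∷ F) → Unique ((x ∷ vs) ++ F ++ l ++ r) →
             2 * suc d ≤ length F → l ≡ [] ⊎ End F l → r ≡ [] ⊎ End F r →
             size q ≤ length vs + (length F + (length l + length r)) → Win q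
    finish q {x} {vs} {y} {F} {l} p cl u big (inj₁ refl) r h =
      finalWin q p (Clique-⊆ there cl) u (≤-trans (m≤m+n _ _) big) (attach r) h
      where
      attach : ∀ {r} → r ≡ [] ⊎ End F r → r ≡ [] ⊎ Attachable F r
      attach (inj₁ e) = inj₁ e
      attach (inj₂ (a , b , _ , a∈ , _ , l≡ , ra , _)) = inj₂ (a , a∈ , l≡ , ra)
    finish q {x} {vs} {y} {F} {l} p cl u big l≡@(inj₂ _) (inj₁ refl) h =
      finish q {l = []} {r = l} p cl (subst (λ l → Unique ((x ∷ vs) ++ F ++ l)) (++-identityʳ l) u) big (inj₁ refl) l≡
        (≤-trans h (≤-reflexive (cong (λ n → length vs + (length F + n)) (+-identityʳ (length l)))))
    finish q {x} {vs} {y} {F} {l} {r} p cl u big (inj₂ (a , _ , _ , a∈ , _ , l≡ , ra , _)) (inj₂ er) h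
      with other er
      where
      other : End F r → ∃ λ c → c ∈ F × c ≢ a × length r ≡ suc d × Red (c ∷ r)
      other (b , c , b≢c , b∈ , c∈ , r≡ , rb , rc) with b Fin.≟ a
      ... | no b≢a = b , b∈ , b≢a , r≡ , rb
      ... | yes refl = c , c∈ , b≢c ∘ sym , r≡ , rc
    ... | c , c∈ , c≢a , r≡ , rc with ∈₂⇒↭ c∈ a∈ c≢a
    ... | F₀ , π₀ with splitAt-length d F₀ lenF₀
      where
      lenF₀ : d ≤ length F₀
      lenF₀ = ≤-pred (≤-pred (≤-trans (≤-trans (≤-reflexive (+-comm 1 (suc d)))
        (+-monoʳ-≤ (suc d) (s≤s z≤n))) (≤-trans big (≤-reflexive (Perm.↭-length π₀)))))
    ... | t , F₁ , refl , lt with tailPath r r≡ rc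
    ... | ws , w , qr , σ with Unique-++⁻ (x ∷ vs) (Unique-resp-↭ π₁ u)
      where
      π₁ : (x ∷ vs) ++ F ++ l ++ r ↭ (x ∷ vs) ++ (t ++ c ∷ []) ++ (a ∷ F₁ ++ l ++ r)
      π₁ = Perm.++⁺ˡ (x ∷ vs) (↭-trans (Perm.++⁺ʳ (l ++ r) π₀)
        (rearrange ([ c ] ∷ [ a ] ∷ t ∷ F₁ ∷ l ∷ r ∷ [])
            ((# 0 ⊕ (# 1 ⊕ (# 2 ⊕ # 3))) ⊕ (# 4 ⊕ # 5))
            ((# 2 ⊕ # 0) ⊕ (# 1 ⊕ (# 3 ⊕ (# 4 ⊕ # 5)))) refl))
    ... | _ , u₁ , dis with reverse (p ▷ st ▷ qr)
      where
      st : RPath y (t ++ c ∷ []) c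
      st = cliqueEdge cl (there (here refl)) (λ v∈ → there (there (∈-resp (↭-sym π₀) (there (there (∈-++⁺ˡ v∈))))))
        (there (there c∈)) lt
        (Unique-∷⁺ (λ y∈ → dis (end∈ p , ∈-++⁺ˡ y∈)) (proj₁ (Unique-++⁻ (t ++ c ∷ []) u₁)))
    ... | vs′ , p′ , ρ = finalWin q p′ cl′ u′ big′ (inj₂ (a , here refl , l≡ , ra)) h′
      where
      cl′ : Clique (x ∷ a ∷ F₁)
      cl′ = Clique-⊆ (∷-⊆ λ v∈ → there (∈-resp (↭-sym π₀) (there (∷-⊆ (∈-++⁺ʳ t) v∈)))) cl
      all↭ : (w ∷ vs′) ++ (a ∷ F₁) ++ l ↭ (x ∷ vs) ++ F ++ l ++ r
      all↭ = ↭-trans (Perm.++⁺ʳ ((a ∷ F₁) ++ l) ρ)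
        (↭-trans (↭-trans
          (rearrange ([ x ] ∷ vs ∷ t ∷ [ c ] ∷ ws ∷ [ a ] ∷ F₁ ∷ l ∷ [])
            ((# 0 ⊕ (# 1 ⊕ ((# 2 ⊕ # 3) ⊕ # 4))) ⊕ ((# 5 ⊕ # 6) ⊕ # 7))
            (# 4 ⊕ ((# 0 ⊕ # 1) ⊕ ((# 3 ⊕ (# 5 ⊕ (# 2 ⊕ # 6))) ⊕ # 7))) refl)
          (Perm.++⁺ σ (Perm.++⁺ˡ (x ∷ vs) (Perm.++⁺ʳ l (↭-sym π₀)))))
          (rearrange (r ∷ [ x ] ∷ vs ∷ F ∷ l ∷ [])
            (# 0 ⊕ ((# 1 ⊕ # 2) ⊕ (# 3 ⊕ # 4)))
            ((# 1 ⊕ # 2) ⊕ (# 3 ⊕ (# 4 ⊕ # 0))) refl))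
      u′ : Unique ((w ∷ vs′) ++ (a ∷ F₁) ++ l)
      u′ = Unique-resp-↭ (↭-sym all↭) u
      lenF : length F ≡ suc (suc (d + length F₁))
      lenF = trans (Perm.↭-length π₀) (cong (2 +_) (trans (length-++ t {F₁}) (cong (_+ length F₁) lt)))
      big′ : suc d ≤ suc (length F₁)
      big′ = +-cancelˡ-≤ (suc d) _ _ (≤-trans (≤-reflexive (cong (suc d +_) (sym (+-identityʳ (suc d)))))
        (≤-trans big (≤-reflexive (trans lenF (cong suc (sym (+-suc d _)))))))
      h′ : size q ≤ length vs′ + (suc (length F₁) + length l)
      h′ = ≤-trans h (≤-reflexive (suc-injective (trans
        (cong suc (sym (trans (length-++ vs) (cong (length vs +_) (trans (length-++ F) (cong (length F +_) (length-++ l)))))))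
        (trans (sym (Perm.↭-length all↭))
          (cong suc (trans (length-++ vs′) (cong (λ n → length vs′ + suc n) (length-++ F₁))))))))

    -- Balloons and systems of disjoint balloons

    IsEdge : List V → Set
    IsEdge e = length e ≡ 2 + d × Unique e × Red e

    edgeBetween : ∀ {e c c′} → IsEdge e → c ∈ e → c′ ∈ e → c ≢ c′ →
                  ∃ λ es → RPath c es c′ × c ∷ es ↭ e
    edgeBetween (len , _ , r) c∈ c′∈ c≢ with ∈₂⇒↭ c∈ c′∈ c≢
    ... | t , π = _ , edgePath len r π , ↭-sym (↭-trans π (prep _ (Perm.∷↭∷ʳ _ t)))

    cherryPath : ∀ {x y z f g f′ g′} → length f ≡ suc d → length g ≡ suc d → f ↭ z ∷ f′ → g ↭ z ∷ g′ →
                 Red (x ∷ f) → Red (y ∷ g) → ∃ λ es → RPath x es y × x ∷ es ↭ x ∷ y ∷ z ∷ f′ ++ g′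
    cherryPath {x} {y} {z} {f′ = f′} {g′} lf lg πf πg rf rg =
      _ , edgePath (cong suc lf) rf (prep x πf) ▷ edgePath (cong suc lg) rg (↭-trans (prep y πg) (swap y z ↭-refl)) ,
      rearrange ([ x ] ∷ [ y ] ∷ [ z ] ∷ f′ ∷ g′ ∷ [])
            (# 0 ⊕ ((# 3 ⊕ # 2) ⊕ (# 4 ⊕ # 1)))
            (# 0 ⊕ (# 1 ⊕ (# 2 ⊕ (# 3 ⊕ # 4)))) refl

    uniqueEdge : ∀ {y c : V} {t} → Unique t → y ∉ t → c ∉ t → y ≢ c → Unique (y ∷ t ++ c ∷ [])
    uniqueEdge {y} {c} {t} u y∉ c∉ y≢c = Unique-∷⁺ y∉′ (Unique-resp-↭ (Perm.∷↭∷ʳ c t) (Unique-∷⁺ c∉ u))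
      where
      y∉′ : y ∉ t ++ c ∷ []
      y∉′ y∈ with ∈-++⁻ t y∈
      ... | inj₁ w = y∉ w
      ... | inj₂ (here eq) = y≢c eq

    -- Both ends of the path belong to the clique, so the path can be continued on either side. `K`
    -- is kept even when its vertices enter a path; what is still available is computed by `free`.
    record Balloon : Set where
      field
        x y     : V
        vs K    : List V
        path    : RPath x vs y
        clique  : Clique (x ∷ y ∷ K)
        uniqueK : Unique K
      verts : List V
      verts = x ∷ vs
    open Balloon public

    attach : (b : Balloon) → ∀ {t c es c′} → length t ≡ d → t ⊆ K b → c ∈ K b → c′ ∈ K b →
             Unique (y b ∷ t ++ c ∷ []) → RPath c es c′ → Balloon
    attach b {t} {c} {es} {c′} lt t⊆ c∈ c′∈ u p = record
      { x = x b ; y = c′ ; vs = vs b ++ (t ++ c ∷ []) ++ es ; K = K b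
      ; path = path b ▷ cliqueEdge (clique b) (there (here refl)) (there ∘ there ∘ t⊆) (there (there c∈)) lt u ▷ p
      ; clique = Clique-⊆ sub (clique b)
      ; uniqueK = uniqueK b }
      where
      sub : x b ∷ c′ ∷ K b ⊆ x b ∷ y b ∷ K b
      sub (here eq) = here eq
      sub (there (here refl)) = there (there c′∈)
      sub (there (there v∈)) = there (there v∈)

    -- Paths are disjoint from paths and cores from cores, but a path may run through any core, its
    -- own or that of another balloon.
    record System (r : ℕ) : Set where
      field
        b     : Fin r → Balloon
        uniqP : ∀ i → Unique (verts (b i))
        disjP : ∀ {i j v} → v ∈ verts (b i) → v ∈ verts (b j) → i ≡ j
        disjK : ∀ {i j v} → v ∈ K (b i) → v ∈ K (b j) → i ≡ j
      paths : List V
      paths = concat (tabulate (verts ∘ b))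
      free : Fin r → List V
      free i = K (b i) ∖ paths
      cores : List V
      cores = concat (tabulate (K ∘ b))
    open System public

    module _ {A : Set} where
      ∈-concatTabulate⁺ : ∀ {r v} (f : Fin r → List A) i → v ∈ f i → v ∈ concat (tabulate f)
      ∈-concatTabulate⁺ f i v∈ = ∈-concat⁺′ v∈ (∈-tabulate⁺ i)

      ∈-concatTabulate⁻ : ∀ {r v} (f : Fin r → List A) → v ∈ concat (tabulate f) → ∃ λ i → v ∈ f i
      ∈-concatTabulate⁻ f v∈ with ∈-concat⁻′ (tabulate f) v∈
      ... | _ , v∈xs , xs∈ with ∈-tabulate⁻ xs∈
      ... | i , refl = i , v∈xs

    paths⁺ : ∀ {r} (S : System r) i {v} → v ∈ verts (b S i) → v ∈ paths S
    paths⁺ S i = ∈-concatTabulate⁺ (verts ∘ b S) i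

    paths⁻ : ∀ {r} (S : System r) {v} → v ∈ paths S → ∃ λ i → v ∈ verts (b S i)
    paths⁻ S = ∈-concatTabulate⁻ (verts ∘ b S)

    free-Unique : ∀ {r} (S : System r) i → Unique (free S i)
    free-Unique S i = ∖-Unique (paths S) (uniqueK (b S i))

    restrict : ∀ {r r′} (S : System r) (g : Fin r′ → Fin r) → (∀ {i j} → g i ≡ g j → i ≡ j) → System r′
    restrict S g inj = record
      { b = b S ∘ g ; uniqP = uniqP S ∘ g ; disjP = λ v w → inj (disjP S v w) ; disjK = λ v w → inj (disjK S v w) }

    set : ∀ {r} {A : Set} → (Fin r → A) → Fin r → A → Fin r → A
    set f p a i with i Fin.≟ p
    ... | yes _ = a
    ... | no  _ = f i

    set-≡ : ∀ {r} {A : Set} (f : Fin r → A) p a → set f p a p ≡ a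
    set-≡ f p a with p Fin.≟ p
    ... | yes _ = refl
    ... | no p≢ = ⊥-elim (p≢ refl)

    -- `Z` consists of the vertices that a change takes up. As cores stay the same, `covers` limits
    -- the loss of free vertices in each core to the length of `Z`.
    record _⇑[_]_ {r} (S : System r) (Z : List V) (S′ : System r) : Set where
      field
        sameK  : ∀ i → K (b S′ i) ≡ K (b S i)
        longer : ∀ i → length (verts (b S i)) ≤ length (verts (b S′ i))
        old⊆   : paths S ⊆ paths S′
        new⊆   : Z ⊆ paths S′
        covers : ∀ {v} → v ∈ paths S′ → v ∈ Z ⊎ v ∈ paths S
    open _⇑[_]_ public

    -- A clique edge through `t` leads from the end of the path to `c`, and the ear brings it back
    -- to the core. Hence `c′` can serve as the new end.
    absorb : ∀ {r} (S : System r) p {t c es c′} → RPath c es c′ → c ∈ K (b S p) → c′ ∈ K (b S p) →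
             length t ≡ d → t ⊆ K (b S p) → Fresh (t ++ c ∷ es) (paths S) →
             ∃ λ S′ → S ⇑[ t ++ c ∷ es ] S′
    absorb {r} S p {t} {c} {es} {c′} q c∈ c′∈ lt t⊆ (uZ , dZ) = S′ , record
      { sameK = sameK′ ; longer = longer′ ; old⊆ = old ; new⊆ = λ v∈ → inNew (∈-++⁺ʳ (verts bp) v∈)
      ; covers = cov }
      where
      bp = b S p
      Z = t ++ c ∷ es
      b′ : Balloon
      b′ = attach bp lt t⊆ c∈ c′∈ (uniqueEdge (proj₁ split) y∉ c∉ y≢c) q
        where
        split = Unique-++⁻ t uZ
        yIn : y bp ∈ paths S
        yIn = paths⁺ S p (end∈ (path bp))
        y∉ : y bp ∉ t
        y∉ y∈ = dZ (∈-++⁺ˡ y∈ , yIn)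
        c∉ : c ∉ t
        c∉ c∈t = proj₂ (proj₂ split) (c∈t , here refl)
        y≢c : y bp ≢ c
        y≢c refl = dZ (∈-++⁺ʳ t (here refl) , yIn)
      π : verts b′ ↭ verts bp ++ Z
      π = rearrange ([ x bp ] ∷ vs bp ∷ t ∷ [ c ] ∷ es ∷ [])
            (# 0 ⊕ (# 1 ⊕ ((# 2 ⊕ # 3) ⊕ # 4)))
            ((# 0 ⊕ # 1) ⊕ (# 2 ⊕ (# 3 ⊕ # 4))) refl
      u′ : Unique (verts b′)
      u′ = Unique-resp-↭ (↭-sym π) (Uniq.++⁺ (uniqP S p) uZ (λ { (v , w) → dZ (w , paths⁺ S p v) }))
      split′ : ∀ {v} → v ∈ verts b′ → v ∈ verts bp ⊎ v ∈ Z
      split′ v∈ = ∈-++⁻ (verts bp) (∈-resp π v∈)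
      up : Fin r → Balloon
      up = set (b S) p b′
      uniq : ∀ i → Unique (verts (up i))
      uniq i with i Fin.≟ p
      ... | yes _ = u′
      ... | no _ = uniqP S i
      dis : ∀ {i j v} → v ∈ verts (up i) → v ∈ verts (up j) → i ≡ j
      dis {i} {j} v∈ w∈ with i Fin.≟ p | j Fin.≟ p
      ... | yes refl | yes refl = refl
      ... | no _ | no _ = disjP S v∈ w∈
      dis {i} {j} v∈ w∈ | yes refl | no _ with split′ v∈
      ... | inj₁ v = disjP S v w∈
      ... | inj₂ v = ⊥-elim (dZ (v , paths⁺ S j w∈))
      dis {i} {j} v∈ w∈ | no _ | yes refl with split′ w∈
      ... | inj₁ w = disjP S v∈ w
      ... | inj₂ w = ⊥-elim (dZ (w , paths⁺ S i v∈))
      sameK′ : ∀ i → K (up i) ≡ K (b S i)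
      sameK′ i with i Fin.≟ p
      ... | yes refl = refl
      ... | no _ = refl
      S′ : System r
      S′ = record { b = up ; uniqP = uniq ; disjP = λ {i} {j} → dis {i} {j}
                  ; disjK = λ {i} {j} v w → disjK S (subst (_ ∈_) (sameK′ i) v) (subst (_ ∈_) (sameK′ j) w) }
      longer′ : ∀ i → length (verts (b S i)) ≤ length (verts (up i))
      longer′ i with i Fin.≟ p
      ... | yes refl = ≤-trans (m≤m+n _ (length Z)) (≤-reflexive (trans (sym (length-++ (verts bp))) (sym (Perm.↭-length π))))
      ... | no _ = ≤-refl
      inNew : verts bp ++ Z ⊆ paths S′
      inNew v∈ = paths⁺ S′ p (subst (λ a → _ ∈ verts a) (sym (set-≡ (b S) p b′)) (∈-resp (↭-sym π) v∈))
      old : paths S ⊆ paths S′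
      old v∈ with paths⁻ S v∈
      ... | i , w with i Fin.≟ p
      ... | yes refl = inNew (∈-++⁺ˡ w)
      ... | no i≢p = paths⁺ S′ i (go w)
        where
        go : ∀ {v} → v ∈ verts (b S i) → v ∈ verts (up i)
        go w with i Fin.≟ p
        ... | yes i≡p = ⊥-elim (i≢p i≡p)
        ... | no _ = w
      cov : ∀ {v} → v ∈ paths S′ → v ∈ Z ⊎ v ∈ paths S
      cov v∈ with paths⁻ S′ v∈
      ... | i , w with i Fin.≟ p
      ... | no _ = inj₂ (paths⁺ S i w)
      ... | yes refl with split′ w
      ... | inj₁ a = inj₂ (paths⁺ S p a)
      ... | inj₂ a = inj₁ a

    -- Merging and linking balloons

    k : ℕ
    k = 2 + d

    record _Merges[_,_]_ {r} (S : System (suc r)) (q : Fin (suc r)) (Z : List V) (S′ : System r) : Set where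
      field
        sameK  : ∀ i → K (b S′ i) ≡ K (b S (punchIn q i))
        longer : ∀ i → length (verts (b S (punchIn q i))) ≤ length (verts (b S′ i))
        old⊆   : paths S ⊆ paths S′
        new⊆   : Z ⊆ paths S′
        covers : ∀ {v} → v ∈ paths S′ → v ∈ Z ⊎ v ∈ paths S

    -- Balloon q becomes a detour of the path of balloon p, which leaves K p along e₁ and returns along e₂.
    module Merge {r} (S : System (suc r)) (q : Fin (suc r)) (p : Fin r)
      {e₁ e₂ es₁ es₂ t₁ t₂ t₃ : List V} {a₁ b₁ a₂ b₂ : V}
      (a₁K : a₁ ∈ K (b S (punchIn q p))) (a₂K : a₂ ∈ K (b S (punchIn q p)))
      (b₁K : b₁ ∈ K (b S q)) (b₂K : b₂ ∈ K (b S q)) (b₁∈ : b₁ ∈ e₁) (b₂∈ : b₂ ∈ e₂)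
      (p₁ : RPath a₁ es₁ b₁) (p₂ : RPath b₂ es₂ a₂) (π₁ : a₁ ∷ es₁ ↭ e₁) (π₂ : b₂ ∷ es₂ ↭ e₂)
      (l₁ : length t₁ ≡ d) (l₂ : length t₂ ≡ d) (l₃ : length t₃ ≡ d)
      (t₁⊆ : t₁ ⊆ K (b S q)) (t₂⊆ : t₂ ⊆ K (b S q)) (t₃⊆ : t₃ ⊆ K (b S (punchIn q p)))
      (fr : Fresh (t₃ ++ t₂ ++ t₁ ++ e₁ ++ e₂) (paths S)) where
      uZ = proj₁ fr
      dZ : Disjoint (t₃ ++ t₂ ++ t₁ ++ e₁ ++ e₂) (paths S)
      dZ = proj₂ fr
      Q = b S q
      Z₀ = e₁ ++ e₂
      Z = t₃ ++ t₂ ++ t₁ ++ Z₀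
      S₀ : System r
      S₀ = restrict S (punchIn q) (Fin.punchIn-injective q _ _)
      S₀⊆ : paths S₀ ⊆ paths S
      S₀⊆ v∈ with paths⁻ S₀ v∈
      ... | i , w = paths⁺ S (punchIn q i) w
      off : ∀ {v} → v ∈ Z → v ∉ paths S
      off v w = dZ (v , w)
      inZ₀ : ∀ {v} → v ∈ Z₀ → v ∈ Z
      inZ₀ = ∈-++⁺ʳ t₃ ∘ ∈-++⁺ʳ t₂ ∘ ∈-++⁺ʳ t₁
      u₂ = proj₁ (proj₂ (Unique-++⁻ t₃ uZ))
      d₂ = proj₂ (proj₂ (Unique-++⁻ t₂ u₂))
      u₁ = proj₁ (proj₂ (Unique-++⁻ t₂ u₂))
      d₁ = proj₂ (proj₂ (Unique-++⁻ t₁ u₁))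
      b₁Z = ∈-++⁺ˡ {ys = e₂} b₁∈
      b₂Z = ∈-++⁺ʳ e₁ b₂∈
      into : RPath b₁ (t₁ ++ x Q ∷ []) (x Q)
      into = cliqueEdge (clique Q) (there (there b₁K)) (there ∘ there ∘ t₁⊆) (here refl) l₁
        (uniqueEdge (proj₁ (Unique-++⁻ t₁ u₁)) (λ w → d₁ (w , b₁Z))
          (λ w → off (∈-++⁺ʳ t₃ (∈-++⁺ʳ t₂ (∈-++⁺ˡ w))) (paths⁺ S q (here refl)))
          (λ { refl → off (inZ₀ b₁Z) (paths⁺ S q (here refl)) }))
      out : RPath (y Q) (t₂ ++ b₂ ∷ []) b₂
      out = cliqueEdge (clique Q) (there (here refl)) (there ∘ there ∘ t₂⊆) (there (there b₂K)) l₂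
        (uniqueEdge (proj₁ (Unique-++⁻ t₂ u₂))
          (λ w → off (∈-++⁺ʳ t₃ (∈-++⁺ˡ w)) (paths⁺ S q (end∈ (path Q))))
          (λ w → d₂ (w , ∈-++⁺ʳ t₁ b₂Z))
          (λ { refl → off (inZ₀ b₂Z) (paths⁺ S q (end∈ (path Q))) }))
      -- Across `e₁` into the other core, by a clique edge to the start of the path of `Q`, along
      -- this path, by a clique edge to `b₂`, and across `e₂` back to `a₂`. The set `t₃` joins the
      -- path of balloon `p` to `a₁`.
      ear = es₁ ++ (t₁ ++ x Q ∷ []) ++ vs Q ++ (t₂ ++ b₂ ∷ []) ++ es₂
      earPath : RPath a₁ ear a₂
      earPath = p₁ ▷ into ▷ path Q ▷ out ▷ p₂
      π : t₃ ++ a₁ ∷ ear ↭ Z ++ verts Q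
      π = ↭-trans
        (rearrange (t₃ ∷ [ a₁ ] ∷ es₁ ∷ t₁ ∷ [ x Q ] ∷ vs Q ∷ t₂ ∷ [ b₂ ] ∷ es₂ ∷ [])
            (# 0 ⊕ (# 1 ⊕ (# 2 ⊕ ((# 3 ⊕ # 4) ⊕ (# 5 ⊕ ((# 6 ⊕ # 7) ⊕ # 8))))))
            ((# 0 ⊕ (# 6 ⊕ (# 3 ⊕ ((# 1 ⊕ # 2) ⊕ (# 7 ⊕ # 8))))) ⊕ (# 4 ⊕ # 5)) refl)
        (Perm.++⁺ʳ (verts Q) (Perm.++⁺ˡ t₃ (Perm.++⁺ˡ t₂ (Perm.++⁺ˡ t₁ (Perm.++⁺ π₁ π₂)))))
      fresh : Fresh (t₃ ++ a₁ ∷ ear) (paths S₀)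
      fresh = Unique-resp-↭ (↭-sym π) (Uniq.++⁺ uZ (uniqP S q) (λ { (v , w) → off v (paths⁺ S q w) })) , dis
        where
        dis : Disjoint (t₃ ++ a₁ ∷ ear) (paths S₀)
        dis (v , w) with ∈-++⁻ Z (∈-resp π v)
        ... | inj₁ v∈Z = off v∈Z (S₀⊆ w)
        ... | inj₂ v∈Q with paths⁻ S₀ w
        ... | i , v∈i = Fin.punchInᵢ≢i q i (disjP S v∈i v∈Q)
      merging : ∀ S′ → S₀ ⇑[ t₃ ++ a₁ ∷ ear ] S′ → S Merges[ q , Z ] S′
      merging S′ up = record
        { sameK = sameK up
        ; longer = longer up
        ; old⊆ = λ v∈ → let i , w = paths⁻ S v∈ in old i (q Fin.≟ i) w
        ; new⊆ = λ v → new⊆ up (∈-resp (↭-sym π) (∈-++⁺ˡ v))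
        ; covers = λ v∈ → [ (λ w → [ inj₁ , inj₂ ∘ paths⁺ S q ]′ (∈-++⁻ Z (∈-resp π w))) , inj₂ ∘ S₀⊆ ]′ (covers up v∈) }
        where
        old : ∀ {v} i → Dec (q ≡ i) → v ∈ verts (b S i) → v ∈ paths S′
        old i (yes refl) w = new⊆ up (∈-resp (↭-sym π) (∈-++⁺ʳ Z w))
        old i (no q≢i) w = old⊆ up (paths⁺ S₀ (punchOut q≢i) (subst (λ j → _ ∈ verts (b S j)) (sym (Fin.punchIn-punchOut q≢i)) w))
      merged : ∃ λ S′ → S Merges[ q , Z ] S′
      merged = let S′ , up = absorb S₀ p earPath a₁K a₂K l₃ t₃⊆ fresh in S′ , merging S′ up

    -- The last component of the result tells where `Z` comes from, so that only cores met by the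
    -- two edges are charged for the merge.
    merge : ∀ {r} (S : System (suc r)) q p → let P = b S (punchIn q p); Q = b S q in
            ∀ {e₁ e₂ a₁ b₁ a₂ b₂} → IsEdge e₁ → IsEdge e₂ → Fresh (e₁ ++ e₂) (paths S) →
            a₁ ∈ e₁ → a₁ ∈ K P → b₁ ∈ e₁ → b₁ ∈ K Q →
            a₂ ∈ e₂ → a₂ ∈ K P → b₂ ∈ e₂ → b₂ ∈ K Q →
            mergeCost d ≤ length (free S (punchIn q p)) → mergeCost d ≤ length (free S q) →
            ∃₂ λ S′ Z → S Merges[ q , Z ] S′ × length Z ≡ mergeCost d × e₁ ⊆ Z ×
              (∀ {v} → v ∈ Z → v ∈ e₁ ++ e₂ ⊎ v ∈ K P ⊎ v ∈ K Q)
    merge {r} S q p {e₁} {e₂} {a₁} {b₁} {a₂} {b₂} E₁ E₂ fr a₁∈ a₁K b₁∈ b₁K a₂∈ a₂K b₂∈ b₂K costP costQ =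
      case pick d (e₁ ++ e₂) (uniqueK (b S q)) fr
             (≤-trans (≤-reflexive (cong (d +_) len₀)) (≤-trans (≤-trans (m≤n+m _ d) (m≤n+m _ d)) costQ)) of λ
        { (t₁ , l₁ , t₁⊆ , fr₁) →
      case pick d (t₁ ++ e₁ ++ e₂) (uniqueK (b S q)) fr₁
             (≤-trans (≤-reflexive (cong (d +_) (plus t₁ l₁ len₀))) (≤-trans (m≤n+m _ d) costQ)) of λ
        { (t₂ , l₂ , t₂⊆ , fr₂) →
      case pick d (t₂ ++ t₁ ++ e₁ ++ e₂) (uniqueK (b S (punchIn q p))) fr₂
             (≤-trans (≤-reflexive (cong (d +_) (plus t₂ l₂ (plus t₁ l₁ len₀)))) costP) of λ
        { (t₃ , l₃ , t₃⊆ , fr₃) →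
      case edgeBetween E₁ a₁∈ b₁∈ (λ { refl → Fin.punchInᵢ≢i q p (disjK S a₁K b₁K) }) of λ
        { (es₁ , p₁ , π₁) →
      case edgeBetween E₂ b₂∈ a₂∈ (λ { refl → Fin.punchInᵢ≢i q p (disjK S a₂K b₂K) }) of λ
        { (es₂ , p₂ , π₂) →
      case Merge.merged S q p a₁K a₂K b₁K b₂K b₁∈ b₂∈ p₁ p₂ π₁ π₂ l₁ l₂ l₃ t₁⊆ t₂⊆ t₃⊆ fr₃ of λ
        { (S′ , m) → S′ , t₃ ++ t₂ ++ t₁ ++ e₁ ++ e₂ , m , plus t₃ l₃ (plus t₂ l₂ (plus t₁ l₁ len₀)) ,
         (λ {v} v∈ → first⊆ t₃ t₂ t₁ {v} v∈) , (λ {v} v∈ → from {X = K (b S (punchIn q p))} {Y = K (b S q)} t₃⊆ t₂⊆ t₁⊆ {v} v∈) }}}}}}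
      where
      len₀ : length (e₁ ++ e₂) ≡ k + k
      len₀ = trans (length-++ e₁) (cong₂ _+_ (proj₁ E₁) (proj₁ E₂))
      plus : ∀ t {Z : List V} {m n} → length t ≡ m → length Z ≡ n → length (t ++ Z) ≡ m + n
      plus t lt lZ = trans (length-++ t) (cong₂ _+_ lt lZ)
      first⊆ : ∀ t₃ t₂ t₁ → e₁ ⊆ t₃ ++ t₂ ++ t₁ ++ e₁ ++ e₂
      first⊆ t₃ t₂ t₁ v∈ = ∈-++⁺ʳ t₃ (∈-++⁺ʳ t₂ (∈-++⁺ʳ t₁ (∈-++⁺ˡ v∈)))
      from : ∀ {t₃ t₂ t₁ X Y} → t₃ ⊆ X → t₂ ⊆ Y → t₁ ⊆ Y → ∀ {v} → v ∈ t₃ ++ t₂ ++ t₁ ++ e₁ ++ e₂ →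
             v ∈ e₁ ++ e₂ ⊎ v ∈ X ⊎ v ∈ Y
      from {t₃} {t₂} {t₁} s₃ s₂ s₁ v∈ with ∈-++⁻ t₃ v∈
      ... | inj₁ w = inj₂ (inj₁ (s₃ w))
      ... | inj₂ v∈ with ∈-++⁻ t₂ v∈
      ... | inj₁ w = inj₂ (inj₂ (s₂ w))
      ... | inj₂ v∈ with ∈-++⁻ t₁ v∈
      ... | inj₁ w = inj₂ (inj₂ (s₁ w))
      ... | inj₂ w = inj₁ w

    module Link {r} (S : System r) {i j : Fin r} (i≢j : i ≢ j) {c c′ : V} {es t₁ t₂ : List V}
      (p : RPath c es c′) (c∈ : c ∈ K (b S i)) (c′∈ : c′ ∈ K (b S j))
      (l₁ : length t₁ ≡ d) (l₂ : length t₂ ≡ d) (t₁⊆ : t₁ ⊆ K (b S i)) (t₂⊆ : t₂ ⊆ K (b S j))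
      (fr : Fresh (t₂ ++ t₁ ++ c ∷ es) (paths S)) where
      uZ = proj₁ fr
      dZ : Disjoint (t₂ ++ t₁ ++ c ∷ es) (paths S)
      dZ = proj₂ fr
      I = b S i
      J = b S j
      Z = t₂ ++ t₁ ++ c ∷ es
      u₁ = proj₁ (proj₂ (Unique-++⁻ t₂ uZ))
      d₂ = proj₂ (proj₂ (Unique-++⁻ t₂ uZ))
      d₁ = proj₂ (proj₂ (Unique-++⁻ t₁ u₁))
      off : ∀ {v} → v ∈ Z → v ∉ paths S
      off v w = dZ (v , w)
      yI = paths⁺ S i (end∈ (path I))
      xJ = paths⁺ S j (here refl)
      out : RPath (y I) (t₁ ++ c ∷ []) c
      out = cliqueEdge (clique I) (there (here refl)) (there ∘ there ∘ t₁⊆) (there (there c∈)) l₁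
        (uniqueEdge (proj₁ (Unique-++⁻ t₁ u₁)) (λ w → off (∈-++⁺ʳ t₂ (∈-++⁺ˡ w)) yI)
          (λ w → d₁ (w , here refl)) (λ { refl → off (∈-++⁺ʳ t₂ (∈-++⁺ʳ t₁ (here refl))) yI }))
      c′Z = ∈-++⁺ʳ t₁ (end∈ p)
      into : RPath c′ (t₂ ++ x J ∷ []) (x J)
      into = cliqueEdge (clique J) (there (there c′∈)) (there ∘ there ∘ t₂⊆) (here refl) l₂
        (uniqueEdge (proj₁ (Unique-++⁻ t₂ uZ)) (λ w → d₂ (w , c′Z)) (λ w → off (∈-++⁺ˡ w) xJ)
          (λ { refl → off (∈-++⁺ʳ t₂ c′Z) xJ }))
      π : x I ∷ vs I ++ (t₁ ++ c ∷ []) ++ es ++ (t₂ ++ x J ∷ []) ++ vs J ↭ (verts I ++ verts J) ++ Z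
      π = rearrange ([ x I ] ∷ vs I ∷ t₁ ∷ [ c ] ∷ es ∷ t₂ ∷ [ x J ] ∷ vs J ∷ [])
            (# 0 ⊕ (# 1 ⊕ ((# 2 ⊕ # 3) ⊕ (# 4 ⊕ ((# 5 ⊕ # 6) ⊕ # 7)))))
            (((# 0 ⊕ # 1) ⊕ (# 6 ⊕ # 7)) ⊕ (# 5 ⊕ (# 2 ⊕ (# 3 ⊕ # 4)))) refl
      uAll : Unique ((verts I ++ verts J) ++ Z)
      uAll = Uniq.++⁺ (Uniq.++⁺ (uniqP S i) (uniqP S j) (λ { (v , w) → i≢j (disjP S v w) })) uZ dis
        where
        dis : Disjoint (verts I ++ verts J) Z
        dis (v , w) = off w ([ paths⁺ S i , paths⁺ S j ]′ (∈-++⁻ (verts I) v))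
      longEnough : suc (length (verts I) + length (vs J)) ≤ length ((verts I ++ verts J) ++ Z)
      longEnough = ≤-trans (≤-reflexive (trans (sym (+-suc (length (verts I)) (length (vs J)))) (sym (length-++ (verts I) {verts J}))))
        (≤-trans (m≤m+n _ (length Z)) (≤-reflexive (sym (length-++ (verts I ++ verts J)))))

      -- The connecting vertices are ignored. The count uses `vs` for `j` because `Win` does not
      -- count the first vertex of the new path.
      linked : ∀ q → size q ≤ length (verts (b S i)) + length (vs (b S j)) → Win q
      linked q h = x I , vs I ++ (t₁ ++ c ∷ []) ++ es ++ (t₂ ++ x J ∷ []) ++ vs J , y J ,
        path I ▷ out ▷ p ▷ into ▷ path J , Unique-resp-↭ (↭-sym π) uAll ,
        ≤-trans h (≤-pred (≤-trans longEnough (≤-reflexive (sym (Perm.↭-length π)))))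

    link : ∀ {r} (S : System r) {i j} → i ≢ j → ∀ q {c es c′} → RPath c es c′ → c ∈ K (b S i) → c′ ∈ K (b S j) →
           Fresh (c ∷ es) (paths S) → d + length (c ∷ es) ≤ length (free S i) →
           d + (d + length (c ∷ es)) ≤ length (free S j) →
           size q ≤ length (verts (b S i)) + length (vs (b S j)) → Win q
    link S {i} {j} i≢j q {c} {es} {c′} p c∈ c′∈ fr li lj h =
      case pick d (c ∷ es) (uniqueK (b S i)) fr li of λ { (t₁ , l₁ , t₁⊆ , fr₁) →
      case pick d (t₁ ++ c ∷ es) (uniqueK (b S j)) fr₁
             (≤-trans (≤-reflexive (cong (d +_) (trans (length-++ t₁) (cong (_+ _) l₁)))) lj) of λ
        { (t₂ , l₂ , t₂⊆ , fr₂) → Link.linked S i≢j p c∈ c′∈ l₁ l₂ t₁⊆ t₂⊆ fr₂ q h }}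

    free-⇑ : ∀ {r} {S S′ : System r} {Z} → S ⇑[ Z ] S′ → ∀ i → length (free S i) ≤ length Z + length (free S′ i)
    free-⇑ {S = S} {S′} {Z} up i = subst (λ X → length (free S i) ≤ length Z + length (X ∖ paths S′)) (sym (sameK up i))
      (length-∖ (uniqueK (b S i)) (λ _ → covers up))

    free-Merges : ∀ {r} {S : System (suc r)} {q Z S′} → S Merges[ q , Z ] S′ → ∀ i Z′ →
                  (∀ {v} → v ∈ K (b S (punchIn q i)) → v ∈ Z → v ∈ Z′) →
                  length (free S (punchIn q i)) ≤ length Z′ + length (free S′ i)
    free-Merges {S = S} {q} {Z} {S′} m i Z′ h =
      subst (λ X → length (free S (punchIn q i)) ≤ length Z′ + length (X ∖ paths S′)) (sym (_Merges[_,_]_.sameK m i))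
        (length-∖ (uniqueK (b S (punchIn q i))) λ v∈K v∈ → case _Merges[_,_]_.covers m v∈ of λ
          { (inj₁ v∈Z) → inj₁ (h v∈K v∈Z) ; (inj₂ w) → inj₂ w })

    -- Red edges between the cores

    record Crossing {χ} (C : Fin χ → List V) : Set where
      field
        e      : List V
        isEdge : IsEdge e
        covered : ∀ {v} → v ∈ e → ∃ λ i → v ∈ C i
        {i j}  : Fin χ
        i≢j    : i ≢ j
        {u w}  : V
        u∈     : u ∈ e
        w∈     : w ∈ e
        u∈C    : u ∈ C i
        w∈C    : w ∈ C j

    -- Otherwise the parts would hold a blue copy of `H`, with one colour class in each part: part
    -- zero receives a smallest class of `σ` vertices, and `v` is the number of all vertices of `H`.
    NoBlue : ℕ → ℕ → ℕ → Set
    NoBlue v σ R = (C : Fin (suc R) → List V) → (∀ i → Unique (C i)) →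
      (∀ {i j x} → x ∈ C i → x ∈ C j → i ≡ j) → σ ≤ length (C zero) → (∀ i → v ≤ length (C (suc i))) →
      Crossing C

    NoBlueClique : ℕ → Set
    NoBlueClique v = ∀ Y → Unique Y → v ≤ length Y → ∃ λ e → IsEdge e × e ⊆ Y

    redClique : (∀ l → Dec (Red l)) → ∀ {v} → NoBlueClique v → ∀ a X → Unique X → redCliqueBound d v a ≤ length X →
                ∃ λ Y → Unique Y × Y ⊆ X × length Y ≡ a × Clique Y
    redClique Red? {v} noBlueClique a X uX big with ramsey k (a + v) (does ∘ Red?) X big
    ... | Y , c , Y⊑ , len , hom = answer c hom
      where
      uY : Unique Y
      uY = Unique-⊑ Y⊑ uX
      -- Ramsey's theorem speaks of sublists in the order of `Y`, whereas a clique concerns all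
      -- lists of distinct vertices.
      inOrder : ∀ {l} → Unique l → l ⊆ Y → ∃ λ l′ → l′ ⊑ Y × l ↭ l′
      inOrder {l} ul l⊆ = filter (_∈? l) Y , Sub.filter-⊆ (_∈? l) Y ,
        unique-⊆-↭ ul (Uniq.filter⁺ (_∈? l) uY) (λ w → ∈-filter⁺ (_∈? l) (l⊆ w) w) (λ w → proj₂ (∈-filter⁻ (_∈? l) {xs = Y} w))
      answer : ∀ c → Homogeneous k (does ∘ Red?) Y c → ∃ λ Y → Unique Y × Y ⊆ X × length Y ≡ a × Clique Y
      answer true hom = take a Y , Uniq.take⁺ a uY , ⊑⇒⊆ Y⊑ ∘ take-⊆ a Y , length-take a Y (≤-trans (m≤m+n a v) len) ,
        λ l≡ ul l⊆ → let l′ , s , π = inOrder ul (take-⊆ a Y ∘ l⊆) in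
          Red-↭ (↭-sym π) (does⇒ (Red? l′) (hom s (trans (sym (Perm.↭-length π)) l≡)))
        where
        does⇒ : ∀ {l} (D : Dec (Red l)) → does D ≡ true → Red l
        does⇒ (yes r) _ = r
      answer false hom = ⊥-elim (contra (noBlueClique Y uY (≤-trans (m≤n+m v a) len)))
        where
        does⇏ : ∀ {l} (D : Dec (Red l)) → does D ≡ false → ¬ Red l
        does⇏ (no r) _ = r
        contra : (∃ λ e → IsEdge e × e ⊆ Y) → Empty
        contra (e , (len , ue , r) , e⊆) with inOrder ue e⊆
        ... | l′ , s , π = does⇏ (Red? l′) (hom s (trans (sym (Perm.↭-length π)) len)) (Red-↭ π r)

    -- `q` is the last part that the edge meets. A merge that deletes balloon `q` then takes
    -- vertices from balloons up to `q` only, as the grading below demands.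
    record Labelled {χ} (C : Fin χ → List V) : Set where
      field
        e      : List V
        isEdge : IsEdge e
        p q    : Fin χ
        p<q    : toℕ p < toℕ q
        {u w}  : V
        u∈     : u ∈ e
        w∈     : w ∈ e
        u∈C    : u ∈ C p
        w∈C    : w ∈ C q
        below  : ∀ {v} → v ∈ e → ∃ λ i → toℕ i ≤ toℕ q × v ∈ C i

    highest : ∀ {χ} (C : Fin χ → List V) x e → (∀ {v} → v ∈ x ∷ e → ∃ λ i → v ∈ C i) →
              ∃₂ λ q w → w ∈ x ∷ e × w ∈ C q × (∀ {v} → v ∈ x ∷ e → ∃ λ i → toℕ i ≤ toℕ q × v ∈ C i)
    highest C x [] h with h (here refl)
    ... | i , x∈ = i , x , here refl , x∈ , λ { (here refl) → i , ≤-refl , x∈ }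
    highest C x (x′ ∷ e) h with h (here refl) | highest C x′ e (h ∘ there)
    ... | i , x∈ | q , w , w∈ , w∈C , below with toℕ i ≤? toℕ q
    ... | yes i≤q = q , w , there w∈ , w∈C , λ { (here refl) → i , i≤q , x∈ ; (there v∈) → below v∈ }
    ... | no i≰q = i , x , here refl , x∈ , λ
      { (here refl) → i , ≤-refl , x∈
      ; (there v∈) → let j , j≤ , v∈C = below v∈ in j , ≤-trans j≤ (<⇒≤ (≰⇒> i≰q)) , v∈C }

    -- Of two distinct parts that the edge meets, at least one is not the last; it serves as `p`.
    label : ∀ {χ} (C : Fin χ → List V) → (∀ {i j x} → x ∈ C i → x ∈ C j → i ≡ j) → Crossing C → Labelled C
    label C dis record { e = x ∷ e ; isEdge = E ; covered = ins ; i = i ; j = j ; i≢j = i≢j ; u∈ = u∈ ; w∈ = w∈ ; u∈C = u∈C ; w∈C = w∈C }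
      with highest C x e ins
    ... | q , t , t∈ , t∈C , below with i Fin.≟ q
    ... | no i≢q = record { e = x ∷ e ; isEdge = E ; p = i ; q = q ; p<q = lt (below u∈) ; u∈ = u∈ ; w∈ = t∈ ; u∈C = u∈C ; w∈C = t∈C ; below = below }
      where
      lt : (∃ λ i′ → toℕ i′ ≤ toℕ q × _ ∈ C i′) → toℕ i < toℕ q
      lt (i′ , le , v) with dis v u∈C
      ... | refl = ≤∧≢⇒< le (i≢q ∘ Fin.toℕ-injective)
    ... | yes refl = record { e = x ∷ e ; isEdge = E ; p = j ; q = q ; p<q = lt (below w∈) ; u∈ = w∈ ; w∈ = t∈ ; u∈C = w∈C ; w∈C = t∈C ; below = below }
      where
      lt : (∃ λ i′ → toℕ i′ ≤ toℕ q × _ ∈ C i′) → toℕ j < toℕ q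
      lt (i′ , le , v) with dis v w∈C
      ... | refl = ≤∧≢⇒< le (λ eq → i≢j (sym (Fin.toℕ-injective eq)))

    Labelled-⊆ : ∀ {χ} {C C′ : Fin χ → List V} → (∀ i → C i ⊆ C′ i) → Labelled C → Labelled C′
    Labelled-⊆ s L = record
      { e = e ; isEdge = isEdge ; p = p ; q = q ; p<q = p<q ; u∈ = u∈ ; w∈ = w∈ ; u∈C = s p u∈C ; w∈C = s q w∈C
      ; below = λ v∈ → let i , le , v∈C = below v∈ in i , le , s i v∈C }
      where open Labelled L

    record Pair {χ} (C : Fin χ → List V) : Set where
      field
        L₁ L₂ : Labelled C
        same-p : Labelled.p L₁ ≡ Labelled.p L₂
        same-q : Labelled.q L₁ ≡ Labelled.q L₂
        disjoint : Disjoint (Labelled.e L₁) (Labelled.e L₂)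

    module _ {v σ R : ℕ} (noBlue : NoBlue v σ R) where

      χ : ℕ
      χ = suc R

      disjointEdges : ∀ g (C : Fin χ → List V) → (∀ i → Unique (C i)) →
        (∀ {i j x} → x ∈ C i → x ∈ C j → i ≡ j) → (∀ i → v + σ + g * k ≤ length (C i)) →
        ∃ λ (L : Fin g → Labelled C) → ∀ {i j} → i ≢ j → Disjoint (Labelled.e (L i)) (Labelled.e (L j))
      disjointEdges zero C uC dis big = (λ ()) , λ { {()} }
      disjointEdges (suc g) C uC dis big with disjointEdges g C uC dis
          (λ i → ≤-trans (+-monoʳ-≤ (v + σ) (m≤n+m (g * k) k)) (big i))
      ... | L , disL = L′ , disL′
        where
        Z : List V
        Z = concat (tabulate (Labelled.e ∘ L))
        lenZ : length Z ≤ g * k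
        lenZ = length-concatTabulate (Labelled.e ∘ L) k (λ i → ≤-reflexive (proj₁ (Labelled.isEdge (L i))))
        C′ : Fin χ → List V
        C′ i = C i ∖ Z
        C′⊆ : ∀ i → C′ i ⊆ C i
        C′⊆ i w = proj₁ (∈-∖⁻ (C i) Z w)
        big′ : ∀ i → v + σ ≤ length (C′ i)
        big′ i = +-cancelʳ-≤ (g * k) _ _ (≤-trans (+-monoʳ-≤ (v + σ) (m≤n+m (g * k) k)) (≤-trans (big i)
          (≤-trans (length-≤-∖ Z (uC i)) (≤-trans (+-monoˡ-≤ _ lenZ) (≤-reflexive (+-comm (g * k) _))))))
        dis′ : ∀ {i j x} → x ∈ C′ i → x ∈ C′ j → i ≡ j
        dis′ {i} {j} a b = dis (C′⊆ i a) (C′⊆ j b)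
        new : Labelled C′
        new = label C′ dis′ (noBlue C′ (λ i → ∖-Unique Z (uC i)) dis′ (≤-trans (m≤n+m σ v) (big′ zero))
                (λ i → ≤-trans (m≤m+n v σ) (big′ (suc i))))
        L′ : Fin (suc g) → Labelled C
        L′ zero = Labelled-⊆ C′⊆ new
        L′ (suc i) = L i
        off : ∀ {x} i → x ∈ Labelled.e new → x ∉ Labelled.e (L i)
        off i x∈ w = let _ , _ , x∈C′ = Labelled.below new x∈ in
          proj₂ (∈-∖⁻ (C _) Z x∈C′) (∈-concatTabulate⁺ (Labelled.e ∘ L) i w)
        disL′ : ∀ {i j} → i ≢ j → Disjoint (Labelled.e (L′ i)) (Labelled.e (L′ j))
        disL′ {zero} {zero} i≢j _ = i≢j refl
        disL′ {zero} {suc j} _ (a , b) = off j a b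
        disL′ {suc i} {zero} _ (a , b) = off i b a
        disL′ {suc i} {suc j} i≢j = disL (i≢j ∘ cong suc)

      -- A detour needs an edge out and an edge back between the same two cores. More than `χ * χ`
      -- disjoint edges contain two with equal labels.
      twoEdges : (C : Fin χ → List V) → (∀ i → Unique (C i)) →
        (∀ {i j x} → x ∈ C i → x ∈ C j → i ≡ j) → (∀ i → pairSize d v σ R ≤ length (C i)) → Pair C
      twoEdges C uC dis big with disjointEdges (suc (χ * χ)) C uC dis big
      ... | L , disL with Fin.pigeonhole (n<1+n (χ * χ)) (λ i → combine {χ} {χ} (Labelled.p (L i)) (Labelled.q (L i)))
      ... | i , j , i<j , eq = record
        { L₁ = L i ; L₂ = L j
        ; same-p = proj₁ (Fin.combine-injective (Labelled.p (L i)) (Labelled.q (L i)) (Labelled.p (L j)) (Labelled.q (L j)) eq) ; same-q = proj₂ (Fin.combine-injective (Labelled.p (L i)) (Labelled.q (L i)) (Labelled.p (L j)) (Labelled.q (L j)) eq)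
        ; disjoint = disL (Fin.<⇒≢ i<j) }

    cost : ℕ
    cost = mergeCost d

    free⊆ : ∀ {r} (S : System r) i → free S i ⊆ K (b S i)
    free⊆ S i w = proj₁ (∈-∖⁻ (K (b S i)) (paths S) w)

    free∉ : ∀ {r} (S : System r) i {v} → v ∈ free S i → v ∉ paths S
    free∉ S i w = proj₂ (∈-∖⁻ (K (b S i)) (paths S) w)

    free-disjoint : ∀ {r} (S : System r) {i j v} → v ∈ free S i → v ∈ free S j → i ≡ j
    free-disjoint S {i} {j} a c = disjK S (free⊆ S i a) (free⊆ S j c)

    record MergeResult {r} (S : System (suc r)) (q : Fin (suc r)) : Set where
      field
        {S′}   : System r
        {Z}    : List V
        merges : S Merges[ q , Z ] S′
        lenZ   : length Z ≡ cost
        {a}    : V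
        a∈Z    : a ∈ Z
        a∉     : a ∉ paths S
        below  : ∀ {v} → v ∈ Z → ∃ λ i → toℕ i ≤ toℕ q × v ∈ K (b S i)

    mergePair : ∀ {r χ} (S : System (suc r)) (ι : Fin χ → Fin (suc r)) → (∀ i → toℕ (ι i) ≡ toℕ i) →
                (P : Pair (λ i → free S (ι i))) → (∀ i → cost ≤ length (free S (ι i))) →
                MergeResult S (ι (Labelled.q (Pair.L₁ P)))
    mergePair {r} S ι ι≡ P big =
      case merge S q p′ (L₁.isEdge) (L₂.isEdge) fresh L₁.u∈ (toP L₁.u∈C) L₁.w∈ (free⊆ S q L₁.w∈C)
             L₂.u∈ (toP (subst (λ i → _ ∈ free S (ι i)) (sym same-p) L₂.u∈C)) L₂.w∈
             (free⊆ S q (subst (λ i → _ ∈ free S (ι i)) (sym same-q) L₂.w∈C))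
             (subst (λ i → cost ≤ length (free S i)) (sym p′≡) (big L₁.p)) (big L₁.q) of λ
        { (S′ , Z , m , len , e⊆ , from) → record
          { merges = m ; lenZ = len ; a∈Z = e⊆ L₁.u∈ ; a∉ = free∉ S p L₁.u∈C
          ; below = λ v∈ → [ inE , [ (λ w → p , <⇒≤ p<q , subst (λ i → _ ∈ K (b S i)) p′≡ w) , (λ w → q , ≤-refl , w) ]′ ]′ (from v∈) } }
      where
      open Pair P
      module L₁ = Labelled L₁
      module L₂ = Labelled L₂
      p = ι L₁.p
      q = ι L₁.q
      p<q : toℕ p < toℕ q
      p<q = subst (_< toℕ q) (sym (ι≡ L₁.p)) (subst (toℕ L₁.p <_) (sym (ι≡ L₁.q)) L₁.p<q)
      q≢p : q ≢ p
      q≢p eq = <⇒≢ p<q (cong toℕ (sym eq))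
      p′ = punchOut q≢p
      p′≡ : punchIn q p′ ≡ p
      p′≡ = Fin.punchIn-punchOut q≢p
      toP : ∀ {v} → v ∈ free S p → v ∈ K (b S (punchIn q p′))
      toP w = subst (λ i → _ ∈ K (b S i)) (sym p′≡) (free⊆ S p w)
      inE : ∀ {v} → v ∈ L₁.e ++ L₂.e → ∃ λ i → toℕ i ≤ toℕ q × v ∈ K (b S i)
      inE v∈ with ∈-++⁻ L₁.e v∈
      ... | inj₁ w = let i , le , c = L₁.below w in
        ι i , subst (_≤ toℕ q) (sym (ι≡ i)) (≤-trans le (≤-reflexive (sym (ι≡ L₁.q)))) , free⊆ S (ι i) c
      ... | inj₂ w = let i , le , c = L₂.below w in
        ι i , subst (_≤ toℕ q) (sym (ι≡ i)) (≤-trans le (≤-reflexive (trans (cong toℕ (sym same-q)) (sym (ι≡ L₁.q))))) , free⊆ S (ι i) c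
      off : ∀ {v} → v ∈ L₁.e ++ L₂.e → v ∉ paths S
      off v∈ with ∈-++⁻ L₁.e v∈
      ... | inj₁ w = let i , _ , c = L₁.below w in free∉ S (ι i) c
      ... | inj₂ w = let i , _ , c = L₂.below w in free∉ S (ι i) c
      fresh : Fresh (L₁.e ++ L₂.e) (paths S)
      fresh = Uniq.++⁺ (proj₁ (proj₂ L₁.isEdge)) (proj₁ (proj₂ L₂.isEdge)) disjoint , λ { (v , w) → off v w }

    -- Covering by at most `R` balloons

    consSystem : ∀ {r} (B : Balloon) (S : System r) → Unique (verts B) → Disjoint (verts B) (paths S) →
                 (∀ i → Disjoint (K B) (K (b S i))) → System (suc r)
    consSystem B S u dP dK = record
      { b = consᶠ B (b S)
      ; uniqP = λ { zero → u ; (suc i) → uniqP S i }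
      ; disjP = λ { {zero} {zero} _ _ → refl
                  ; {zero} {suc j} v w → ⊥-elim (dP (v , paths⁺ S j w))
                  ; {suc i} {zero} v w → ⊥-elim (dP (w , paths⁺ S i v))
                  ; {suc i} {suc j} v w → cong suc (disjP S v w) }
      ; disjK = λ { {zero} {zero} _ _ → refl
                  ; {zero} {suc j} v w → ⊥-elim (dK j (v , w))
                  ; {suc i} {zero} v w → ⊥-elim (dK i (w , v))
                  ; {suc i} {suc j} v w → cong suc (disjK S v w) } }

    -- The lower bound on free decreases along the list of balloons.  A merge harms only balloons standing
    -- before the deleted one, and precisely these are moved to a position with a weaker requirement.
    record Graded (R m : ℕ) (X : List V) {r} (S : System r) : Set where
      field
        r≤R     : r ≤ R
        large   : ∀ i → m + (R ∸ toℕ i) * cost ≤ length (free S i)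
        bounded : ∀ i → length (K (b S i)) ≤ freshSize d R m
        paths⊆  : paths S ⊆ X
        cores⊆  : ∀ i → K (b S i) ⊆ X

    -- The number of balloons may stay the same and merges may drop cores; what always improves is
    -- the set of path vertices, which gains `a`. This makes the covering terminate.
    Progress : (R m : ℕ) (X : List V) → ∀ {r} → System r → Set
    Progress R m X S = ∃₂ λ r′ (S′ : System r′) → Graded R m X S′ × paths S ⊆ paths S′ ×
      ∃ λ a → a ∈ X × a ∈ paths S′ × a ∉ paths S

    -- A red clique outside all balloons becomes a balloon with the one-vertex path `x₀` and enters
    -- at index 0. If there are now `suc R` balloons, two of them can be merged.
    module Insert (R m : ℕ) (X : List V) {r} (S : System r) (G : Graded R m X S) (x₀ : V) (K₀ : List V)
      (uY : Unique (x₀ ∷ K₀)) (Y⊆ : x₀ ∷ K₀ ⊆ X ∖ (paths S ++ cores S)) (lenK : length K₀ ≡ freshSize d R m)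
      (clY : Clique (x₀ ∷ K₀)) where
      open Graded G

      Y⊆X : x₀ ∷ K₀ ⊆ X
      Y⊆X w = proj₁ (∈-∖⁻ X (paths S ++ cores S) (Y⊆ w))

      Y∉paths : ∀ {v} → v ∈ x₀ ∷ K₀ → v ∉ paths S
      Y∉paths w p = proj₂ (∈-∖⁻ X (paths S ++ cores S) (Y⊆ w)) (∈-++⁺ˡ p)

      Y∉core : ∀ i {v} → v ∈ x₀ ∷ K₀ → v ∉ K (b S i)
      Y∉core i w c = proj₂ (∈-∖⁻ X (paths S ++ cores S) (Y⊆ w)) (∈-++⁺ʳ (paths S) (∈-concatTabulate⁺ (K ∘ b S) i c))

      B : Balloon
      B = record { x = x₀ ; y = x₀ ; vs = [] ; K = K₀ ; path = []
                 ; clique = Clique-⊆ (λ { (here e) → here e ; (there w) → w }) clY ; uniqueK = proj₂ (Unique-∷⁻ uY) }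

      T : System (suc r)
      T = consSystem B S (Unique-∷⁺ (λ ()) []) (λ { (here refl , w) → Y∉paths (here refl) w })
            (λ i → λ { (v , w) → Y∉core i (there v) w })

      pathsT : ∀ {v} → v ∈ paths T → v ≡ x₀ ⊎ v ∈ paths S
      pathsT (here e) = inj₁ e
      pathsT (there w) = inj₂ w

      freeT : ∀ i → m + (suc R ∸ toℕ i) * cost ≤ length (free T i)
      freeT zero = ≤-trans (≤-reflexive (sym lenK)) (length-≤ {A = paths T} (proj₂ (Unique-∷⁻ uY)) λ w p → none w (pathsT p))
        where
        none : ∀ {v} → v ∈ K₀ → v ≡ x₀ ⊎ v ∈ paths S → Empty
        none w (inj₁ refl) = proj₁ (Unique-∷⁻ uY) w
        none w (inj₂ p) = Y∉paths (there w) p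
        length-≤ : ∀ {A K : List V} → Unique K → (∀ {v} → v ∈ K → v ∉ A) → length K ≤ length (K ∖ A)
        length-≤ u h = unique-⊆-length u (λ w → ∈-∖⁺ w (h w))
      -- The old balloons move up by one, and `suc R ∸ suc i` is the old `R ∸ i`, so their demand is
      -- unchanged.
      freeT (suc i) = ≤-trans (large i) (length-∖ {Z = []} (uniqueK (b S i))
        λ w p → [ (λ { refl → ⊥-elim (Y∉core i (here refl) w) }) , inj₂ ]′ (pathsT p))

      boundedT : ∀ i → length (K (b T i)) ≤ freshSize d R m
      boundedT zero = ≤-reflexive lenK
      boundedT (suc i) = bounded i

      coresT : ∀ i → K (b T i) ⊆ X
      coresT zero = Y⊆X ∘ there
      coresT (suc i) = cores⊆ i

      pathsT⊆ : paths T ⊆ X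
      pathsT⊆ p = [ (λ { refl → Y⊆X (here refl) }) , paths⊆ ]′ (pathsT p)

      extend : r < R → Progress R m X S
      extend r<R = suc r , T , record
        { r≤R = r<R
        ; large = λ i → ≤-trans (+-monoʳ-≤ m (*-monoˡ-≤ cost (∸-monoˡ-≤ (toℕ i) (n≤1+n R)))) (freeT i)
        ; bounded = boundedT ; paths⊆ = pathsT⊆ ; cores⊆ = coresT } ,
        there , x₀ , Y⊆X (here refl) , here refl , Y∉paths (here refl)

      afterMerge : ∀ q → MergeResult T q → Progress R m X S
      afterMerge q res = r , S′ , record
        { r≤R = r≤R ; large = large′
        ; bounded = λ i → subst (λ L → length L ≤ freshSize d R m) (sym (M.sameK i)) (boundedT (punchIn q i))
        ; paths⊆ = λ p → [ Z⊆X , pathsT⊆ ]′ (M.covers p)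
        ; cores⊆ = λ i → subst (λ L → L ⊆ X) (sym (M.sameK i)) (coresT (punchIn q i)) } ,
        M.old⊆ ∘ there , a , Z⊆X a∈Z , M.new⊆ a∈Z , a∉ ∘ there
        where
        open MergeResult res
        module M = _Merges[_,_]_ merges
        Z⊆X : Z ⊆ X
        Z⊆X v∈ = let i , _ , w = below v∈ in coresT i w
        large′ : ∀ i → m + (R ∸ toℕ i) * cost ≤ length (free S′ i)
        large′ i with toℕ-punchIn q i
        ... | inj₁ (i<q , eq) = +-cancelˡ-≤ cost _ _ (≤-trans (≤-reflexive shift)
               (≤-trans (freeT (punchIn q i)) (≤-trans (free-Merges merges i Z (λ _ w → w)) (≤-reflexive (cong (_+ length (free S′ i)) lenZ)))))
          where
          i≤R : toℕ i ≤ R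
          i≤R = ≤-trans (<⇒≤ (Fin.toℕ<n i)) r≤R
          shift : cost + (m + (R ∸ toℕ i) * cost) ≡ m + (suc R ∸ toℕ (punchIn q i)) * cost
          shift = begin
            cost + (m + (R ∸ toℕ i) * cost) ≡⟨ +-assoc cost m _ ⟨
            (cost + m) + (R ∸ toℕ i) * cost ≡⟨ cong (_+ (R ∸ toℕ i) * cost) (+-comm cost m) ⟩
            (m + cost) + (R ∸ toℕ i) * cost ≡⟨ +-assoc m cost _ ⟩
            m + suc (R ∸ toℕ i) * cost ≡⟨ cong (λ n → m + n * cost) (+-∸-assoc 1 i≤R) ⟨
            m + (suc R ∸ toℕ i) * cost ≡⟨ cong (λ n → m + (suc R ∸ n) * cost) eq ⟨
            m + (suc R ∸ toℕ (punchIn q i)) * cost ∎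
            where open ≡-Reasoning
        -- A balloon behind `q` moves down by one, so its demand stays the same. It loses nothing,
        -- since `Z` lies in the cores up to `q`.
        ... | inj₂ (q≤i , eq) = ≤-trans (≤-reflexive (cong (λ n → m + (suc R ∸ n) * cost) (sym eq)))
               (≤-trans (freeT (punchIn q i)) (free-Merges merges i [] none))
          where
          none : ∀ {v} → v ∈ K (b T (punchIn q i)) → v ∈ Z → v ∈ []
          none w z = let j , j≤q , c = below z in
            ⊥-elim (<⇒≱ (s≤s q≤i) (subst (_≤ toℕ q) (trans (cong toℕ (sym (disjK T w c))) eq) j≤q))

      insert′ : ∀ {v σ} → NoBlue v σ R → pairSize d v σ R + cost ≤ m → Progress R m X S
      insert′ {v} {σ} noBlue big with m≤n⇒m<n∨m≡n r≤R
      ... | inj₁ r<R = extend r<R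
      ... | inj₂ refl = afterMerge _ (mergePair T id (λ _ → refl)
              (twoEdges noBlue (free T) (free-Unique T) (free-disjoint T) (λ i → ≤-trans (m≤m+n _ cost) (big′ i)))
              (λ i → ≤-trans (m≤n+m cost (pairSize d v σ R)) (big′ i)))
        where
        big′ : ∀ i → pairSize d v σ R + cost ≤ length (free T i)
        big′ i = ≤-trans big (≤-trans (m≤m+n m _) (freeT i))

    -- Red cliques are inserted until too few vertices are uncovered to guarantee another one. `X`
    -- is a parameter because the covering is applied to all vertices and then to what this leaves
    -- over.
    phase1 : (∀ l → Dec (Red l)) → ∀ {v σ R} → NoBlue v σ R → NoBlueClique v → ∀ m → pairSize d v σ R + cost ≤ m →
             ∀ X → Unique X → ∃₂ λ r (S : System r) → Graded R m X S ×
               length (X ∖ (paths S ++ cores S)) < redCliqueBound d v (suc (freshSize d R m))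
    phase1 Red? {v} {σ} {R} noBlue noBlueClique m big X uX = go (length X) emptySystem emptyGraded (length-filter (λ u → ¬? (u ∈? [])) X)
      where
      emptySystem : System 0
      emptySystem = record { b = λ () ; uniqP = λ () ; disjP = λ { {()} } ; disjK = λ { {()} } }
      emptyGraded : Graded R m X emptySystem
      emptyGraded = record { r≤R = z≤n ; large = λ () ; bounded = λ () ; paths⊆ = λ () ; cores⊆ = λ () }
      bound = redCliqueBound d v (suc (freshSize d R m))
      Goal = ∃₂ λ r (S : System r) → Graded R m X S × length (X ∖ (paths S ++ cores S)) < bound
      step′ : ∀ {r} (S : System r) → Graded R m X S → bound ≤ length (X ∖ (paths S ++ cores S)) → Progress R m X S
      step′ S G le with redClique Red? noBlueClique (suc (freshSize d R m)) _ (∖-Unique (paths S ++ cores S) uX) le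
      ... | x₀ ∷ K₀ , uY , Y⊆ , lenY , clY = Insert.insert′ R m X S G x₀ K₀ uY Y⊆ (suc-injective lenY) clY noBlue big
      mutual
        go : ∀ n {r} (S : System r) → Graded R m X S → length (X ∖ paths S) ≤ n → Goal
        go n S G le with length (X ∖ (paths S ++ cores S)) <? bound
        ... | yes small = _ , S , G , small
        ... | no ¬small = next n S G (step′ S G (≮⇒≥ ¬small)) le
        next : ∀ n {r} (S : System r) → Graded R m X S → Progress R m X S → length (X ∖ paths S) ≤ n → Goal
        next zero S G (_ , S′ , _ , sub , a , a∈X , a∈ , a∉) le = ⊥-elim (<⇒≱ (∖-< uX sub a∈X a∈ a∉) (≤-trans le z≤n))
        next (suc n) S G (_ , S′ , G′ , sub , a , a∈X , a∈ , a∉) le = go n S′ G′ (≤-pred (≤-trans (∖-< uX sub a∈X a∈ a∉) le))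

    -- Merging small balloons into the long ones

    Apart : List V → ∀ {r} → System r → Set
    Apart U S = ∀ {v} → v ∈ U → v ∉ paths S × (∀ i → v ∉ K (b S i))

    -- The small balloons `A` get the lower indices: the next one to be merged away is always at
    -- index 0, and the long ones remain the last `R`.
    module Join {s R : ℕ} (A : System s) (S : System R) (U : List V) (pathsA : paths A ⊆ U)
                (coresA : ∀ i → K (b A i) ⊆ U) (apart : Apart U S) where

      pick′ : Fin s ⊎ Fin R → Balloon
      pick′ = [ b A , b S ]′

      splitAt-injective : ∀ {i j : Fin (s + R)} → splitAt s i ≡ splitAt s j → i ≡ j
      splitAt-injective {i} {j} eq = trans (sym (Fin.join-splitAt s R i)) (trans (cong (Fin.join s R) eq) (Fin.join-splitAt s R j))

      uniq : ∀ t → Unique (verts (pick′ t))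
      uniq (inj₁ i) = uniqP A i
      uniq (inj₂ i) = uniqP S i

      disP : ∀ t t′ {v} → v ∈ verts (pick′ t) → v ∈ verts (pick′ t′) → t ≡ t′
      disP (inj₁ i) (inj₁ j) v w = cong inj₁ (disjP A v w)
      disP (inj₁ i) (inj₂ j) v w = ⊥-elim (proj₁ (apart (pathsA (paths⁺ A i v))) (paths⁺ S j w))
      disP (inj₂ i) (inj₁ j) v w = ⊥-elim (proj₁ (apart (pathsA (paths⁺ A j w))) (paths⁺ S i v))
      disP (inj₂ i) (inj₂ j) v w = cong inj₂ (disjP S v w)

      disK : ∀ t t′ {v} → v ∈ K (pick′ t) → v ∈ K (pick′ t′) → t ≡ t′
      disK (inj₁ i) (inj₁ j) v w = cong inj₁ (disjK A v w)
      disK (inj₁ i) (inj₂ j) v w = ⊥-elim (proj₂ (apart (coresA i v)) j w)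
      disK (inj₂ i) (inj₁ j) v w = ⊥-elim (proj₂ (apart (coresA j w)) i v)
      disK (inj₂ i) (inj₂ j) v w = cong inj₂ (disjK S v w)

      joined : System (s + R)
      joined = record
        { b = pick′ ∘ splitAt s
        ; uniqP = λ i → uniq (splitAt s i)
        ; disjP = λ {i} {j} v w → splitAt-injective (disP (splitAt s i) (splitAt s j) v w)
        ; disjK = λ {i} {j} v w → splitAt-injective (disK (splitAt s i) (splitAt s j) v w) }

      b-right : ∀ i → b joined (s ↑ʳ i) ≡ b S i
      b-right i = cong pick′ (Fin.splitAt-↑ʳ s R i)

      b-left : ∀ i → b joined (i ↑ˡ R) ≡ b A i
      b-left i = cong pick′ (Fin.splitAt-↑ˡ s i R)

      paths-joined⁻ : ∀ {v} → v ∈ paths joined → v ∈ paths A ⊎ v ∈ paths S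
      paths-joined⁻ v∈ with paths⁻ joined v∈
      ... | i , w = go (splitAt s i) w
        where
        go : ∀ t {v} → v ∈ verts (pick′ t) → v ∈ paths A ⊎ v ∈ paths S
        go (inj₁ j) w = inj₁ (paths⁺ A j w)
        go (inj₂ j) w = inj₂ (paths⁺ S j w)

      pathsA⊆joined : paths A ⊆ paths joined
      pathsA⊆joined v∈ with paths⁻ A v∈
      ... | i , w = paths⁺ joined (i ↑ˡ R) (subst (λ B → _ ∈ verts B) (sym (b-left i)) w)

      pathsS⊆joined : paths S ⊆ paths joined
      pathsS⊆joined v∈ with paths⁻ S v∈
      ... | i , w = paths⁺ joined (s ↑ʳ i) (subst (λ B → _ ∈ verts B) (sym (b-right i)) w)

      free-right : ∀ i → length (free S i) ≤ length (free joined (s ↑ʳ i))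
      free-right i = subst (λ B → length (free S i) ≤ length (K B ∖ paths joined)) (sym (b-right i))
        (length-∖ {Z = []} (uniqueK (b S i)) λ w p →
          [ (λ p → ⊥-elim (proj₂ (apart (pathsA p)) i w)) , inj₂ ]′ (paths-joined⁻ p))

      free-left : ∀ i → length (free A i) ≤ length (free joined (i ↑ˡ R))
      free-left i = subst (λ B → length (free A i) ≤ length (K B ∖ paths joined)) (sym (b-left i))
        (length-∖ {Z = []} (uniqueK (b A i)) λ w p →
          [ inj₂ , (λ p → ⊥-elim (proj₁ (apart (coresA i w)) p)) ]′ (paths-joined⁻ p))

      free-all : ∀ m → (∀ i → m ≤ length (free A i)) → (∀ i → m ≤ length (free S i)) →
                 ∀ i → m ≤ length (free joined i)
      free-all m hA hS i = subst (λ j → m ≤ length (free joined j)) (Fin.join-splitAt s R i) (go (splitAt s i))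
        where
        go : ∀ t → m ≤ length (free joined (Fin.join s R t))
        go (inj₁ j) = ≤-trans (hA j) (free-left j)
        go (inj₂ j) = ≤-trans (hS j) (free-right j)

    -- With size q < h + h, any two of the paths linked together suffice.
    Long : ℕ → ∀ {r} → System r → ∀ {R} → (Fin R → Fin r) → Set
    Long h S ι = ∀ i → h ≤ length (verts (b S (ι i)))

    -- The 2k - 1 vertices of two edges with exactly one common vertex, the longest ear in use.
    earLength : ℕ
    earLength = 3 + (d + d)

    k≤earLength : k ≤ earLength
    k≤earLength = s≤s (s≤s (m≤n⇒m≤1+n (m≤m+n d d)))

    earFits : d + (d + earLength) ≤ cost
    earFits = +-monoʳ-≤ d (+-monoʳ-≤ d (≤-trans (≤-trans (n≤1+n earLength)
      (≤-reflexive (cong (2 +_) (trans (cong suc (sym (+-suc d d))) (sym (+-suc d (suc d))))))) (m≤n+m (k + k) d)))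

    linkEar : ∀ {r} (S : System r) q {h i j c es c′} → size q < h + h → h ≤ length (verts (b S i)) →
              h ≤ length (verts (b S j)) → i ≢ j → RPath c es c′ → c ∈ K (b S i) → c′ ∈ K (b S j) →
              Fresh (c ∷ es) (paths S) → length (c ∷ es) ≤ earLength →
              cost ≤ length (free S i) → cost ≤ length (free S j) → Win q
    linkEar S q {h} {i} {j} lt hi hj i≢j p c∈K c′∈K fr len bi bj =
      link S i≢j q p c∈K c′∈K fr
        (≤-trans (≤-trans (+-monoʳ-≤ d (≤-trans len (m≤n+m _ d))) earFits) bi)
        (≤-trans (≤-trans (+-monoʳ-≤ d (+-monoʳ-≤ d len)) earFits) bj)
        (≤-pred (≤-trans lt (≤-trans (+-mono-≤ hi hj) (≤-reflexive (+-suc (length (verts (b S i))) (length (vs (b S j))))))))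

    fresh-edge : ∀ {A e c es} → IsEdge e → Disjoint e A → c ∷ es ↭ e → Fresh (c ∷ es) A × length (c ∷ es) ≤ earLength
    fresh-edge E dis π = (Unique-resp-↭ (↭-sym π) (proj₁ (proj₂ E)) , λ { (v , w) → dis (∈-resp π v , w) }) ,
      ≤-trans (≤-reflexive (trans (Perm.↭-length π) (proj₁ E))) k≤earLength

    linkLong : ∀ {r} (S : System r) q {h i j e c c′} → size q < h + h → h ≤ length (verts (b S i)) →
               h ≤ length (verts (b S j)) → i ≢ j → IsEdge e → Disjoint e (paths S) →
               c ∈ e → c ∈ K (b S i) → c′ ∈ e → c′ ∈ K (b S j) →
               cost ≤ length (free S i) → cost ≤ length (free S j) → Win q
    linkLong S q lt hi hj i≢j E dis c∈e c∈K c′∈e c′∈K bi bj =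
      case edgeBetween E c∈e c′∈e (λ { refl → i≢j (disjK S c∈K c′∈K) }) of λ { (es , p , π) →
        case fresh-edge E dis π of λ { (fr , len) → linkEar S q lt hi hj i≢j p c∈K c′∈K fr len bi bj }}

    smallSize : ℕ → ℕ → ℕ → ℕ
    smallSize v σ R = pairSize d v σ R + cost

    -- Only cores of long balloons count, because the core of a small balloon is given up when it is
    -- merged. The vertices of small cores are therefore put into `D` in advance.
    Cover : ∀ {r} → System r → ∀ {R} → (Fin R → Fin r) → List V → Set
    Cover S ι D = ∀ v → v ∈ paths S ⊎ (∃ λ i → v ∈ K (b S (ι i))) ⊎ v ∈ D

    -- The parts are the free cores of the first small balloon and of the `R` long ones. If two
    -- parallel edges join two long balloons, one of these edges links long paths and wins;
    -- otherwise they start at part zero and merge the small balloon into a long one.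
    module MergeSmall {v σ R : ℕ} (noBlue : NoBlue v σ R) (q base h : ℕ) (D : List V) (lt : size q < h + h) where

      Target : Set
      Target = ∃ λ (S : System R) → (∀ i → base ≤ length (free S i)) × Long h S id × Cover S id D

      module Step {s} (S : System (suc s + R)) (every : ∀ i → smallSize v σ R + suc s * cost ≤ length (free S i))
                  (big : ∀ i → base + suc s * cost ≤ length (free S (suc s ↑ʳ i)))
                  (long : Long h S (suc s ↑ʳ_)) (cover : Cover S (suc s ↑ʳ_) D) where

        ι : Fin (suc R) → Fin (suc s + R)
        ι zero = zero
        ι (suc i) = suc (s ↑ʳ i)

        ι-injective : ∀ {i j} → ι i ≡ ι j → i ≡ j
        ι-injective {zero} {zero} _ = refl
        ι-injective {suc i} {suc j} eq = cong suc (Fin.↑ʳ-injective s i j (Fin.suc-injective eq))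

        C : Fin (suc R) → List V
        C i = free S (ι i)

        costly : ∀ i → cost ≤ length (free S i)
        costly i = ≤-trans (m≤n+m cost (pairSize d v σ R)) (≤-trans (m≤m+n (smallSize v σ R) (suc s * cost)) (every i))

        pair : Pair C
        pair = twoEdges noBlue C (free-Unique S ∘ ι) (λ a c → ι-injective (free-disjoint S a c))
          (λ i → ≤-trans (≤-trans (m≤m+n (pairSize d v σ R) cost) (m≤m+n (smallSize v σ R) (suc s * cost))) (every (ι i)))

        Next : Set
        Next = ∃ λ (S′ : System (s + R)) → (∀ i → smallSize v σ R + s * cost ≤ length (free S′ i)) ×
          (∀ i → base + s * cost ≤ length (free S′ (s ↑ʳ i))) × Long h S′ (s ↑ʳ_) × Cover S′ (s ↑ʳ_) D

        off : ∀ (L : Labelled C) → Disjoint (Labelled.e L) (paths S)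
        off L (v , w) = let i , _ , c = Labelled.below L v in free∉ S (ι i) c w

        loss : ∀ m₀ {S′ Z} → S Merges[ zero , Z ] S′ → length Z ≡ cost → ∀ j →
               m₀ + suc s * cost ≤ length (free S (suc j)) → m₀ + s * cost ≤ length (free S′ j)
        loss m₀ {S′} {Z} m len j le = +-cancelˡ-≤ cost _ _ (≤-trans (≤-reflexive shift)
          (≤-trans le (≤-trans (free-Merges m j Z (λ _ w → w)) (≤-reflexive (cong (_+ length (free S′ j)) len)))))
          where
          shift : cost + (m₀ + s * cost) ≡ m₀ + suc s * cost
          shift = trans (sym (+-assoc cost m₀ _)) (trans (cong (_+ s * cost) (+-comm cost m₀)) (+-assoc m₀ cost _))

        afterMerge : ∀ {S′ Z} → S Merges[ zero , Z ] S′ → length Z ≡ cost → Next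
        afterMerge {S′} m len = S′ ,
          (λ j → loss (smallSize v σ R) m len j (every (suc j))) ,
          (λ j → loss base m len (s ↑ʳ j) (big j)) ,
          (λ j → ≤-trans (long j) (_Merges[_,_]_.longer m (s ↑ʳ j))) ,
          (λ x → [ (λ w → inj₁ (_Merges[_,_]_.old⊆ m w)) ,
            [ (λ { (j , w) → inj₂ (inj₁ (j , subst (x ∈_) (sym (_Merges[_,_]_.sameK m (s ↑ʳ j))) w)) }) , (λ w → inj₂ (inj₂ w)) ]′ ]′ (cover x))

        mergeFirst : ∀ i {e₁ e₂ a₁ b₁ a₂ b₂} → IsEdge e₁ → IsEdge e₂ → Disjoint e₁ e₂ →
                     Disjoint e₁ (paths S) → Disjoint e₂ (paths S) →
                     a₁ ∈ e₁ → a₁ ∈ C (suc i) → b₁ ∈ e₁ → b₁ ∈ C zero →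
                     a₂ ∈ e₂ → a₂ ∈ C (suc i) → b₂ ∈ e₂ → b₂ ∈ C zero → Next
        mergeFirst i {e₁} {e₂} E₁ E₂ dis off₁ off₂ a₁∈ a₁C b₁∈ b₁C a₂∈ a₂C b₂∈ b₂C =
          case merge S zero (s ↑ʳ i) E₁ E₂ fresh a₁∈ (free⊆ S (ι (suc i)) a₁C) b₁∈ (free⊆ S zero b₁C)
                 a₂∈ (free⊆ S (ι (suc i)) a₂C) b₂∈ (free⊆ S zero b₂C) (costly (ι (suc i))) (costly zero) of λ
            { (S′ , Z , m , len , _) → afterMerge m len }
          where
          fresh : Fresh (e₁ ++ e₂) (paths S)
          fresh = Uniq.++⁺ (proj₁ (proj₂ E₁)) (proj₁ (proj₂ E₂)) dis ,
            λ { (v , w) → [ (λ v → off₁ (v , w)) , (λ v → off₂ (v , w)) ]′ (∈-++⁻ e₁ v) }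

        open Pair pair
        module L₁ = Labelled L₁
        module L₂ = Labelled L₂

        inC : ∀ {x i j} → i ≡ j → x ∈ C i → x ∈ C j
        inC refl w = w

        decide : ∀ p q′ → L₁.p ≡ p → L₁.q ≡ q′ → Win q ⊎ Next
        decide p zero _ eq = ⊥-elim (n≮0 (subst (λ j → toℕ L₁.p < toℕ j) eq L₁.p<q))
        decide zero (suc i) pe qe = inj₂ (mergeFirst i L₁.isEdge L₂.isEdge disjoint (off L₁) (off L₂)
          L₁.w∈ (inC qe L₁.w∈C) L₁.u∈ (inC pe L₁.u∈C)
          L₂.w∈ (inC (trans (sym same-q) qe) L₂.w∈C) L₂.u∈ (inC (trans (sym same-p) pe) L₂.u∈C))
        decide (suc j) (suc i) pe qe = inj₁ (linkLong S q {i = ι (suc j)} {j = ι (suc i)} lt (long j) (long i) j≢i L₁.isEdge (off L₁)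
          L₁.u∈ (free⊆ S (ι (suc j)) (inC pe L₁.u∈C)) L₁.w∈ (free⊆ S (ι (suc i)) (inC qe L₁.w∈C))
          (costly (ι (suc j))) (costly (ι (suc i))))
          where
          j≢i : ι (suc j) ≢ ι (suc i)
          j≢i eq = <⇒≢ L₁.p<q (cong toℕ (trans pe (trans (ι-injective {suc j} {suc i} eq) (sym qe))))

        next : Win q ⊎ Next
        next = decide L₁.p L₁.q refl refl

      mergeAll : ∀ s (S : System (s + R)) → (∀ i → smallSize v σ R + s * cost ≤ length (free S i)) →
                 (∀ i → base + s * cost ≤ length (free S (s ↑ʳ i))) →
                 Long h S (s ↑ʳ_) → Cover S (s ↑ʳ_) D → Win q ⊎ Target
      mergeAll zero S every big long cover =
        inj₂ (S , (λ i → ≤-trans (≤-reflexive (sym (+-identityʳ base))) (big i)) , long , cover)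
      mergeAll (suc s) S every big long cover =
        [ inj₁ , (λ { (S′ , every′ , big′ , long′ , cover′) → mergeAll s S′ every′ big′ long′ cover′ }) ]′
          (Step.next S every big long cover)

    -- Ears through uncovered vertices

    uncovered : ∀ {R} → System R → List V
    uncovered S = allFin N ∖ (paths S ++ cores S)

    uncovered-Unique : ∀ {R} (S : System R) → Unique (uncovered S)
    uncovered-Unique S = ∖-Unique (paths S ++ cores S) (Uniq.allFin⁺ N)

    uncovered∉paths : ∀ {R} (S : System R) {v} → v ∈ uncovered S → v ∉ paths S
    uncovered∉paths S w p = proj₂ (∈-∖⁻ (allFin N) (paths S ++ cores S) w) (∈-++⁺ˡ p)

    uncovered∉core : ∀ {R} (S : System R) i {v} → v ∈ uncovered S → v ∉ K (b S i)
    uncovered∉core S i w c = proj₂ (∈-∖⁻ (allFin N) (paths S ++ cores S) w)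
      (∈-++⁺ʳ (paths S) (∈-concatTabulate⁺ (K ∘ b S) i c))

    uncovered⁺ : ∀ {R} (S : System R) {v} → v ∉ paths S → (∀ i → v ∉ K (b S i)) → v ∈ uncovered S
    uncovered⁺ S {v} np nc = ∈-∖⁺ (∈-allFin v) λ w →
      [ np , (λ c → let i , z = ∈-concatTabulate⁻ (K ∘ b S) c in nc i z) ]′ (∈-++⁻ (paths S) w)

    record Shrinks {R} (S : System R) : Set where
      field
        {S′}    : System R
        {Z}     : List V
        up      : S ⇑[ Z ] S′
        lenZ    : length Z ≤ cost
        fewer   : length (uncovered S′) < length (uncovered S)

    -- Two vertices of the core are required for two reasons: a conflict over one of them can be
    -- avoided, and a set that is no candidate can be made harmless by deleting at most one vertex
    -- from each core.
    Candidate : ∀ {R} → System R → List V → Set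
    Candidate S f = ∃ λ i → End (free S i) f

    record Cherry (S : List V) (F : List V → Set) : Set where
      field
        {f g f′ g′} : List V
        {z}     : V
        Ff      : F f
        Fg      : F g
        f⊆      : f ⊆ S
        g⊆      : g ⊆ S
        uf      : Unique f
        ug      : Unique g
        f↭      : f ↭ z ∷ f′
        g↭      : g ↭ z ∷ g′
        meet    : Disjoint f′ g′

    IndependentSet : ℕ → List V → (List V → Set) → Set
    IndependentSet σ W F = ∃ λ S₀ → σ ≤ length S₀ × Unique S₀ × S₀ ⊆ W ×
      (∀ {f} → length f ≡ suc d → Unique f → f ⊆ S₀ → ¬ F f)

    -- The maximality of `τ`, turned around and transferred to sets of vertices of the coloured
    -- graph: a set larger than `τ` must violate one of the two conditions on the hypergraph.
    TauBound : ℕ → ℕ → Set₁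
    TauBound σ τ = ∀ W → Unique W → τ < length W → (F : List V → Set) → (∀ f → Dec (F f)) →
      (∀ {f} → F f → length f ≡ suc d) →
      (∀ {f g} → f ↭ g → F f → F g) → IndependentSet σ W F ⊎ Cherry W F

    module Outer (Red? : ∀ l → Dec (Red l)) {v σ R : ℕ} (noBlue : NoBlue v σ R) (q h : ℕ) (lt : size q < h + h)
                 (S : System R) (large : ∀ i → v + 2 ^ σ + cost + 2 * suc d ≤ length (free S i)) (long : Long h S id) where

      W : List V
      W = uncovered S

      costly : ∀ i → cost ≤ length (free S i)
      costly i = ≤-trans (≤-trans (m≤n+m cost (v + 2 ^ σ)) (m≤m+n _ (2 * suc d))) (large i)

      -- An ear between different cores links two long paths. An ear that returns to its own core is
      -- absorbed, and this covers `a`.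
      useEar : ∀ {i j c es c′ a} → RPath c es c′ → c ∈ K (b S i) → c′ ∈ K (b S j) → Fresh (c ∷ es) (paths S) →
               length (c ∷ es) ≤ earLength → a ∈ c ∷ es → a ∈ W → Win q ⊎ Shrinks S
      useEar {i} {j} {c} {es} {c′} {a} p c∈ c′∈ fr len a∈ a∈W = decide (i Fin.≟ j)
        where
        decide : Dec (i ≡ j) → Win q ⊎ Shrinks S
        decide (no i≢j) = inj₁ (linkEar S q lt (long i) (long j) i≢j p c∈ c′∈ fr len (costly i) (costly j))
        decide (yes refl) =
          case pick d (c ∷ es) (uniqueK (b S i)) fr (≤-trans (≤-trans (+-monoʳ-≤ d (≤-trans len (m≤n+m _ d))) earFits) (costly i)) of λ
            { (t , lt′ , t⊆ , fr′) → case absorb S i p c∈ c′∈ lt′ t⊆ fr′ of λ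
            { (S′ , up) → inj₂ (record { up = up ; lenZ = lenZ t lt′
                ; fewer = fewer up (new⊆ up (∈-++⁺ʳ t a∈)) }) }}
          where
          lenZ : ∀ t → length t ≡ d → length (t ++ c ∷ es) ≤ cost
          lenZ t lt′ = ≤-trans (≤-reflexive (length-++ t)) (≤-trans (+-mono-≤ (≤-reflexive lt′) (≤-trans len (m≤n+m _ d))) earFits)
          fewer : ∀ {S′ Z} → S ⇑[ Z ] S′ → a ∈ paths S′ → length (uncovered S′) < length W
          fewer {S′} up a∈′ = ∖-< (Uniq.allFin⁺ N) sub (∈-allFin a) (∈-++⁺ˡ a∈′)
              (proj₂ (∈-∖⁻ (allFin N) (paths S ++ cores S) a∈W))
            where
            sub : paths S ++ cores S ⊆ paths S′ ++ cores S′
            sub w = [ (λ w → ∈-++⁺ˡ (old⊆ up w)) ,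
              (λ w → let l , z = ∈-concatTabulate⁻ (K ∘ b S) w in
                 ∈-++⁺ʳ (paths S′) (∈-concatTabulate⁺ (K ∘ b S′) l (subst (_ ∈_) (sym (sameK up l)) z))) ]′ (∈-++⁻ (paths S) w)

      useEdge : ∀ {i j e c c′ a} → IsEdge e → Disjoint e (paths S) → c ≢ c′ → c ∈ e → c ∈ K (b S i) →
                c′ ∈ e → c′ ∈ K (b S j) → a ∈ e → a ∈ W → Win q ⊎ Shrinks S
      useEdge E dis c≢c′ c∈ cK c′∈ c′K a∈ a∈W =
        case edgeBetween E c∈ c′∈ c≢c′ of λ { (es , p , π) → case fresh-edge E dis π of λ { (fr , len) →
          useEar p cK c′K fr len (∈-resp (↭-sym π) a∈) a∈W }}

      -- The edges `a ∷ f` and `y ∷ g` have only `z` in common and form an ear through it, provided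
      -- that `a` and `y` differ; if the first vertex offered for `g` is `a`, the second is taken.
      useCherry : Cherry W (Candidate S) → Win q ⊎ Shrinks S
      useCherry record { f = f ; g = g ; f′ = f′ ; g′ = g′ ; z = z ; Ff = i , a , _ , _ , a∈ , _ , lf , ra , _
                       ; Fg = j , c , c₂ , c≢c₂ , c∈ , c₂∈ , lg , rc , rc₂
                       ; f⊆ = f⊆ ; g⊆ = g⊆ ; uf = uf ; ug = ug ; f↭ = f↭ ; g↭ = g↭ ; meet = meet } = choose (c Fin.≟ a)
        where
        with-y : ∀ y → y ≢ a → y ∈ free S j → Red (y ∷ g) → Win q ⊎ Shrinks S
        with-y y y≢a y∈ ry = case cherryPath lf lg f↭ g↭ ra ry of λ { (es , p , π) →
            useEar p (free⊆ S i a∈) (free⊆ S j y∈) (fresh π) (len π)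
              (∈-resp (↭-sym π) (there (there (here refl)))) (f⊆ (∈-resp (↭-sym f↭) (here refl))) }
          where
          all′ = a ∷ y ∷ z ∷ f′ ++ g′
          uf′ = Unique-∷⁻ (Unique-resp-↭ f↭ uf)
          ug′ = Unique-∷⁻ (Unique-resp-↭ g↭ ug)
          inW : z ∷ f′ ++ g′ ⊆ W
          inW (here refl) = f⊆ (∈-resp (↭-sym f↭) (here refl))
          inW (there w) = [ (λ w → f⊆ (∈-resp (↭-sym f↭) (there w))) , (λ w → g⊆ (∈-resp (↭-sym g↭) (there w))) ]′ (∈-++⁻ f′ w)
          core∉ : ∀ {l u} → u ∈ free S l → u ∉ z ∷ f′ ++ g′
          core∉ {l} u∈ w = uncovered∉core S l (inW w) (free⊆ S l u∈)
          uAll : Unique all′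
          uAll = Unique-∷⁺ (λ { (here e) → y≢a (sym e) ; (there w) → core∉ {i} a∈ w })
            (Unique-∷⁺ (core∉ {j} y∈)
            (Unique-∷⁺ (λ w → [ proj₁ uf′ , proj₁ ug′ ]′ (∈-++⁻ f′ w)) (Uniq.++⁺ (proj₂ uf′) (proj₂ ug′) meet)))
          off : ∀ {u} → u ∈ all′ → u ∉ paths S
          off (here refl) = free∉ S i a∈
          off (there (here refl)) = free∉ S j y∈
          off (there (there w)) = uncovered∉paths S (inW w)
          fresh : ∀ {es} → a ∷ es ↭ all′ → Fresh (a ∷ es) (paths S)
          fresh π = Unique-resp-↭ (↭-sym π) uAll , λ { (u , w) → off (∈-resp π u) w }
          len : ∀ {es} → a ∷ es ↭ all′ → length (a ∷ es) ≤ earLength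
          len π = ≤-reflexive (trans (Perm.↭-length π) (cong (3 +_) (trans (length-++ f′) (cong₂ _+_
            (suc-injective (trans (sym (Perm.↭-length f↭)) lf)) (suc-injective (trans (sym (Perm.↭-length g↭)) lg))))))
        choose : Dec (c ≡ a) → Win q ⊎ Shrinks S
        choose (no c≢a) = with-y c c≢a c∈ rc
        choose (yes refl) = with-y c₂ (c≢c₂ ∘ sym) c₂∈ rc₂

      attached : List V → V → Set
      attached f x = length f ≡ suc d × Red (x ∷ f)

      attached? : ∀ f x → Dec (attached f x)
      attached? f x = (length f ℕ.≟ suc d) ×-dec Red? (x ∷ f)

      prune : List (List V) → List V → List V
      prune [] X = X
      prune (f ∷ fs) X = filter (¬? ∘ attached? f) (prune fs X)

      prune-⊆ : ∀ fs X → prune fs X ⊆ X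
      prune-⊆ [] X w = w
      prune-⊆ (f ∷ fs) X w = prune-⊆ fs X (proj₁ (∈-filter⁻ (¬? ∘ attached? f) {xs = prune fs X} w))

      prune-Unique : ∀ fs {X} → Unique X → Unique (prune fs X)
      prune-Unique [] u = u
      prune-Unique (f ∷ fs) u = Uniq.filter⁺ (¬? ∘ attached? f) (prune-Unique fs u)

      prune-¬ : ∀ fs X {f x} → f ∈ fs → x ∈ prune fs X → ¬ attached f x
      prune-¬ (f ∷ fs) X (here refl) w = proj₂ (∈-filter⁻ (¬? ∘ attached? f) {xs = prune fs X} w)
      prune-¬ (f ∷ fs) X (there f∈) w = prune-¬ fs X f∈ (proj₁ (∈-filter⁻ (¬? ∘ attached? f) {xs = prune fs X} w))

      length-prune : ∀ fs {X} → Unique X → (∀ {f} → f ∈ fs → ∀ {x y} → x ∈ X → y ∈ X → attached f x → attached f y → x ≡ y) →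
                     length X ≤ length fs + length (prune fs X)
      length-prune [] u one = ≤-refl
      length-prune (f ∷ fs) {X} u one = ≤-trans (length-prune fs u (one ∘ there))
        (≤-trans (+-monoʳ-≤ (length fs) (length-filter-¬ (attached? f) (prune-Unique fs u)
          (λ x∈ y∈ → one (here refl) (prune-⊆ fs X x∈) (prune-⊆ fs X y∈)))) (≤-reflexive (+-suc _ _)))

      -- A set without candidates is blue to the cores after deleting few core vertices, unless an ear arises.
      module Independent (S₀ : List V) (lenS : length S₀ ≡ σ) (uS : Unique S₀) (S⊆ : S₀ ⊆ W)
                         (ind : ∀ {f} → length f ≡ suc d → Unique f → f ⊆ S₀ → ¬ Candidate S f) where

        one : ∀ i {f} → f ∈ sublists S₀ → ∀ {x y} → x ∈ free S i → y ∈ free S i → attached f x → attached f y → x ≡ y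
        one i {f} f∈ {x} {y} x∈ y∈ (lf , rx) (_ , ry) with x Fin.≟ y
        ... | yes e = e
        ... | no x≢y = ⊥-elim (ind lf (Unique-⊑ (∈-sublists⁻ S₀ f∈) uS) (⊑⇒⊆ (∈-sublists⁻ S₀ f∈))
                         (i , x , y , x≢y , x∈ , y∈ , lf , rx , ry))

        C : Fin (suc R) → List V
        C zero = S₀
        -- No sublist of `S₀` is a candidate, so each is attached to at most one free vertex of this
        -- core: at most `2 ^ σ` vertices are deleted.
        C (suc i) = prune (sublists S₀) (free S i)

        C⊆free : ∀ i → C (suc i) ⊆ free S i
        C⊆free i = prune-⊆ (sublists S₀) (free S i)

        uC : ∀ i → Unique (C i)
        uC zero = uS
        uC (suc i) = prune-Unique (sublists S₀) (free-Unique S i)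

        disC : ∀ {i j x} → x ∈ C i → x ∈ C j → i ≡ j
        disC {zero} {zero} _ _ = refl
        disC {zero} {suc j} a c = ⊥-elim (uncovered∉core S j (S⊆ a) (free⊆ S j (C⊆free j c)))
        disC {suc i} {zero} a c = ⊥-elim (uncovered∉core S i (S⊆ c) (free⊆ S i (C⊆free i a)))
        disC {suc i} {suc j} a c = cong suc (free-disjoint S (C⊆free i a) (C⊆free j c))

        bigC : ∀ i → v ≤ length (C (suc i))
        bigC i = +-cancelʳ-≤ (2 ^ σ) v _ (≤-trans (≤-trans (≤-trans (m≤m+n _ cost) (m≤m+n _ (2 * suc d))) (large i))
          (≤-trans (length-prune (sublists S₀) (free-Unique S i) (one i))
            (≤-reflexive (trans (cong (_+ length (C (suc i))) (trans (length-sublists S₀) (cong (2 ^_) lenS))) (+-comm (2 ^ σ) _)))))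

        crossing : Crossing C
        crossing = noBlue C uC disC (≤-reflexive (sym lenS)) bigC

        open Crossing crossing

        off : Disjoint e (paths S)
        off (x∈ , p) with covered x∈
        ... | zero , c = uncovered∉paths S (S⊆ c) p
        ... | suc l , c = free∉ S l (C⊆free l c) p

        coreVertex : ∀ {x} → x ∈ e → x ∉ S₀ → ∃ λ l → x ∈ K (b S l)
        coreVertex x∈ x∉ with covered x∈
        ... | zero , c = ⊥-elim (x∉ c)
        ... | suc l , c = l , free⊆ S l (C⊆free l c)

        -- If the rest of the edge lay in `S₀`, then `x` would have been pruned. So the edge has a
        -- second core vertex `y`, and from `x` to `y` it is an ear through `s`.
        mixed : ∀ {s x l} → s ∈ e → s ∈ S₀ → x ∈ e → x ∈ C (suc l) → Win q ⊎ Shrinks S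
        mixed {s} {x} {l} s∈ s∈S x∈ x∈C = go (∈⇒↭ x∈)
          where
          go : (∃ λ f → e ↭ x ∷ f) → Win q ⊎ Shrinks S
          go (f , π) = decide (All.all? (_∈? S₀) f)
            where
            uxf = Unique-∷⁻ (Unique-resp-↭ π (proj₁ (proj₂ isEdge)))
            decide : Dec (All (_∈ S₀) f) → Win q ⊎ Shrinks S
            decide (no ¬all) = case find (¬All⇒Any¬ (_∈? S₀) f ¬all) of λ { (y , y∈ , y∉S) →
                case coreVertex (∈-resp (↭-sym π) (there y∈)) y∉S of λ { (l′ , yK) →
                  useEdge isEdge off (λ { refl → proj₁ uxf y∈ }) x∈ (free⊆ S l (C⊆free l x∈C))
                    (∈-resp (↭-sym π) (there y∈)) yK s∈ (S⊆ s∈S) }}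
            -- Pruning ran through the sublists of `S₀`, so `f` is first brought into the order of
            -- `S₀`.
            decide (yes all) = ⊥-elim (prune-¬ (sublists S₀) (free S l) (∈-sublists⁺ (Sub.filter-⊆ (_∈? f) S₀)) x∈C
                (trans (sym (Perm.↭-length ρ)) (suc-injective (trans (sym (Perm.↭-length π)) (proj₁ isEdge))) ,
                 Red-↭ (↭-trans π (prep x ρ)) (proj₂ (proj₂ isEdge))))
              where
              ρ : f ↭ filter (_∈? f) S₀
              ρ = unique-⊆-↭ (proj₂ uxf) (Uniq.filter⁺ (_∈? f) uS)
                (λ w → ∈-filter⁺ (_∈? f) (All.lookup all w) w) (λ w → proj₂ (∈-filter⁻ (_∈? f) {xs = S₀} w))

        result : Win q ⊎ Shrinks S
        result = decide i j refl refl
          where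
          inC : ∀ {x l l′} → l ≡ l′ → x ∈ C l → x ∈ C l′
          inC refl w = w
          decide : ∀ i′ j′ → i ≡ i′ → j ≡ j′ → Win q ⊎ Shrinks S
          decide zero zero ei ej = ⊥-elim (i≢j (trans ei (sym ej)))
          decide zero (suc l) ei ej = mixed u∈ (inC ei u∈C) w∈ (inC ej w∈C)
          decide (suc l) zero ei ej = mixed w∈ (inC ej w∈C) u∈ (inC ei u∈C)
          decide (suc l) (suc l′) ei ej = inj₁ (linkLong S q (lt) (long l) (long l′)
            (λ { refl → i≢j (trans ei (sym ej)) }) isEdge off
            u∈ (free⊆ S l (C⊆free l (inC ei u∈C))) w∈ (free⊆ S l′ (C⊆free l′ (inC ej w∈C))) (costly l) (costly l′))

      End? : ∀ F f → Dec (End F f)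
      End? F f = Fin.any? λ a → Fin.any? λ c → ¬? (a Fin.≟ c) ×-dec (a ∈? F) ×-dec (c ∈? F) ×-dec
        (length f ℕ.≟ suc d) ×-dec Red? (a ∷ f) ×-dec Red? (c ∷ f)

      Candidate? : ∀ f → Dec (Candidate S f)
      Candidate? f = Fin.any? λ i → End? (free S i) f

      candidateIn : ∀ S₀ → length S₀ ≡ σ → Unique S₀ → S₀ ⊆ W →
                    (Win q ⊎ Shrinks S) ⊎ ∃ λ f → Unique f × f ⊆ S₀ × Candidate S f
      candidateIn S₀ lenS uS S⊆ = decide (anyList? (suc d) λ f → unique? f ×-dec All.all? (_∈? S₀) f ×-dec Candidate? f)
        where
        open DecUniq (Fin._≟_ {N}) using (unique?)
        decide : Dec (∃ λ f → length f ≡ suc d × Unique f × All (_∈ S₀) f × Candidate S f) →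
                 (Win q ⊎ Shrinks S) ⊎ ∃ λ f → Unique f × f ⊆ S₀ × Candidate S f
        decide (yes (f , _ , uf , all , c)) = inj₂ (f , uf , All.lookup all , c)
        decide (no none) = inj₁ (Independent.result S₀ lenS uS S⊆
          (λ lf uf sub c → none (_ , lf , uf , All.tabulate sub , c)))

      tooMany : ∀ {τ} → TauBound σ τ → τ < length W → Win q ⊎ Shrinks S
      tooMany tau big = decide (tau W (uncovered-Unique S) big (Candidate S) Candidate? (λ { (i , _ , _ , _ , _ , _ , lf , _) → lf })
          (λ { π (i , a , c , ne , a∈ , c∈ , lf , ra , rc) →
             i , a , c , ne , a∈ , c∈ , trans (sym (Perm.↭-length π)) lf , Red-↭ (prep a π) ra , Red-↭ (prep c π) rc }))
        where
        decide : IndependentSet σ W (Candidate S) ⊎ Cherry W (Candidate S) → Win q ⊎ Shrinks S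
        decide (inj₂ ch) = useCherry ch
        decide (inj₁ (S₀ , len , u , sub , ind)) =
          Independent.result (take σ S₀) (length-take σ S₀ len) (Uniq.take⁺ σ u) (sub ∘ take-⊆ σ S₀)
            (λ lf uf f⊆ → ind lf uf (take-⊆ σ S₀ ∘ f⊆))

    -- Counting vertices and filling the ends of the paths

    coverBound : ∀ {r} (S : System r) (E : Fin r → List V) X Y →
                 (∀ v → v ∈ X → v ∈ paths S ⊎ (∃ λ i → v ∈ K (b S i)) ⊎ (∃ λ i → v ∈ E i) ⊎ v ∈ Y) → Unique X →
                 length X ≤ length (concat (tabulate (λ i → verts (b S i) ++ free S i ++ E i))) + length Y
    coverBound S E X Y h u = ≤-trans (unique-⊆-length u (λ {v} w → classify v (v ∈? paths S) (h v w))) (≤-reflexive (length-++ (concat (tabulate part))))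
      where
      part = λ i → verts (b S i) ++ free S i ++ E i
      inPaths : ∀ {v} → v ∈ paths S → v ∈ concat (tabulate part) ++ Y
      inPaths p = let i , w = paths⁻ S p in ∈-++⁺ˡ (∈-concatTabulate⁺ part i (∈-++⁺ˡ w))
      classify : ∀ v → Dec (v ∈ paths S) → v ∈ paths S ⊎ (∃ λ i → v ∈ K (b S i)) ⊎ (∃ λ i → v ∈ E i) ⊎ v ∈ Y →
                 v ∈ concat (tabulate part) ++ Y
      classify v _ (inj₁ p) = inPaths p
      classify v (yes p) _ = inPaths p
      classify v (no p∉) (inj₂ (inj₁ (i , w))) =
        ∈-++⁺ˡ (∈-concatTabulate⁺ part i (∈-++⁺ʳ (verts (b S i)) (∈-++⁺ˡ (∈-∖⁺ w p∉))))
      classify v _ (inj₂ (inj₂ (inj₁ (i , w)))) =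
        ∈-++⁺ˡ (∈-concatTabulate⁺ part i (∈-++⁺ʳ (verts (b S i)) (∈-++⁺ʳ (free S i) w)))
      classify v _ (inj₂ (inj₂ (inj₂ w))) = ∈-++⁺ʳ (concat (tabulate part)) w

    -- `finish` leaves out at most `d` vertices, which costs no edge. So `suc (size q)` vertices in
    -- the balloon and its end sets are already enough to win.
    balloonWin : ∀ q {r} (S : System r) i {l r′} → 2 * suc d ≤ length (free S i) →
      l ≡ [] ⊎ End (free S i) l → r′ ≡ [] ⊎ End (free S i) r′ → Unique (l ++ r′) →
      l ++ r′ ⊆ uncovered S → Win q ⊎ length (verts (b S i) ++ free S i ++ l ++ r′) ≤ size q
    balloonWin q S i {l} {r′} big okl okr u sub = decide (size q ≤? _)
      where
      B = b S i
      F = free S i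
      decide : Dec (size q ≤ length (vs B) + (length F + (length l + length r′))) →
               Win q ⊎ length (verts B ++ F ++ l ++ r′) ≤ size q
      decide (yes h) = inj₁ (finish q (path B) (Clique-⊆ (λ { (here e) → here e ; (there (here e)) → there (here e)
                                                          ; (there (there w)) → there (there (free⊆ S i w)) }) (clique B))
        (Uniq.++⁺ (uniqP S i) (Uniq.++⁺ (free-Unique S i) u (λ { (a , c) → uncovered∉core S i (sub c) (free⊆ S i a) }))
          (λ { (a , c) → [ (λ c → free∉ S i c (paths⁺ S i a)) , (λ c → uncovered∉paths S (sub c) (paths⁺ S i a)) ]′ (∈-++⁻ F c) }))
        big okl okr h)
      decide (no h) = inj₂ (≤-trans (s≤s (≤-reflexive (trans (length-++ (vs B)) (cong (length (vs B) +_)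
        (trans (length-++ F) (cong (length F +_) (length-++ l))))))) (≰⇒> h))

    -- `M` stands for the maximum in the theorem. Its bound `σ≤M` provides a candidate among the
    -- remaining vertices, and `τ<M` an end at which to put it.
    module Assign (Red? : ∀ l → Dec (Red l)) {v σ R τ : ℕ} (noBlue : NoBlue v σ R) (q h : ℕ) (lt : size q < h + h)
      (M : ℕ) (σ≤M : σ ≤ M) (τ<M : τ < M + 2 * suc d) (N≥ : R * size q + M ≤ N)
      (S : System R) (large : ∀ i → v + 2 ^ σ + cost + 2 * suc d ≤ length (free S i)) (long : Long h S id) where

      open Outer Red? noBlue q h lt S large long

      record Assignment : Set where
        field
          ends : Fin R → List V × List V
        E : Fin R → List V
        E i = proj₁ (ends i) ++ proj₂ (ends i)
        field
          okL  : ∀ i → proj₁ (ends i) ≡ [] ⊎ End (free S i) (proj₁ (ends i))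
          okR  : ∀ i → proj₂ (ends i) ≡ [] ⊎ End (free S i) (proj₂ (ends i))
          inW  : ∀ i → E i ⊆ W
          uniqE : ∀ i → Unique (E i)
          disE : ∀ {i j x} → x ∈ E i → x ∈ E j → i ≡ j
        used rest : List V
        used = concat (tabulate E)
        rest = W ∖ used

      module Add (𝓔 : Assignment) (i : Fin R) (f : List V) (uf : Unique f) (f⊆ : f ⊆ Assignment.rest 𝓔) (lf : length f ≡ suc d) where
        open Assignment 𝓔

        f∉ : ∀ {x} j → x ∈ f → x ∉ E j
        f∉ j w e = proj₂ (∈-∖⁻ W used (f⊆ w)) (∈-concatTabulate⁺ E j e)

        add : ∀ l′ r′ → l′ ≡ [] ⊎ End (free S i) l′ → r′ ≡ [] ⊎ End (free S i) r′ → l′ ++ r′ ↭ f ++ E i →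
              ∃ λ 𝓔′ → length (Assignment.rest 𝓔′) < length rest
        add l′ r′ okl okr π = 𝓔′ , fewer (f≢[] lf)
          where
          ends′ = set ends i (l′ , r′)
          E′ = λ j → proj₁ (ends′ j) ++ proj₂ (ends′ j)
          old : ∀ {x} → x ∈ l′ ++ r′ → x ∈ f ⊎ x ∈ E i
          old w = ∈-++⁻ f (∈-resp π w)
          okL′ : ∀ j → proj₁ (ends′ j) ≡ [] ⊎ End (free S j) (proj₁ (ends′ j))
          okL′ j with j Fin.≟ i
          ... | yes refl = okl
          ... | no _ = okL j
          okR′ : ∀ j → proj₂ (ends′ j) ≡ [] ⊎ End (free S j) (proj₂ (ends′ j))
          okR′ j with j Fin.≟ i
          ... | yes refl = okr
          ... | no _ = okR j
          inW′ : ∀ j → E′ j ⊆ W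
          inW′ j w with j Fin.≟ i
          ... | yes refl = [ (λ a → proj₁ (∈-∖⁻ W used (f⊆ a))) , inW i ]′ (old w)
          ... | no _ = inW j w
          uniqE′ : ∀ j → Unique (E′ j)
          uniqE′ j with j Fin.≟ i
          ... | yes refl = Unique-resp-↭ (↭-sym π) (Uniq.++⁺ uf (uniqE i) (λ { (a , c) → f∉ i a c }))
          ... | no _ = uniqE j
          disE′ : ∀ {j j′ x} → x ∈ E′ j → x ∈ E′ j′ → j ≡ j′
          disE′ {j} {j′} a c with j Fin.≟ i | j′ Fin.≟ i
          ... | yes refl | yes refl = refl
          ... | yes refl | no _ = [ (λ a → ⊥-elim (f∉ j′ a c)) , (λ a → disE a c) ]′ (old a)
          ... | no _ | yes refl = [ (λ c → ⊥-elim (f∉ j c a)) , (λ c → disE a c) ]′ (old c)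
          ... | no _ | no _ = disE a c
          𝓔′ : Assignment
          𝓔′ = record { ends = ends′ ; okL = okL′ ; okR = okR′ ; inW = inW′ ; uniqE = uniqE′ ; disE = λ {j} {j′} → disE′ {j} {j′} }
          E⊆ : ∀ j → E j ⊆ E′ j
          E⊆ j w with j Fin.≟ i
          ... | yes refl = ∈-resp (↭-sym π) (∈-++⁺ʳ f w)
          ... | no _ = w
          f⊆E′ : f ⊆ E′ i
          f⊆E′ w with i Fin.≟ i
          ... | yes _ = ∈-resp (↭-sym π) (∈-++⁺ˡ w)
          ... | no i≢i = ⊥-elim (i≢i refl)
          f≢[] : length f ≡ suc d → ∃ λ x → x ∈ f
          f≢[] = nonempty f
            where
            nonempty : ∀ g → length g ≡ suc d → ∃ λ x → x ∈ g
            nonempty (x ∷ _) _ = x , here refl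
          fewer : (∃ λ x → x ∈ f) → length (Assignment.rest 𝓔′) < length rest
          fewer (x , x∈) = ∖-< (uncovered-Unique S)
            (λ w → let j , e = ∈-concatTabulate⁻ E w in ∈-concatTabulate⁺ E′ j (E⊆ j e))
            (proj₁ (∈-∖⁻ W used (f⊆ x∈))) (∈-concatTabulate⁺ E′ i (f⊆E′ x∈)) (proj₂ (∈-∖⁻ W used (f⊆ x∈)))

      module Round (small : length W ≤ τ) (𝓔 : Assignment) where
        open Assignment 𝓔

        -- The `R` balloons with their ends occupy at most `R * size q` of the `N` vertices, which
        -- leaves `M` for `rest`.
        M≤rest : (∀ i → length (verts (b S i) ++ free S i ++ E i) ≤ size q) → M ≤ length rest
        M≤rest h = +-cancelˡ-≤ (R * size q) _ _ (≤-trans (≤-trans N≥ (≤-trans (≤-reflexive (sym (length-tabulate id)))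
          (coverBound S E (allFin N) rest (λ x _ → place x) (Uniq.allFin⁺ N)))) (+-monoˡ-≤ (length rest) (length-concatTabulate _ (size q) h)))
          where
          place : ∀ x → x ∈ paths S ⊎ (∃ λ i → x ∈ K (b S i)) ⊎ (∃ λ i → x ∈ E i) ⊎ x ∈ rest
          place x with x ∈? paths S | Fin.any? (λ i → x ∈? K (b S i)) | x ∈? used
          ... | yes p | _ | _ = inj₁ p
          ... | no _ | yes c | _ = inj₂ (inj₁ c)
          ... | no _ | no _ | yes u = inj₂ (inj₂ (inj₁ (∈-concatTabulate⁻ E u)))
          ... | no p | no c | no u = inj₂ (inj₂ (inj₂ (∈-∖⁺ (uncovered⁺ S p (λ i w → c (i , w))) u)))

        -- Two ends at balloon i leave room for τ vertices only.
        place : M ≤ length rest → ∀ {f} → Unique f → f ⊆ rest → Candidate S f → ∃ λ 𝓔′ → length (Assignment.rest 𝓔′) < length rest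
        place M≤ {f} uf f⊆ (i , e@(_ , _ , _ , _ , _ , lf , _)) = decide (okL i) (okR i)
          where
          open Add 𝓔 i f uf f⊆ lf
          l = proj₁ (ends i)
          r = proj₂ (ends i)
          lenEnd : ∀ {g} → End (free S i) g → length g ≡ suc d
          lenEnd (_ , _ , _ , _ , _ , lg , _) = lg
          decide : l ≡ [] ⊎ End (free S i) l → r ≡ [] ⊎ End (free S i) r → ∃ λ 𝓔′ → length (Assignment.rest 𝓔′) < length rest
          decide (inj₁ eq) _ = add f r (inj₂ e) (okR i) (↭-reflexive (cong (λ l → f ++ l ++ r) (sym eq)))
          decide (inj₂ _) (inj₁ eq) = add l f (okL i) (inj₂ e) (↭-trans (Perm.++-comm l f)
            (↭-reflexive (cong (f ++_) (trans (sym (++-identityʳ l)) (cong (l ++_) (sym eq))))))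
          decide (inj₂ el) (inj₂ er) = ⊥-elim (<⇒≱ τ<M (≤-trans (+-mono-≤ M≤ (≤-reflexive (sym lenE))) (≤-trans both small)))
            where
            lenE : length (E i) ≡ 2 * suc d
            lenE = trans (length-++ l) (cong₂ _+_ (lenEnd el) (trans (lenEnd er) (sym (+-identityʳ (suc d)))))
            both : length rest + length (E i) ≤ length W
            both = ≤-trans (≤-reflexive (sym (length-++ rest))) (unique-⊆-length
              (Uniq.++⁺ (∖-Unique used (uncovered-Unique S)) (uniqE i)
                (λ { (a , c) → proj₂ (∈-∖⁻ W used a) (∈-concatTabulate⁺ E i c) }))
              (λ w → [ (λ a → proj₁ (∈-∖⁻ W used a)) , inW i ]′ (∈-++⁻ rest w)))

        round : (Win q ⊎ Shrinks S) ⊎ ∃ λ 𝓔′ → length (Assignment.rest 𝓔′) < length rest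
        round with firstOrAll (λ i → balloonWin q S i (≤-trans (m≤n+m (2 * suc d) _) (large i)) (okL i) (okR i) (uniqE i) (inW i))
        ... | inj₁ win = inj₁ (inj₁ win)
        ... | inj₂ h = Sum.map₂ (λ { (f , uf , f⊆ , c) → place (M≤rest h) uf (take-⊆ σ rest ∘ f⊆) c })
              (candidateIn (take σ rest) (length-take σ rest (≤-trans σ≤M (M≤rest h)))
                (Uniq.take⁺ σ (∖-Unique used (uncovered-Unique S))) (λ w → proj₁ (∈-∖⁻ W used (take-⊆ σ rest w))))

      rounds : length W ≤ τ → ∀ n (𝓔 : Assignment) → length (Assignment.rest 𝓔) ≤ n → Win q ⊎ Shrinks S
      rounds small n 𝓔 le = continue n le (Round.round small 𝓔)
        where
        continue : ∀ n → length (Assignment.rest 𝓔) ≤ n →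
          (Win q ⊎ Shrinks S) ⊎ (∃ λ 𝓔′ → length (Assignment.rest 𝓔′) < length (Assignment.rest 𝓔)) → Win q ⊎ Shrinks S
        continue _ _ (inj₁ done) = done
        continue zero le (inj₂ (𝓔′ , lt)) = ⊥-elim (<⇒≱ lt (≤-trans le z≤n))
        continue (suc n) le (inj₂ (𝓔′ , lt)) = rounds small n 𝓔′ (≤-pred (≤-trans lt le))

      shrinkOrWin : TauBound σ τ → Win q ⊎ Shrinks S
      shrinkOrWin tau with length W ≤? τ
      ... | no big = tooMany tau (≰⇒> big)
      ... | yes small = rounds small _ noEnds ≤-refl
        where
        noEnds : Assignment
        noEnds = record { ends = λ _ → [] , [] ; okL = λ _ → inj₁ refl ; okR = λ _ → inj₁ refl
                        ; inW = λ _ () ; uniqE = λ _ → [] ; disE = λ () }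

    -- Two coverings and the absorption of what they leave

    module Main (Red? : ∀ l → Dec (Red l)) {v σ R τ : ℕ} (noBlue : NoBlue v σ R) (noBlueClique : NoBlueClique v)
      (tau : TauBound σ τ) (q M : ℕ) (σ≤M : σ ≤ M) (τ<M : τ < M + 2 * suc d) (N≥ : R * size q + M ≤ N)
      (long-q : threshold d v σ R + threshold d v σ R < size q) where

      base m₀ m₁ m₂ s₁ s₂ w h : ℕ
      base = reserve d v σ R
      m₀ = reserve d v σ R + leftover d v σ R * mergeCost d + R * mergeCost d
      m₁ = smallClique d v σ R
      m₂ = bigClique d v σ R
      s₁ = freshSize d R m₁
      s₂ = freshSize d R m₂
      w = leftover d v σ R
      h = size q ∸ threshold d v σ R

      T≤q : threshold d v σ R ≤ size q
      T≤q = ≤-trans (m≤m+n _ (threshold d v σ R)) (<⇒≤ long-q)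

      -- By `long-q` the threshold is less than half of `size q`, so `h` is more than half of it.
      lt : size q < h + h
      lt = +-cancelʳ-< T (size q) (h + h) (begin-strict
        size q + T ≡⟨ cong (_+ T) (m∸n+n≡m T≤q) ⟨
        h + T + T ≡⟨ +-assoc h T T ⟩
        h + (T + T) <⟨ +-monoʳ-< h long-q ⟩
        h + size q ≡⟨ cong (h +_) (m∸n+n≡m T≤q) ⟨
        h + (h + T) ≡⟨ +-assoc h h T ⟨
        h + h + T ∎)
        where
        T = threshold d v σ R
        open ≤-Reasoning

      -- `n` is fuel and budget at once: a round covers at least one more vertex and takes at most
      -- `cost` free vertices from each core.
      loop : ∀ n (S : System R) → (∀ i → base + n * cost ≤ length (free S i)) → Long h S id →
             length (uncovered S) ≤ n → Win q
      loop n S large long le = go n large le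
          (Assign.shrinkOrWin Red? noBlue q h lt M σ≤M τ<M N≥ S (λ i → ≤-trans (m≤m+n base (n * cost)) (large i)) long tau)
        where
        go : ∀ n → (∀ i → base + n * cost ≤ length (free S i)) → length (uncovered S) ≤ n → Win q ⊎ Shrinks S → Win q
        go _ _ _ (inj₁ win) = win
        go zero _ le (inj₂ s) = ⊥-elim (<⇒≱ (Shrinks.fewer s) (≤-trans le z≤n))
        go (suc n) large le (inj₂ s) = loop n S′
            (λ i → +-cancelˡ-≤ cost _ _ (≤-trans (≤-reflexive shift) (≤-trans (large i)
              (≤-trans (free-⇑ up i) (+-monoˡ-≤ _ lenZ)))))
            (λ i → ≤-trans (long i) (longer up i)) (≤-pred (≤-trans fewer le))
          where
          open Shrinks s
          shift : cost + (base + n * cost) ≡ base + suc n * cost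
          shift = trans (sym (+-assoc cost base _)) (trans (cong (_+ n * cost) (+-comm cost base)) (+-assoc base cost _))

      module Second (S : System R) (G : Graded R m₂ (allFin N) S) (long : Long h S id) where
        U = uncovered S

        apart : Apart U S
        apart x∈ = uncovered∉paths S x∈ , λ i → uncovered∉core S i x∈

        large : ∀ i → m₂ ≤ length (free S i)
        large i = ≤-trans (m≤m+n m₂ _) (Graded.large G i)

        module Small {s} (A : System s) (GA : Graded R m₁ U A)
          (few : length (U ∖ (paths A ++ cores A)) < redCliqueBound d v (suc s₁)) where

          open Join A S U (Graded.paths⊆ GA) (Graded.cores⊆ GA) apart

          D : List V
          D = (U ∖ (paths A ++ cores A)) ++ cores A

          lenD : length D ≤ w
          lenD = ≤-trans (≤-reflexive (length-++ (U ∖ (paths A ++ cores A)))) (+-mono-≤ (<⇒≤ few)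
            (≤-trans (length-concatTabulate (K ∘ b A) s₁ (Graded.bounded GA)) (*-monoˡ-≤ s₁ (Graded.r≤R GA))))

          cover : Cover joined (s ↑ʳ_) D
          cover x with x ∈? paths S | Fin.any? (λ i → x ∈? K (b S i)) | x ∈? paths A | x ∈? cores A
          ... | yes p | _ | _ | _ = inj₁ (pathsS⊆joined p)
          ... | no _ | yes (i , c) | _ | _ = inj₂ (inj₁ (i , subst (λ B → x ∈ K B) (sym (b-right i)) c))
          ... | no _ | no _ | yes p | _ = inj₁ (pathsA⊆joined p)
          ... | no _ | no _ | no _ | yes c = inj₂ (inj₂ (∈-++⁺ʳ _ c))
          ... | no p | no c | no p′ | no c′ = inj₂ (inj₂ (∈-++⁺ˡ (∈-∖⁺ (uncovered⁺ S p (λ i z → c (i , z)))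
                  (λ z → [ p′ , c′ ]′ (∈-++⁻ (paths A) z)))))

          s*cost≤ : s * cost ≤ R * cost
          s*cost≤ = *-monoˡ-≤ cost (Graded.r≤R GA)

          every : ∀ i → smallSize v σ R + s * cost ≤ length (free joined i)
          every = free-all _
            (λ i → ≤-trans (+-monoʳ-≤ (smallSize v σ R) s*cost≤) (≤-trans (m≤m+n m₁ _) (Graded.large GA i)))
            (λ i → ≤-trans (+-monoʳ-≤ (smallSize v σ R) s*cost≤) (≤-trans (m≤n+m m₁ m₀) (large i)))

          big : ∀ i → (base + w * cost) + s * cost ≤ length (free joined (s ↑ʳ i))
          big i = ≤-trans (+-monoʳ-≤ (base + w * cost) s*cost≤) (≤-trans (m≤m+n _ m₁) (≤-trans (large i) (free-right i)))

          longJ : Long h joined (s ↑ʳ_)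
          longJ i = subst (λ B → h ≤ length (verts B)) (sym (b-right i)) (long i)

          win : Win q
          win = [ id , (λ { (S′ , large′ , long′ , cover′) → loop w S′ large′ long′
                  (≤-trans (unique-⊆-length (uncovered-Unique S′) (sub S′ cover′)) lenD) }) ]′
                (MergeSmall.mergeAll noBlue q (base + w * cost) h D lt s joined every big longJ cover)
            where
            sub : ∀ S′ → Cover S′ id D → uncovered S′ ⊆ D
            sub S′ cover′ {x} x∈ = [ (λ p → ⊥-elim (uncovered∉paths S′ x∈ p)) ,
              [ (λ { (i , c) → ⊥-elim (uncovered∉core S′ i x∈ c) }) , id ]′ ]′ (cover′ x)

        win : Win q
        win = case phase1 Red? noBlue noBlueClique m₁ (m≤m+n _ (R * mergeCost d)) U (uncovered-Unique S) of λ
          { (s , A , GA , few) → Small.win A GA few }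

      module First {r} (S : System r) (G : Graded R m₂ (allFin N) S)
                   (few : length (uncovered S) < redCliqueBound d v (suc s₂)) where

        balloons : Win q ⊎ (∀ i → length (verts (b S i) ++ free S i ++ []) ≤ size q)
        balloons = firstOrAll λ i → balloonWin q S i {[]} {[]}
          (≤-trans (m≤n+m (2 * suc d) (v + 2 ^ σ + mergeCost d)) (≤-trans (≤-trans (≤-trans (m≤m+n _ _) (m≤m+n _ _)) (m≤m+n _ m₁))
            (≤-trans (m≤m+n m₂ _) (Graded.large G i)))) (inj₁ refl) (inj₁ refl) [] (λ ())

        parts : Fin r → List V
        parts i = verts (b S i) ++ free S i ++ []

        N≤ : N ≤ length (concat (tabulate parts)) + length (uncovered S)
        N≤ = ≤-trans (≤-reflexive (sym (length-tabulate id))) (coverBound S (λ _ → []) (allFin N) (uncovered S) (λ x _ → place x) (Uniq.allFin⁺ N))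
          where
          place : ∀ x → x ∈ paths S ⊎ (∃ λ i → x ∈ K (b S i)) ⊎ (∃ λ i → x ∈ []) ⊎ x ∈ uncovered S
          place x with x ∈? paths S | Fin.any? (λ i → x ∈? K (b S i))
          ... | yes p | _ = inj₁ p
          ... | no _ | yes c = inj₂ (inj₁ c)
          ... | no p | no c = inj₂ (inj₂ (inj₂ (uncovered⁺ S p (λ i z → c (i , z)))))

        RL≤ : R * size q ≤ length (concat (tabulate parts)) + length (uncovered S)
        RL≤ = ≤-trans (≤-trans (m≤m+n _ M) N≥) N≤

        few′ : length (uncovered S) ≤ threshold d v σ R
        few′ = ≤-trans (<⇒≤ few) (m≤n+m _ s₂)

        -- With a balloon missing, `size q` vertices would have to be uncovered, more than the
        -- threshold allows.
        full : (∀ i → length (parts i) ≤ size q) → R ≤ r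
        full h with R ≤? r
        ... | yes le = le
        ... | no R≰r = ⊥-elim (<⇒≱ long-q (≤-trans (+-cancelˡ-≤ (r * size q) _ _ (begin
          r * size q + size q ≡⟨ +-comm (r * size q) (size q) ⟩
          suc r * size q ≤⟨ *-monoˡ-≤ (size q) (≰⇒> R≰r) ⟩
          R * size q ≤⟨ RL≤ ⟩
          length (concat (tabulate parts)) + length (uncovered S) ≤⟨ +-mono-≤ (length-concatTabulate parts (size q) h) few′ ⟩
          r * size q + threshold d v σ R ∎)) (m≤m+n _ (threshold d v σ R))))
          where open ≤-Reasoning

        -- The balloons almost fill `R * size q`, so each falls short of `size q` by no more than
        -- the number of uncovered vertices. Of its vertices at most `s₂` are free core vertices,
        -- and the others lie on the path.
        long : r ≡ R → (∀ i → length (parts i) ≤ size q) → ∀ i → h ≤ length (verts (b S i))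
        long refl hp i = m≤n+o⇒m∸o≤n (size q) (length (verts (b S i))) (+-cancelˡ-≤ (R * size q) _ _ (begin
          R * size q + size q ≤⟨ +-monoˡ-≤ (size q) RL≤ ⟩
          length (concat (tabulate parts)) + length (uncovered S) + size q
            ≡⟨ trans (+-assoc _ (length (uncovered S)) (size q)) (trans (cong (length (concat (tabulate parts)) +_) (+-comm (length (uncovered S)) (size q)))
                 (sym (+-assoc _ (size q) (length (uncovered S))))) ⟩
          length (concat (tabulate parts)) + size q + length (uncovered S)
            ≤⟨ +-mono-≤ (length-concatTabulate-at parts (size q) hp i) (<⇒≤ few) ⟩
          R * size q + length (parts i) + B₂ ≡⟨ +-assoc (R * size q) (length (parts i)) B₂ ⟩
          R * size q + (length (parts i) + B₂) ≤⟨ +-monoʳ-≤ (R * size q) (+-monoˡ-≤ B₂ lenPart) ⟩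
          R * size q + (length (verts (b S i)) + s₂ + B₂) ≡⟨ cong (R * size q +_) (+-assoc (length (verts (b S i))) s₂ B₂) ⟩
          R * size q + (length (verts (b S i)) + threshold d v σ R) ∎))
          where
          open ≤-Reasoning
          B₂ = redCliqueBound d v (suc s₂)
          m≤n+o⇒m∸o≤n : ∀ m n {o} → m ≤ n + o → m ∸ o ≤ n
          m≤n+o⇒m∸o≤n m n {o} le = ≤-trans (∸-monoˡ-≤ o le) (≤-reflexive (m+n∸n≡m n o))
          lenPart : length (parts i) ≤ length (verts (b S i)) + s₂
          lenPart = ≤-trans (≤-reflexive (length-++ (verts (b S i)))) (+-monoʳ-≤ (length (verts (b S i)))
            (≤-trans (≤-reflexive (cong length (++-identityʳ (free S i)))) (≤-trans (length-filter _ (K (b S i))) (Graded.bounded G i))))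

        win : Win q
        win = [ id , (λ hp → finally (≤-antisym (Graded.r≤R G) (full hp)) hp) ]′ balloons
          where
          finally : r ≡ R → (∀ i → length (parts i) ≤ size q) → Win q
          finally refl hp = Second.win S G (long refl hp)

      redPath : Win q
      redPath = case phase1 Red? noBlue noBlueClique m₂ (≤-trans (m≤m+n _ (R * mergeCost d)) (m≤n+m m₁ m₀)) (allFin N) (Uniq.allFin⁺ N) of λ
        { (r , S , G , few) → First.win S G few }

    -- Transferring τ to sets of vertices

    module _ (W : List (Fin N)) (uW : Unique W) (F : List (Fin N) → Set) (F? : ∀ f → Dec (F f))
             (F-length : ∀ {f} → F f → length f ≡ suc d) (F-↭ : ∀ {f g} → f ↭ g → F f → F g) where

      g : Fin (length W) → Fin N
      g = lookup W

      g-injective : Injective _≡_ _≡_ g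
      g-injective = lookup-injective uW _ _

      list : Subset (length W) → List (Fin N)
      list e = map g (elements e)

      list-Unique : ∀ e → Unique (list e)
      list-Unique e = Uniq.map⁺ g-injective (elements-Unique e)

      list⊆ : ∀ e → list e ⊆ W
      list⊆ e w = case ∈-map⁻ g w of λ { (i , _ , refl) → ∈-lookup i }

      length-list : ∀ e → length (list e) ≡ ∣ e ∣
      length-list e = trans (length-map g (elements e)) (length-elements e)

      hypergraph : Hypergraph (length W)
      hypergraph = record { Edge = F ∘ list ; edge? = F? ∘ list }

      edges-uniform : Uniform (suc d) hypergraph
      edges-uniform e Fe = trans (sym (length-list e)) (F-length Fe)

      toCherry : ∀ e f → F (list e) → F (list f) → ∣ e ∩ f ∣ ≡ 1 → Cherry W F
      toCherry e f Fe Ff one = single (elements (e ∩ f)) refl (trans (length-elements (e ∩ f)) one)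
        where
        single : ∀ zs → elements (e ∩ f) ≡ zs → length zs ≡ 1 → Cherry W F
        single (z ∷ []) eq _ = case ∈⇒↭ (∈-map⁺ g (∈-elements⁺ (proj₁ z∈))) of λ { (f′ , π) →
            case ∈⇒↭ (∈-map⁺ g (∈-elements⁺ (proj₂ z∈))) of λ { (g′ , ρ) → record
              { Ff = Fe ; Fg = Ff ; f⊆ = list⊆ e ; g⊆ = list⊆ f ; uf = list-Unique e ; ug = list-Unique f ; f↭ = π ; g↭ = ρ
              ; meet = λ { (a , c) → proj₁ (Unique-∷⁻ (Unique-resp-↭ π (list-Unique e)))
                  (subst (_∈ f′) (common (∈-resp (↭-sym π) (there a)) (∈-resp (↭-sym ρ) (there c))) a) } }}}
          where
          z∈ : z ∈ˢ e × z ∈ˢ f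
          z∈ = Subset.x∈p∩q⁻ e f (∈-elements⁻ (e ∩ f) (subst (z ∈_) (sym eq) (here refl)))
          common : ∀ {y} → y ∈ list e → y ∈ list f → y ≡ g z
          common a c = case ∈-map⁻ g a of λ { (i , i∈ , refl) → case ∈-map⁻ g c of λ { (j , j∈ , eq′) →
            case subst (i ∈_) eq (∈-elements⁺ (Subset.x∈p∩q⁺ (∈-elements⁻ e i∈ , ∈-elements⁻ f (subst (_∈ elements f) (sym (g-injective eq′)) j∈)))) of λ
              { (here refl) → refl } }}

      toIndependent : ∀ {σ} S → Independent hypergraph S → σ ≤ ∣ S ∣ → IndependentSet σ W F
      toIndependent S ind le = list S , ≤-trans le (≤-reflexive (sym (length-list S))) , list-Unique S , list⊆ S ,
        λ {f} lf uf f⊆ Ff → ind (preimage f) (F-↭ (list-preimage uf (list⊆ S ∘ f⊆)) Ff) (inS f⊆)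
        where
        preimage : List (Fin N) → Subset (length W)
        preimage f = satisfying (λ i → g i ∈? f)
        list-preimage : ∀ {f} → Unique f → f ⊆ W → f ↭ list (preimage f)
        list-preimage {f} uf f⊆W = unique-⊆-↭ uf (list-Unique (preimage f))
          (λ {y} w → case inImage (f⊆W w) of λ { (i , refl) → ∈-map⁺ g (∈-elements⁺ (∈-satisfying⁺ (λ i → g i ∈? f) w)) })
          (λ w → case ∈-map⁻ g w of λ { (i , i∈ , refl) → ∈-satisfying⁻ (λ i → g i ∈? f) (∈-elements⁻ (preimage f) i∈) })
          where
          inImage : ∀ {y xs} → y ∈ xs → ∃ λ i → lookup xs i ≡ y
          inImage (here refl) = zero , refl
          inImage (there w) = let i , eq = inImage w in suc i , eq
        inS : ∀ {f} → f ⊆ list S → preimage f ⊆ˢ S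
        inS {f} f⊆ {i} w = case ∈-map⁻ g (f⊆ (∈-satisfying⁻ (λ i → g i ∈? f) w)) of λ
          { (j , j∈ , eq) → subst (_∈ˢ S) (sym (g-injective eq)) (∈-elements⁻ S j∈) }

      independent? : ∀ S → Dec (Independent hypergraph S)
      independent? S = allSubset? λ e → F? (list e) →-dec ¬? (e Subset.⊆? S)

      independenceNumber : ∃ λ a → IsIndependenceNumber hypergraph a
      independenceNumber = greatest (λ a → Subset.anySubset? λ S → independent? S ×-dec (∣ S ∣ ℕ.≟ a)) (length W)
        (λ { a (S , _ , refl) → Subset.∣p∣≤n S }) {0}
        (∅ , (λ e Fe e⊆ → n≮0 (≤-trans (≤-reflexive (sym (edges-uniform e Fe))) (≤-trans (Subset.p⊆q⇒∣p∣≤∣q∣ e⊆) (≤-reflexive (Subset.∣⊥∣≡0 (length W)))))) ,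
         Subset.∣⊥∣≡0 (length W))

      -- If both alternatives failed, `F` read on the positions in `W` would be one of the
      -- hypergraphs over which `τ` is the maximum, although it has more than `τ` vertices.
      dichotomy : ∀ {σ τ} → IsTau (suc d) σ τ → τ < length W → IndependentSet σ W F ⊎ Cherry W F
      dichotomy {σ} {τ} (_ , maximal) big
        with Subset.anySubset? (λ e → Subset.anySubset? λ f → F? (list e) ×-dec F? (list f) ×-dec (∣ e ∩ f ∣ ℕ.≟ 1))
           | independenceNumber
      ... | yes (e , f , Fe , Ff , one) | _ = inj₂ (toCherry e f Fe Ff one)
      ... | no none | a , (S , ind , refl) , max with σ ≤? ∣ S ∣
      ... | yes le = inj₁ (toIndependent S ind le)
      ... | no ¬le = ⊥-elim (<⇒≱ big (maximal (length W)
              (hypergraph , edges-uniform , (∣ S ∣ , ((S , ind , refl) , max) , ≰⇒> ¬le) , λ e f Fe Ff _ one → none (e , f , Fe , Ff , one))))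

    tauBound : ∀ {σ τ} → IsTau (suc d) σ τ → TauBound σ τ
    tauBound tau W uW big F F? F-length F-↭ = dichotomy W uW F F? F-length F-↭ tau big

  -- From a colouring to red lists, and back to a copy of the path

  module Bridge {N v : ℕ} (d : ℕ) (H : Hypergraph v) (uniform : Uniform (2 + d) H) (c : Subset N → Colour) where

    k : ℕ
    k = 2 + d

    Red : List (Fin N) → Set
    Red l = c (fromList l) ≡ red

    Red? : ∀ l → Dec (Red l)
    Red? l = c (fromList l) ≟ᶜ red

    Red-↭ : ∀ {l l′} → l ↭ l′ → Red l → Red l′
    Red-↭ π r = trans (cong c (sym (fromList-↭ π))) r

    open RedPaths Red Red-↭ d hiding (k; g; g-injective)

    -- Consecutive edges share one vertex, so each edge starts `suc d` places after the one before
    -- it.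
    redBlock : ∀ {x vs y} → RPath x vs y → ∀ i → size (suc i) ≤ length vs → Red (take k (drop (size i) (x ∷ vs)))
    redBlock [] i ()
    redBlock (step {x} {t} {z} {vs} lt r p) zero _ = subst Red (sym (cong (x ∷_) (take-snoc t lt))) r
      where
      take-snoc : ∀ t {n} → length t ≡ n → take (suc n) (t ++ z ∷ vs) ≡ t ++ z ∷ []
      take-snoc [] refl = refl
      take-snoc (_ ∷ t) refl = cong (_ ∷_) (take-snoc t refl)
    redBlock (step {x} {t} {z} {vs} lt r p) (suc i) le =
      subst (Red ∘ take k) (sym (drop-prefix t lt)) (redBlock p i (+-cancelˡ-≤ (suc d) _ _ (≤-trans le (≤-reflexive len))))
      where
      drop-prefix : ∀ t {n m} → length t ≡ n → drop (n + m) (t ++ z ∷ vs) ≡ drop m (z ∷ vs)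
      drop-prefix [] refl = refl
      drop-prefix (_ ∷ t) refl = drop-prefix t refl
      len : length (t ++ z ∷ vs) ≡ suc d + length vs
      len = trans (length-++ t) (trans (+-suc (length t) _) (cong (λ n → suc n + length vs) lt))

    -- The path found may be longer than required; its first `n` vertices are used.
    containsPath : ∀ q → Win q → Contains (colourGraph k c red) (loosePath k (suc (size q)))
    containsPath q (x , vs , y , p , uL , long) = f , f-injective , edges
      where
      n = suc (size q)
      L = x ∷ vs
      n≤ : n ≤ length L
      n≤ = s≤s long
      f : Fin n → Fin N
      f i = lookup L (Fin.inject≤ i n≤)
      f-injective : Injective _≡_ _≡_ f
      f-injective {i} {j} eq = Fin.inject≤-injective n≤ n≤ i j (lookup-injective uL _ _ eq)
      edges : ∀ e → Edge (loosePath k n) e → Edge (colourGraph k c red) (image f e)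
      edges e (i , lt , refl) = trans (cong ∣_∣ img) (trans (∣fromList∣ uB) lenB) ,
                                trans (cong c img) (redBlock p (toℕ i) le)
        where
        m = size (toℕ i)
        B = take k (drop m L)
        le : size (suc (toℕ i)) ≤ length vs
        le = ≤-trans (≤-pred lt) long
        uB : Unique B
        uB = Uniq.take⁺ k (Uniq.drop⁺ m uL)
        lenB : length B ≡ k
        lenB = length-take k (drop m L) (≤-trans (≤-reflexive (sym (m+n∸n≡m k m))) (≤-trans
          (∸-monoˡ-≤ m (s≤s le)) (≤-reflexive (sym (List.length-drop m L)))))
        inBlock⁻ : ∀ {u} → u ∈ˢ block k n (toℕ i) → m ≤ toℕ u × toℕ u ≤ size (suc (toℕ i))
        inBlock⁻ {u} w = ∈-satisfying⁻ (λ u → (m ≤? toℕ u) ×-dec (toℕ u ≤? size (suc (toℕ i)))) w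
        inBlock⁺ : ∀ {u} → m ≤ toℕ u × toℕ u ≤ size (suc (toℕ i)) → u ∈ˢ block k n (toℕ i)
        inBlock⁺ {u} w = ∈-satisfying⁺ (λ u → (m ≤? toℕ u) ×-dec (toℕ u ≤? size (suc (toℕ i)))) w
        m+k : m + k ≡ suc (size (suc (toℕ i)))
        m+k = +-comm m k
        sub : map f (elements (block k n (toℕ i))) ⊆ B
        sub w = case ∈-map⁻ f w of λ { (u , u∈ , refl) → case inBlock⁻ (∈-elements⁻ _ u∈) of λ { (lo , hi) →
          ∈-slice⁺ L m k (Fin.inject≤ u n≤) (subst (m ≤_) (sym (Fin.toℕ-inject≤ u n≤)) lo)
            (subst₂ _<_ (sym (Fin.toℕ-inject≤ u n≤)) (sym m+k) (s≤s hi)) }}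
        sup : B ⊆ map f (elements (block k n (toℕ i)))
        sup w = case ∈-slice⁻ L m k w of λ { (u , lo , hi , refl) → preimage u lo (≤-pred (subst (toℕ u <_) m+k hi)) }
          where
          preimage : ∀ u → m ≤ toℕ u → toℕ u ≤ size (suc (toℕ i)) → lookup L u ∈ map f (elements (block k n (toℕ i)))
          preimage u lo hi = subst (_∈ map f (elements (block k n (toℕ i)))) (cong (lookup L) back)
              (∈-map⁺ f (∈-elements⁺ (inBlock⁺ (subst (m ≤_) (sym to) lo , subst (_≤ size (suc (toℕ i))) (sym to) hi))))
            where
            u<n : toℕ u < n
            u<n = ≤-trans (s≤s hi) lt
            u′ : Fin n
            u′ = fromℕ< u<n
            to : toℕ u′ ≡ toℕ u
            to = Fin.toℕ-fromℕ< u<n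
            back : Fin.inject≤ u′ n≤ ≡ u
            back = Fin.toℕ-injective (trans (Fin.toℕ-inject≤ u′ n≤) to)
        img : image f (block k n (toℕ i)) ≡ fromList B
        img = trans (image-elements f (block k n (toℕ i))) (fromList-↭
          (unique-⊆-↭ (Uniq.map⁺ f-injective (elements-Unique (block k n (toℕ i)))) uB sub sup))

    module NoBlueCopy (noCopy : ¬ Contains (colourGraph k c blue) H) where

      -- An injective image of `H` without a red edge would be a blue copy.
      redEdge : ∀ (f : Fin v → Fin N) → Injective _≡_ _≡_ f → ∃ λ e → Edge H e × IsEdge (map f (elements e))
      redEdge f inj with Subset.anySubset? (λ e → edge? H e ×-dec (c (image f e) ≟ᶜ red))
      ... | yes (e , He , r) = e , He , trans (length-map f (elements e)) (trans (length-elements e) (uniform e He)) ,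
              Uniq.map⁺ inj (elements-Unique e) , trans (cong c (sym (image-elements f e))) r
      ... | no none = ⊥-elim (noCopy (f , inj , λ e He → trans (∣image∣ inj e) (uniform e He) , isBlue (c (image f e)) refl He))
        where
        isBlue : ∀ {e} x → c (image f e) ≡ x → Edge H e → c (image f e) ≡ blue
        isBlue red eq He = ⊥-elim (none (_ , He , eq))
        isBlue blue eq He = eq

      noBlueClique : NoBlueClique v
      noBlueClique Y uY big with redEdge (λ u → lookup Y (Fin.inject≤ u big))
          (λ {x} {y} eq → Fin.inject≤-injective big big x y (lookup-injective uY _ _ eq))
      ... | e , _ , isE = _ , isE , λ w → case ∈-map⁻ _ w of λ { (u , _ , refl) → ∈-lookup (Fin.inject≤ u big) }

      module Colouring {R σ : ℕ} (f : Fin v → Fin (suc R)) (proper : Proper H f) (x : Fin (suc R))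
                       (size-x : ∣ colourClass f x ∣ ≡ σ) where

        class : List (Fin v)
        class = elements (colourClass f x)

        inClass : ∀ {u} → f u ≡ x → u ∈ class
        inClass eq = ∈-elements⁺ (∈-satisfying⁺ (λ u → f u Fin.≟ x) eq)

        -- Class x goes to part zero.
        place : ∀ u → Dec (x ≡ f u) → Fin (suc R) × ℕ
        place u (yes eq) = zero , toℕ (Any.index (inClass (sym eq)))
        place u (no x≢) = suc (punchOut x≢) , toℕ u

        index-injective : ∀ {u w : Fin v} {xs} (a : u ∈ xs) (b : w ∈ xs) → toℕ (Any.index a) ≡ toℕ (Any.index b) → u ≡ w
        index-injective (here refl) (here refl) _ = refl
        index-injective (there a) (there b) eq = index-injective a b (suc-injective eq)

        place-injective : ∀ {u w} D D′ → place u D ≡ place w D′ → u ≡ w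
        place-injective (yes _) (yes _) eq = index-injective (inClass _) (inClass _) (cong proj₂ eq)
        place-injective (no _) (no _) eq = Fin.toℕ-injective (cong proj₂ eq)
        place-injective (yes _) (no _) ()
        place-injective (no _) (yes _) ()

        place-colour : ∀ {u w} D D′ → proj₁ (place u D) ≡ proj₁ (place w D′) → f u ≡ f w
        place-colour (yes a) (yes b) _ = trans (sym a) b
        place-colour (no a) (no b) eq = Fin.punchOut-injective a b (Fin.suc-injective eq)

        index-< : ∀ {u : Fin v} {xs} (a : u ∈ xs) → toℕ (Any.index a) < length xs
        index-< a = Fin.toℕ<n (Any.index a)

        -- `H` is embedded with distinct colour classes in distinct parts. Outside class `x`, vertex
        -- `u` takes position `toℕ u` of its part, so `v` positions suffice. The image has a red
        -- edge; as `f` is proper, this edge comes from two classes and thus crosses.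
        noBlue : NoBlue v σ R
        noBlue C uC disC σ≤ v≤ = result (redEdge g g-injective)
          where
          spot : Fin v → Fin (suc R) × ℕ
          spot u = place u (x Fin.≟ f u)
          fits : ∀ u D → proj₂ (place u D) < length (C (proj₁ (place u D)))
          fits u (yes eq) = ≤-trans (index-< (inClass (sym eq))) (≤-trans (≤-reflexive (trans (length-elements (colourClass f x)) size-x)) σ≤)
          fits u (no x≢) = ≤-trans (Fin.toℕ<n u) (v≤ (punchOut x≢))
          g : Fin v → Fin N
          g u = lookup (C (proj₁ (spot u))) (fromℕ< (fits u (x Fin.≟ f u)))
          g∈ : ∀ u → g u ∈ C (proj₁ (spot u))
          g∈ u = ∈-lookup (fromℕ< (fits u (x Fin.≟ f u)))
          samePlace : ∀ {i j m n} (p : m < length (C i)) (q : n < length (C j)) → i ≡ j →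
                      lookup (C i) (fromℕ< p) ≡ lookup (C j) (fromℕ< q) → m ≡ n
          samePlace {i} p q refl eq = trans (sym (Fin.toℕ-fromℕ< p)) (trans (cong toℕ (lookup-injective (uC i) _ _ eq)) (Fin.toℕ-fromℕ< q))
          g-injective : Injective _≡_ _≡_ g
          g-injective {u} {w} eq = place-injective (x Fin.≟ f u) (x Fin.≟ f w) (cong₂ _,_ samePart
              (samePlace (fits u (x Fin.≟ f u)) (fits w (x Fin.≟ f w)) samePart eq))
            where
            samePart : proj₁ (spot u) ≡ proj₁ (spot w)
            samePart = disC (g∈ u) (subst (_∈ C (proj₁ (spot w))) (sym eq) (g∈ w))
          result : (∃ λ e → Edge H e × IsEdge (map g (elements e))) → Crossing C
          result (e , He , isE) with Fin.any? (λ u → Fin.any? λ w → (u Subset.∈? e) ×-dec (w Subset.∈? e) ×-dec ¬? (f u Fin.≟ f w))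
          ... | yes (u , w , u∈ , w∈ , ne) = record
                { isEdge = isE ; covered = λ z → case ∈-map⁻ g z of λ { (t , _ , refl) → _ , g∈ t }
                ; i≢j = λ eq → ne (place-colour (x Fin.≟ f u) (x Fin.≟ f w) eq)
                ; u∈ = ∈-map⁺ g (∈-elements⁺ u∈) ; w∈ = ∈-map⁺ g (∈-elements⁺ w∈) ; u∈C = g∈ u ; w∈C = g∈ w }
          ... | no none = ⊥-elim (proper e He λ u w u∈ w∈ → mono u w u∈ w∈ (f u Fin.≟ f w))
            where
            mono : ∀ u w → u ∈ˢ e → w ∈ˢ e → Dec (f u ≡ f w) → f u ≡ f w
            mono u w u∈ w∈ (yes eq) = eq
            mono u w u∈ w∈ (no ne) = ⊥-elim (none (u , w , u∈ , w∈ , ne))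

        redCopy : ∀ {τ} → TauBound σ τ → ∀ q M → σ ≤ M → τ < M + 2 * suc d → R * size q + M ≤ N →
                  threshold d v σ R + threshold d v σ R < size q →
                  Contains (colourGraph k c red) (loosePath k (suc (size q)))
        redCopy tau q M σ≤M τ<M N≥ long = containsPath q (Main.redPath Red? noBlue noBlueClique tau q M σ≤M τ<M N≥ long)

  -- The bound in natural numbers and in integers

  natBound : ∀ d {v} (H : Hypergraph v) → Uniform (2 + d) H → ∀ χ σ τ →
    IsChromaticNumber H χ → IsSigma H σ → IsTau (suc d) σ τ →
    ∃ λ R → χ ≡ suc R × ∃ λ n₀ → ∀ q → n₀ ≤ q * suc d →
      ∃ λ r → IsRamseyNumber (2 + d) (loosePath (2 + d) (suc (q * suc d))) H r ×
        r ≤ R * (q * suc d) + ((τ + 3 ∸ 2 * (2 + d)) ⊔ σ)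
  natBound d {v} H unif χ σ τ (_ , χ-least) (zero , _ , (_ , _ , () , _) , _) tau
  natBound d {v} H unif χ σ τ χ-number (suc R , number , (f , proper , x , size-x) , _) tau =
    -- `IsSigma` carries a chromatic number of its own, which equals `χ` by leastness on both sides.
    -- The value of `n₀` left open here is one more than twice the threshold, as `colouring`
    -- requires.
    R , ≤-antisym (proj₂ χ-number (suc R) (proj₁ number)) (proj₂ number χ (proj₁ χ-number)) , _ , λ q long →
      ramseyNumber-≤ (2 + d) (loosePath (2 + d) (suc (q * suc d))) H _ λ c → colouring q long c (contains? (colourGraph (2 + d) c blue) H)
    where
    M = (τ + 3 ∸ 2 * (2 + d)) ⊔ σ
    τ<M : τ < M + 2 * suc d
    -- The 2 is the difference between 2k and 2(k - 1); it turns τ + 1 into the τ + 3 of the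
    -- theorem.
    τ<M = +-cancelʳ-≤ 2 _ _ (begin
      suc τ + 2 ≡⟨ +-suc τ 2 ⟨
      τ + 3 ≤⟨ m≤n+m∸n (τ + 3) (2 * (2 + d)) ⟩
      2 * (2 + d) + (τ + 3 ∸ 2 * (2 + d)) ≡⟨ +-comm (2 * (2 + d)) _ ⟩
      (τ + 3 ∸ 2 * (2 + d)) + 2 * (2 + d) ≤⟨ +-monoˡ-≤ (2 * (2 + d)) (m≤m⊔n _ σ) ⟩
      M + 2 * (2 + d) ≡⟨ cong (M +_) (trans (*-suc 2 (suc d)) (+-comm 2 (2 * suc d))) ⟩
      M + (2 * suc d + 2) ≡⟨ +-assoc M (2 * suc d) 2 ⟨
      M + 2 * suc d + 2 ∎)
      where open ≤-Reasoning
    colouring : ∀ q → threshold d v σ R + threshold d v σ R < q * suc d → (c : Subset (R * (q * suc d) + M) → Colour) →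
      Dec (Contains (colourGraph (2 + d) c blue) H) →
      Contains (colourGraph (2 + d) c red) (loosePath (2 + d) (suc (q * suc d))) ⊎ Contains (colourGraph (2 + d) c blue) H
    colouring q long c (yes copy) = inj₂ copy
    colouring q long c (no noCopy) = inj₁ (Bridge.NoBlueCopy.Colouring.redCopy d H unif c noCopy f proper x size-x
        (RedPaths.tauBound (Bridge.Red d H unif c) (Bridge.Red-↭ d H unif c) d tau) q M (m≤n⊔m (τ + 3 ∸ 2 * (2 + d)) σ) τ<M ≤-refl long)

  -- Truncated subtraction differs from the integer one only for a negative result, and then it
  -- gives 0, which is at most `σ`.
  integerBound : ∀ k σ τ R s {r} → r ≤ R * s + ((τ + 3 ∸ 2 * k) ⊔ σ) →
    pos r ℤ.≤ pos R ℤ.* pos s ℤ.+ ((pos τ ℤ.- pos 2 ℤ.* pos k ℤ.+ pos 3) ℤ.⊔ pos σ)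
  integerBound k σ τ R s {r} r≤ = begin
    pos r ≤⟨ ℤ.+≤+ r≤ ⟩
    pos (R * s) ℤ.+ pos (M ⊔ σ) ≡⟨ cong (λ z → z ℤ.+ pos (M ⊔ σ)) (ℤ.pos-* R s) ⟩
    pos R ℤ.* pos s ℤ.+ pos (M ⊔ σ) ≤⟨ ℤ.+-monoʳ-≤ (pos R ℤ.* pos s) max≤ ⟩
    pos R ℤ.* pos s ℤ.+ (T ℤ.⊔ pos σ) ∎
    where
    open ℤ.≤-Reasoning
    M = τ + 3 ∸ 2 * k
    T = pos τ ℤ.- pos 2 ℤ.* pos k ℤ.+ pos 3
    T≡ : T ≡ (τ + 3) ℤ.⊖ (2 * k)
    T≡ = trans (ℤ.+-assoc (pos τ) (ℤ.- (pos 2 ℤ.* pos k)) (pos 3)) (trans (cong (λ z → pos τ ℤ.+ z) (ℤ.+-comm (ℤ.- (pos 2 ℤ.* pos k)) (pos 3)))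
      (trans (sym (ℤ.+-assoc (pos τ) (pos 3) (ℤ.- (pos 2 ℤ.* pos k)))) (trans (cong (λ z → pos (τ + 3) ℤ.- z) (sym (ℤ.pos-* 2 k)))
        (ℤ.m-n≡m⊖n (τ + 3) (2 * k)))))
    M≤ : Dec (2 * k ≤ τ + 3) → pos M ℤ.≤ T ℤ.⊔ pos σ
    M≤ (yes le) = ℤ.≤-trans (ℤ.≤-reflexive (trans (sym (ℤ.⊖-≥ le)) (sym T≡))) (ℤ.i≤i⊔j T (pos σ))
    M≤ (no nle) = ℤ.≤-trans (ℤ.≤-reflexive (cong pos (m≤n⇒m∸n≡0 (<⇒≤ (≰⇒> nle))))) (ℤ.≤-trans (ℤ.+≤+ z≤n) (ℤ.i≤j⊔i T (pos σ)))
    max≤ : pos (M ⊔ σ) ℤ.≤ T ℤ.⊔ pos σ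
    max≤ with ⊔-sel M σ
    ... | inj₁ eq = subst (λ m → pos m ℤ.≤ T ℤ.⊔ pos σ) (sym eq) (M≤ (2 * k ≤? τ + 3))
    ... | inj₂ eq = subst (λ m → pos m ℤ.≤ T ℤ.⊔ pos σ) (sym eq) (ℤ.i≤j⊔i T (pos σ))

open import Defs
open import Data.Nat using (ℕ; _≤_; _∸_)
open import Data.Integer using (+_; _+_; _-_; _*_; _⊔_) renaming (_≤_ to _≤ᶻ_)
open import Data.Integer.Divisibility using (_∣_)
open import Data.Product using (∃; _×_)
open import Data.Nat using (zero; suc; s≤s)
open import Data.Nat.Divisibility using (divides)
open import Data.Product using (_,_)
open import Relation.Binary.PropositionalEquality using (refl)
open LoosePathRamsey using (natBound; integerBound)

theorem1p7 : ∀ (k : ℕ) → 3 ≤ k →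
    ∀ {v : ℕ} (H : Hypergraph v) → Uniform k H →
    ∀ (χ σ τ : ℕ) →
    IsChromaticNumber H χ → IsSigma H σ → IsTau (k ∸ 1) σ τ →
    ∃ λ (n₀ : ℕ) → ∀ (n : ℕ) → n₀ ≤ n → (+ k - + 1) ∣ (+ n - + 1) →
    ∃ λ (R : ℕ) → IsRamseyNumber k (loosePath k n) H R ×
    + R ≤ᶻ (+ χ - + 1) * (+ n - + 1) + ((+ τ - + 2 * + k + + 3) ⊔ + σ)
theorem1p7 (suc (suc d)) _ H uniform χ σ τ χ-number σ-number τ-number
  with natBound d H uniform χ σ τ χ-number σ-number τ-number
-- `bound` is in terms of n - 1, hence the `suc`; divisibility supplies the number `q` of edges.
... | R , refl , n₀ , bound = suc n₀ , λ
  { zero ()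
  ; (suc _) (s≤s n₀≤n) (divides q refl) → let r , ramsey , r≤ = bound q n₀≤n in
      r , ramsey , integerBound (suc (suc d)) σ τ R _ r≤ }
theorem1p7 zero ()
theorem1p7 (suc zero) (s≤s ())
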